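{- If for some $\varepsilon,\delta>0$ there is a $(2-\delta)$-approximation algorithm for Roundtrip Radius, or a $(2-\delta)$-approximation algorithm for Max Radius, that runs in $O(m^{2-\varepsilon})$ time on directed graphs with $m$ edges, then the Hitting Set Conjecture is false.
   Context: For a directed graph $G=(V,E)$ let $d(u,v)$ be the length of a shortest directed path from $u$ to $v$ ($\infty$ if none exists). The Roundtrip Radius is $\min_{x\in V}\max_{v\in V}\,(d(x,v)+d(v,x))$. The Max Radius is $\min_{x\in V}\max_{v\in V}\max\{d(x,v),d(v,x)\}$. A $c$-approximation algorithm for one of these parameters $R$ outputs $R^*$ with $R\le R^*\le cR$. Running times are in the standard word-RAM model with $O(\log n)$-bit words. Hitting Set (HS) Conjecture: there is no $\varepsilon>0$ such that for all $c\ge 1$ there is an algorithm that, given two lists of $n$ subsets of a universe $U$ of size $c\log n$, decides in $O(n^{2-\varepsilon})$ time whether there is a set in the first list that intersects every set in the second list. -}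

module Defs where

open import Data.Bool.Base using (Bool; true; false; if_then_else_; _∧_; _∨_; _xor_)
open import Data.Empty using (⊥)
open import Data.Fin.Base as Fin using (Fin; toℕ; fromℕ<)
import Data.Fin.Properties as Fin
open import Data.Fin.Subset using (Subset; _∩_; Nonempty)
open import Data.Integer.Base using (∣_∣; +_)
open import Data.List.Base as List
  using (List; []; _∷_; _++_; length; concatMap; allFin)
open import Data.List.Relation.Unary.Unique.Propositional using (Unique)
open import Data.List.Membership.Propositional using (_∈_)
import Data.List.Membership.DecPropositional as DecMembership
import Data.List.Extrema as Extrema
open import Data.Maybe.Base using (Maybe; just; nothing)
open import Data.Nat
open import Data.Nat.Properties
open import Data.Nat.DivMod using (_/_; _%_)
open import Data.Nat.Induction using (<-rec)
open import Data.Nat.Logarithm using (⌊log₂_⌋; ⌈log₂_⌉)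
open import Data.Product using (∃; ∃-syntax; ∃₂; _×_; _,_; proj₁)
open import Data.Product.Properties using (≡-dec)
import Data.Rational.Base as ℚ
open ℚ using (ℚ; 0ℚ; 1ℚ; ↥_; ↧ₙ_)
open import Data.Sum.Base using (_⊎_; inj₁; inj₂)
open import Data.Unit.Base using (⊤)
open import Data.Vec.Base using (Vec; toList; lookup)
open import Relation.Binary.Bundles using (TotalOrder)
import Relation.Binary.Construct.Add.Supremum.NonStrict _≤_ as Sup
open import Relation.Binary.PropositionalEquality
open import Relation.Nullary using (¬_; Dec; yes; no; contradiction)
open import Relation.Nullary.Construct.Add.Supremum using (_⁺; ⊤⁺; [_])
open import Relation.Nullary.Decidable using (_×-dec_; map′)

------------------------------------------------------------------------
-- ℕ ∪ {∞}

ℕ∞ : Set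
ℕ∞ = ℕ ⁺

≤∞-totalOrder : TotalOrder _ _ _
≤∞-totalOrder = record { isTotalOrder = Sup.≤⁺-isTotalOrder-≡ ≤-isTotalOrder }

open Extrema ≤∞-totalOrder using (min; max)
open import Algebra.Construct.NaturalChoice.Max ≤∞-totalOrder
  using () renaming (_⊔_ to _⊔∞_)

infixl 6 _+∞_

_+∞_ : ℕ∞ → ℕ∞ → ℕ∞
[ k ] +∞ [ l ] = [ k + l ]
[ k ] +∞ ⊤⁺    = ⊤⁺
⊤⁺    +∞ _     = ⊤⁺

-- The default values ⊤⁺ and [ 0 ] are neutral for min and max; they play no
-- role as long as n is nonzero.
minOver maxOver : ∀ {n} → (Fin n → ℕ∞) → ℕ∞
minOver f = min ⊤⁺    (List.map f (allFin _))
maxOver f = max [ 0 ] (List.map f (allFin _))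

------------------------------------------------------------------------
-- Directed graphs

-- A nonempty vertex set, and a finite set of ordered pairs listed without
-- repetition in an arbitrary order.
record Digraph : Set where
  field
    order           : ℕ
    .{{order-nonZero}} : NonZero order
    edges           : List (Fin order × Fin order)
    edges-unique    : Unique edges

  V : Set
  V = Fin order

  size : ℕ
  size = length edges

open Digraph public using (V; order; edges; size)

-- Paths may repeat vertices, which does not affect shortest lengths.
data Path (G : Digraph) : V G → ℕ → V G → Set where
  []  : ∀ {u} → Path G u 0 u
  _∷_ : ∀ {u v w k} → (u , v) ∈ edges G → Path G v k w → Path G u (suc k) w

IsDistance : (G : Digraph) → V G → V G → ℕ∞ → Set
IsDistance G u v [ k ] = Path G u k v × (∀ j → Path G u j v → k ≤ j)
IsDistance G u v ⊤⁺    = ∀ j → ¬ Path G u j v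

module _ (G : Digraph) where

  private
    _∈?_ = DecMembership._∈?_ (≡-dec (Fin._≟_ {order G}) (Fin._≟_ {order G}))

  path? : ∀ u k v → Dec (Path G u k v)
  path? u zero v = map′ (λ { refl → [] }) (λ { [] → refl }) (u Fin.≟ v)
  path? u (suc k) v =
    map′ (λ { (x , e , p) → e ∷ p }) (λ { (e ∷ p) → _ , e , p })
         (Fin.any? λ x → ((u , x) ∈? edges G) ×-dec path? x k v)

  private
    _⊕_ : ∀ {u v w j k} → Path G u j v → Path G v k w → Path G u (j + k) w
    []      ⊕ q = q
    (e ∷ p) ⊕ q = e ∷ (p ⊕ q)

    at : ∀ {u v k} → Path G u k v → Fin (suc k) → V G
    at {u = u} _ Fin.zero    = u
    at (_ ∷ p)   (Fin.suc i) = at p i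

    take : ∀ {u v k} (p : Path G u k v) i → Path G u (toℕ i) (at p i)
    take _       Fin.zero    = []
    take (e ∷ p) (Fin.suc i) = e ∷ take p i

    drop : ∀ {u v k} (p : Path G u k v) i → Path G (at p i) (k ∸ toℕ i) v
    drop p       Fin.zero    = p
    drop (_ ∷ p) (Fin.suc i) = drop p i

    shorten : ∀ {u v k} → order G ≤ k → Path G u k v →
              ∃[ j ] j < k × Path G u j v
    shorten {v = v} {k} n≤k p
      with i , j , i<j , eq ← Fin.pigeonhole (s≤s n≤k) (at p)
      = _ , smaller
      , take p i ⊕ subst (λ x → Path G x (k ∸ toℕ j) v) (sym eq) (drop p j)
      where
      open ≤-Reasoning
      smaller : toℕ i + (k ∸ toℕ j) < k
      smaller = begin-strict
        toℕ i + (k ∸ toℕ j) <⟨ +-monoˡ-< (k ∸ toℕ j) i<j ⟩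
        toℕ j + (k ∸ toℕ j) ≡⟨ m+[n∸m]≡n (≤-pred (Fin.toℕ<n j)) ⟩
        k                   ∎

    below : ∀ {u v} k → Path G u k v → ∃[ j ] j < order G × Path G u j v
    below {u} {v} =
      <-rec (λ k → Path G u k v → ∃[ j ] j < order G × Path G u j v) λ k rec p →
        case k (λ {j} → rec {j}) p
      where
      case : ∀ k →
             (∀ {j} → j < k → Path G u j v → ∃[ i ] i < order G × Path G u i v) →
             Path G u k v → ∃[ i ] i < order G × Path G u i v
      case k rec p with k <? order G
      ... | yes k<n = k , k<n , p
      ... | no  k≮n with j , j<k , q ← shorten (≮⇒≥ k≮n) p = rec j<k q

    least : ∀ u v n → (∃[ k ] IsDistance G u v [ k ]) ⊎
                      (∀ j → j < n → ¬ Path G u j v)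
    least u v zero = inj₂ λ _ ()
    least u v (suc n) with least u v n
    ... | inj₁ found = inj₁ found
    ... | inj₂ none with path? u n v
    ...   | yes p = inj₁ (n , p , λ j q → ≮⇒≥ λ j<n → none j j<n q)
    ...   | no ¬p = inj₂ λ j j<1+n q → case j j<1+n q
      where
      case : ∀ j → j < suc n → ¬ Path G u j v
      case j j<1+n q with m≤n⇒m<n∨m≡n (≤-pred j<1+n)
      ... | inj₁ j<n  = none j j<n q
      ... | inj₂ refl = ¬p q

  distance : ∀ u v → ∃ (IsDistance G u v)
  distance u v with least u v (order G)
  ... | inj₁ (k , d) = [ k ] , d
  ... | inj₂ none    = ⊤⁺ , λ j p →
    let i , i<n , q = below j p in none i i<n q

d : (G : Digraph) → V G → V G → ℕ∞
d G u v = proj₁ (distance G u v)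

RoundtripRadius : Digraph → ℕ∞
RoundtripRadius G = minOver λ x → maxOver λ v → d G x v +∞ d G v x

MaxRadius : Digraph → ℕ∞
MaxRadius G = minOver λ x → maxOver λ v → d G x v ⊔∞ d G v x

-- R ≤ R* ≤ c R, with c ∞ = ∞.
IsApproximation : (c : ℚ) (R R* : ℕ∞) → Set
IsApproximation c [ R ] [ R* ] =
  R ≤ R* × (+ R* ℚ./ 1) ℚ.≤ c ℚ.* (+ R ℚ./ 1)
IsApproximation c ⊤⁺    ⊤⁺     = ⊤
IsApproximation c _     _      = ⊥

------------------------------------------------------------------------
-- Word RAM
--
-- The machine has word-sized registers and an indirectly addressed memory
-- whose addresses are words, and every instruction takes unit time.  With
-- word length w, an instruction producing a value ≥ 2 ^ w has no successor
-- state, so a computation that halts never exceeds the word length.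
-- Wrap-around arithmetic is a special case up to a constant factor, by
-- reducing results modulo a power of two with words of twice the length.

data Op : Set where
  add sub mul div mod and or xor shl shr : Op

-- Bits are combined least significant first.  The first argument bounds the
-- number of bits inspected.
bitwise : ℕ → (Bool → Bool → Bool) → ℕ → ℕ → ℕ
bitwise zero    f x y = 0
bitwise (suc b) f x y =
  (if f (odd x) (odd y) then 1 else 0) + 2 * bitwise b f (x / 2) (y / 2)
  where
  odd : ℕ → Bool
  odd z = z % 2 ≡ᵇ 1

-- Subtraction is truncated at 0, and division by 0 returns 0.
⟦_⟧ : Op → ℕ → ℕ → ℕ
⟦ add ⟧ x y = x + y
⟦ sub ⟧ x y = x ∸ y
⟦ mul ⟧ x y = x * y
⟦ div ⟧ x zero      = 0
⟦ div ⟧ x y@(suc _) = x / y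
⟦ mod ⟧ x zero      = 0
⟦ mod ⟧ x y@(suc _) = x % y
⟦ and ⟧ x y = bitwise (x + y) _∧_ x y
⟦ or  ⟧ x y = bitwise (x + y) _∨_ x y
⟦ xor ⟧ x y = bitwise (x + y) _xor_ x y
⟦ shl ⟧ x y = x * 2 ^ y
⟦ shr ⟧ x zero    = x
⟦ shr ⟧ x (suc y) = ⟦ shr ⟧ x y / 2

Reg Label : Set
Reg   = ℕ
Label = ℕ

data Instr : Set where
  const : (r : Reg) (v : ℕ) → Instr           -- r := v
  op    : (o : Op) (r s t : Reg) → Instr      -- r := s o t
  load  : (r s : Reg) → Instr                 -- r := mem[s]
  store : (r s : Reg) → Instr                 -- mem[r] := s
  jz    : (r : Reg) (l : Label) → Instr       -- if r = 0 then goto l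
  halt  : Instr

Program : Set
Program = List Instr

record State : Set where
  constructor ⟨_,_,_⟩
  field
    pc  : Label
    reg : Reg → ℕ
    mem : ℕ → ℕ

open State public

fetch : Program → Label → Instr
fetch []      _       = halt
fetch (i ∷ _) zero    = i
fetch (_ ∷ P) (suc l) = fetch P l

infixl 20 _[_≔_]

_[_≔_] : (ℕ → ℕ) → ℕ → ℕ → (ℕ → ℕ)
(f [ i ≔ v ]) j = if j ≡ᵇ i then v else f j

setReg : (w : ℕ) → Reg → ℕ → State → Maybe State
setReg w r v ⟨ l , ρ , μ ⟩ =
  if v <ᵇ 2 ^ w then just ⟨ suc l , ρ [ r ≔ v ] , μ ⟩ else nothing

exec : (w : ℕ) → Instr → State → Maybe State
exec w (const r v)  σ = setReg w r v σ
exec w (op o r s t) σ = setReg w r (⟦ o ⟧ (reg σ s) (reg σ t)) σ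
exec w (load r s)   σ = setReg w r (mem σ (reg σ s)) σ
exec w (store r s)  ⟨ l , ρ , μ ⟩ = just ⟨ suc l , ρ , μ [ ρ r ≔ ρ s ] ⟩
exec w (jz r m)     ⟨ l , ρ , μ ⟩ =
  just ⟨ (if ρ r ≡ᵇ 0 then m else suc l) , ρ , μ ⟩
exec w halt         σ = nothing

-- Runs w P σ t τ: with word length w, P started in σ halts in τ after t steps.
data Runs (w : ℕ) (P : Program) : State → ℕ → State → Set where
  stop : ∀ {σ} → fetch P (pc σ) ≡ halt → Runs w P σ 0 σ
  step : ∀ {σ σ′ t τ} → exec w (fetch P (pc σ)) σ ≡ just σ′ →
         Runs w P σ′ t τ → Runs w P σ (suc t) τ

padded : List ℕ → ℕ → ℕ
padded []       _       = 0
padded (x ∷ _)  zero    = x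
padded (_ ∷ xs) (suc i) = padded xs i

initial : List ℕ → State
initial xs = ⟨ 0 , (λ _ → 0) , padded xs ⟩

output : State → ℕ
output σ = reg σ 0

------------------------------------------------------------------------
-- Problems and algorithms

record Problem : Set₁ where
  field
    Instance : Set
    encode   : Instance → List ℕ
    -- word lengths are O(log (scale x))
    scale    : Instance → ℕ
    -- running times are measured as a function of param x
    param    : Instance → ℕ
    Correct  : Instance → ℕ → Set

-- t ≤ C s^(2-ε) for ε = p / q > 0, written as t^q s^p ≤ C s^(2q).  Raising the
-- constant to the power q is immaterial as it is existentially quantified.
_≤_·_^[2-_] : ℕ → ℕ → ℕ → ℚ → Set
t ≤ C · s ^[2- ε ] = t ^ ↧ₙ ε * s ^ ∣ ↥ ε ∣ ≤ C * s ^ (2 * ↧ₙ ε)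

-- A word-RAM program for Π with running time O(param^(2-ε)) as param → ∞; below
-- the cutoff it only has to be correct.
record Algorithm (Π : Problem) (ε : ℚ) : Set where
  open Problem Π
  field
    program  : Program
    wordRate : ℕ
    constant : ℕ
    cutoff   : ℕ
    solves   : ∀ x → ∃₂ λ t τ →
      Runs (wordRate * suc ⌊log₂ scale x ⌋) program (initial (encode x)) t τ ×
      Correct x (output τ) ×
      (cutoff ≤ param x → t ≤ constant · param x ^[2- ε ])

-- Number of vertices, number of edges, then the edges.
encodeDigraph : Digraph → List ℕ
encodeDigraph G = order G ∷ size G ∷
  concatMap (λ (u , v) → toℕ u ∷ toℕ v ∷ []) (edges G)

decode∞ : ℕ → ℕ∞
decode∞ zero    = ⊤⁺
decode∞ (suc k) = [ k ]

Approximating : (c : ℚ) → (Digraph → ℕ∞) → Problem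
Approximating c R = record
  { Instance = Digraph
  ; encode   = encodeDigraph
  ; scale    = order
  ; param    = size
  ; Correct  = λ G out → IsApproximation c (R G) (decode∞ out)
  }

------------------------------------------------------------------------
-- Hitting Set

-- ⌊ c ⌈log₂ n⌉ ⌋, for c ≥ 0
universeSize : ℚ → ℕ → ℕ
universeSize c n = (∣ ↥ c ∣ * ⌈log₂ n ⌉) / ↧ₙ c

record HSInstance (c : ℚ) : Set where
  field
    n : ℕ

  U : ℕ
  U = universeSize c n

  field
    first second : Vec (Subset U) n

HasHittingSet : ∀ {c} → HSInstance c → Set
HasHittingSet I = ∃[ i ] ∀ j → Nonempty (lookup first i ∩ lookup second j)
  where open HSInstance I

-- n, the size of the universe, then one 0/1 word per set and element.
encodeHS : ∀ {c} → HSInstance c → List ℕ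
encodeHS I = n ∷ U ∷ bits first ++ bits second
  where
  open HSInstance I
  bits : Vec (Subset U) n → List ℕ
  bits Ss = concatMap
    (λ S → List.map (λ b → if b then 1 else 0) (toList S)) (toList Ss)

HittingSet : ℚ → Problem
HittingSet c = record
  { Instance = HSInstance c
  ; encode   = encodeHS
  ; scale    = HSInstance.n
  ; param    = HSInstance.n
  ; Correct  = λ I out →
      (HasHittingSet I × out ≡ 1) ⊎ (¬ HasHittingSet I × out ≡ 0)
  }

HittingSetConjecture : Set
HittingSetConjecture =
  ¬ (∃[ ε ] 0ℚ ℚ.< ε × (∀ c → 1ℚ ℚ.≤ c → Algorithm (HittingSet c) ε))

{-# OPTIONS --safe #-}
-- An instance with n sets becomes a digraph with O(n log n) edges made of paths of
-- length L = 4 q, where δ ≥ 1 / q.  A hitting set is a centre of radius about L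
-- (max) or 2 L (roundtrip); if there is none, then every vertex has a partner that
-- is twice as far away, so that a (2 - δ)-approximation decides which case holds.
-- Far-away vertices are certified by potentials, functions that grow by at most 1
-- along every edge.
--
-- For the max radius, aₖ reaches a hub over a path of length L and every vertex from
-- there, while bⱼ needs L steps to reach its elements, which lead on to the sets
-- containing them; so the distance from bⱼ to aₖ is about L or 2 L.
-- Twin source paths z⁰ and z¹ leading to the aₖ are far from everything else.
--
-- For the roundtrip radius, every coordinate of a set (an element, or a digit of its
-- index) is a cycle of length 2 L; a set enters it at its own value and leaves it
-- for the set at the opposite one.  Sets that differ somewhere are thus at distance
-- L in both directions, and bⱼ sits halfway on the cycles of its elements.  Cycles
-- come in two copies, and corresponding vertices of the copies are far apart, as no
-- set distinguishes them.
--
-- The reduction program writes the graph behind its input and runs the relocated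
-- approximation program on it.  If ε = p / r, it takes time m^(2 - 1/r) on m edges,
-- which is O(n^(2 - 1/(2r))) as powers of log n are O(n).
module Submission where

-- Connecting edges cost the centre of a yes-instance up to 2 extra steps on each path, so the radii
-- to be told apart are L + 2 and 2 L (or their doubles). The inequality (2 - 1/q) (L + 2) < 2 L
-- amounts to L > 4 q - 2, whence the choice L = 4 q. On a no-instance every vertex has to fail as a
-- centre, not only the aₖ, and most of each graph serves this purpose. In particular, the bⱼ of the
-- roundtrip graph fail because of one additional binary digit on which all sets agree. Numbering
-- the sets with O(log n) digits is what keeps the number of edges at O(n log n). As the hypothesis
-- and the conclusion speak about programs, the graphs are given by a few double loops over
-- arithmetic expressions. The same rules are compiled to code, enumerated as a list of edges and
-- matched with edges between structured vertices, so each graph only needs a check that its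
-- formulas number its vertices correctly. An overflow blocks the machine. Hence all values are
-- bounded by fixed powers of one number X with O(log n) bits, and the word length is chosen to
-- dominate these powers.

module HittingSetReduction where

  open import Defs
  open import Data.Bool.Base using (Bool; true; false; if_then_else_; T; _∧_)
  import Data.Bool.Properties as Bool
  open import Data.Empty using (⊥-elim)
  open import Data.Fin.Base as Fin using (Fin; toℕ; fromℕ<)
  open import Data.Fin.Patterns using (0F; 1F; 2F; 3F; 4F; 5F; 6F; 7F)
  import Data.Fin.Properties as Fin
  import Data.Fin.Induction as Fin
  open import Data.List.Base using (List; []; _∷_; _++_; length; concatMap; downFrom; map)
  open import Data.List.Properties
    using (length-++; ++-assoc; ++-identityʳ; concatMap-++; concatMap-map;
            length-map; length-downFrom)
  open import Data.List.Membership.Propositional using (_∈_; lose; find)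
  open import Data.List.Membership.Propositional.Properties
    using (∈-++⁺ˡ; ∈-++⁺ʳ; ∈-++⁻; ∈-map⁺; ∈-map⁻; ∈-concatMap⁺; ∈-concatMap⁻;
           ∈-downFrom⁺; ∈-downFrom⁻; ∈-allFin)
  open import Data.List.Relation.Unary.All as All using (All; []; _∷_)
  import Data.List.Relation.Unary.All.Properties as All
  import Data.List.Relation.Unary.AllPairs as AllPairs
  open AllPairs using ([]; _∷_)
  import Data.List.Relation.Unary.AllPairs.Properties as AllPairs
  open import Data.List.Relation.Unary.Any using (here; there)
  import Data.List.Relation.Unary.Any.Properties as Any
  open import Data.List.Relation.Unary.Unique.Propositional using (Unique)
  import Data.List.Relation.Unary.Unique.Propositional.Properties as Unique
  import Data.Fin.Subset as Subset
  import Data.Fin.Subset.Properties as Subset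
  import Data.Integer.Base as ℤ
  import Data.Integer.Properties as ℤ
  import Data.Rational.Base as ℚ
  import Data.Rational.Properties as ℚ
  import Data.Rational.Unnormalised.Base as ℚᵘ
  import Data.Rational.Unnormalised.Properties as ℚᵘ
  open import Data.Vec.Base as Vec using (Vec; []; _∷_; lookup; toList)
  import Data.Vec.Properties as Vec
  open import Data.Maybe.Base using (just)
  open import Data.Nat.Base
  open import Data.Nat.DivMod
    using (_/_; _%_; m/n≤m; m%n≤m; m*n/n≡m; m/n*n≤m; /-monoˡ-≤;
           m%n<n; m≡m%n+[m/n]*n; m<n*o⇒m/o<n; m<n⇒m/n≡0; +-distrib-/-∣ˡ)
  open import Data.Nat.Divisibility using (m∣m*n)
  open import Data.Nat.Coprimality using (1-coprimeTo)
  open import Data.Nat.Properties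
  open import Data.Nat.Logarithm
  open import Algebra.Properties.CommutativeSemigroup *-commutativeSemigroup
    using (x∙yz≈y∙zx; x∙yz≈y∙xz)
  open import Data.Product using (∃-syntax; ∃₂; _×_; _,_; proj₁; proj₂; uncurry)
  open import Data.Sum.Base using (_⊎_; inj₁; inj₂; [_,_]′)
  import Data.Sum.Properties as Sum
  open import Data.Unit.Base using (⊤; tt)
  open import Function.Base using (_∘_; _$_; id)
  open import Relation.Binary.PropositionalEquality
  open import Relation.Nullary.Decidable using (_×-dec_; does; dec-true)
  open import Relation.Nullary using (¬_; Dec; yes; no; contradiction)
  open import Relation.Nullary.Construct.Add.Supremum using (⊤⁺; [_])
  import Relation.Binary.Construct.Add.Supremum.NonStrict _≤_ as Sup
  open Sup using (_≤⁺_; _≤⊤⁺; [_])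
  import Data.List.Extrema ≤∞-totalOrder as Extrema
  import Algebra.Construct.NaturalChoice.Max ≤∞-totalOrder as Max∞

  -- Executions of machine code

  infixr 5 _◅_ _◅◅_

  -- Unlike `Runs`, a segment need not end at `halt`, so that executions of consecutive pieces of
  -- code compose.
  data Steps (w : ℕ) (P : Program) : State → ℕ → State → Set where
    done   : ∀ {σ} → Steps w P σ 0 σ
    _◅_ : ∀ {σ σ′ t τ} → exec w (fetch P (pc σ)) σ ≡ just σ′ →
          Steps w P σ′ t τ → Steps w P σ (suc t) τ

  _◅◅_ : ∀ {w P σ t σ′ t′ τ} → Steps w P σ t σ′ → Steps w P σ′ t′ τ →
         Steps w P σ (t + t′) τ
  done       ◅◅ q = q
  (e ◅ p) ◅◅ q = e ◅ (p ◅◅ q)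

  Steps⇒Runs : ∀ {w P σ t τ} → Steps w P σ t τ → fetch P (pc τ) ≡ halt →
               Runs w P σ t τ
  Steps⇒Runs done       h = stop h
  Steps⇒Runs (e ◅ p) h = step e (Steps⇒Runs p h)

  ≡ᵇ-refl : ∀ n → (n ≡ᵇ n) ≡ true
  ≡ᵇ-refl zero    = refl
  ≡ᵇ-refl (suc n) = ≡ᵇ-refl n

  ≢⇒≡ᵇ : ∀ m n → m ≢ n → (m ≡ᵇ n) ≡ false
  ≢⇒≡ᵇ zero    zero    p = contradiction refl p
  ≢⇒≡ᵇ zero    (suc n) p = refl
  ≢⇒≡ᵇ (suc m) zero    p = refl
  ≢⇒≡ᵇ (suc m) (suc n) p = ≢⇒≡ᵇ m n (p ∘ cong suc)

  update-same : ∀ f i v → (f [ i ≔ v ]) i ≡ v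
  update-same f i v rewrite ≡ᵇ-refl i = refl

  update-other : ∀ f i v {j} → j ≢ i → (f [ i ≔ v ]) j ≡ f j
  update-other f i v {j} p rewrite ≢⇒≡ᵇ j i p = refl

  <⇒<ᵇ≡true : ∀ {m n} → m < n → (m <ᵇ n) ≡ true
  <⇒<ᵇ≡true {m} {n} p with m <ᵇ n | <⇒<ᵇ p
  ... | true | _ = refl

  setReg-just : ∀ w r {v} l ρ μ → v < 2 ^ w →
                setReg w r v ⟨ l , ρ , μ ⟩ ≡ just ⟨ suc l , ρ [ r ≔ v ] , μ ⟩
  setReg-just w r l ρ μ p rewrite <⇒<ᵇ≡true p = refl

  -- Structured programs.  A loop counts its register down to 0 and uses
  -- register 0 as scratch, hence the shifted register index.

  infixr 4 _⨟_

  data Cmd : Set where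
    const′ : (r : Reg) (v : ℕ) → Cmd
    op′    : (o : Op) (r s t : Reg) → Cmd
    load′  : (r s : Reg) → Cmd
    store′ : (r s : Reg) → Cmd
    skip   : Cmd
    _⨟_    : Cmd → Cmd → Cmd
    when   : Reg → Cmd → Cmd
    loop   : (r : Reg) → Cmd → Cmd

  -- Jump targets are absolute, so a forward jump needs the length of code that is yet to be
  -- produced; `length-compile` confirms the prediction.
  end : Label → Cmd → Label
  end k (const′ r v)  = suc k
  end k (op′ o r s t) = suc k
  end k (load′ r s)   = suc k
  end k (store′ r s)  = suc k
  end k skip          = k
  end k (c ⨟ c′)      = end (end k c) c′
  end k (when r c)    = end (suc k) c
  end k (loop r c)    = 2 + end (3 + k) c

  compile : Label → Cmd → Program
  compile k (const′ r v)  = const r v ∷ []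
  compile k (op′ o r s t) = op o r s t ∷ []
  compile k (load′ r s)   = load r s ∷ []
  compile k (store′ r s)  = store r s ∷ []
  compile k skip          = []
  compile k (c ⨟ c′)      = compile k c ++ compile (end k c) c′
  compile k (when r c)    = jz r (end (suc k) c) ∷ compile (suc k) c
  compile k (loop r c)    =
    jz (suc r) (2 + end (3 + k) c) ∷ const 0 1 ∷ op sub (suc r) (suc r) 0 ∷
    -- The machine only jumps on zero; clearing register 0 makes the jump back unconditional.
    (compile (3 + k) c ++ const 0 0 ∷ jz 0 k ∷ [])

  length-compile : ∀ k c → k + length (compile k c) ≡ end k c
  length-compile k (const′ r v)  = +-comm k 1
  length-compile k (op′ o r s t) = +-comm k 1
  length-compile k (load′ r s)   = +-comm k 1
  length-compile k (store′ r s)  = +-comm k 1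
  length-compile k skip          = +-identityʳ k
  length-compile k (c ⨟ c′)      = begin
    k + length (compile k c ++ compile (end k c) c′)
      ≡⟨ cong (k +_) (length-++ (compile k c)) ⟩
    k + (length (compile k c) + length (compile (end k c) c′))
      ≡⟨ +-assoc k _ _ ⟨
    k + length (compile k c) + length (compile (end k c) c′)
      ≡⟨ cong (_+ length (compile (end k c) c′)) (length-compile k c) ⟩
    end k c + length (compile (end k c) c′)
      ≡⟨ length-compile (end k c) c′ ⟩
    end (end k c) c′ ∎
    where open ≡-Reasoning
  length-compile k (when r c) =
    trans (+-suc k _) (length-compile (suc k) c)
  length-compile k (loop r c) = begin
    k + (3 + length (compile (3 + k) c ++ const 0 0 ∷ jz 0 k ∷ []))
      ≡⟨ +-comm k _ ⟩
    3 + length (compile (3 + k) c ++ const 0 0 ∷ jz 0 k ∷ []) + k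
      ≡⟨ cong (λ x → 3 + x + k) (length-++ (compile (3 + k) c)) ⟩
    3 + (length (compile (3 + k) c) + 2) + k
      ≡⟨ cong (3 +_) (trans (cong (_+ k) (+-comm _ 2)) (cong (2 +_) (+-comm _ k))) ⟩
    2 + (3 + k + length (compile (3 + k) c))
      ≡⟨ cong (2 +_) (length-compile (3 + k) c) ⟩
    2 + end (3 + k) c ∎
    where open ≡-Reasoning

  data At (P : Program) : Label → Program → Set where
    []  : ∀ {k} → At P k []
    _∷_ : ∀ {k i is} → fetch P k ≡ i → At P (suc k) is → At P k (i ∷ is)

  At-++⁻ : ∀ {P k} is {js} → At P k (is ++ js) →
           At P k is × At P (k + length is) js
  At-++⁻ {P} {k} [] {js} p = [] , subst (λ l → At P l js) (sym (+-identityʳ k)) p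
  At-++⁻ {P} {k} (i ∷ is) {js} (e ∷ p) with q , r ← At-++⁻ is p =
    e ∷ q , subst (λ l → At P l js) (sym (+-suc k _)) r

  fetch-++ : ∀ is js k → fetch (is ++ js) (length is + k) ≡ fetch js k
  fetch-++ []       js k = refl
  fetch-++ (i ∷ is) js k = fetch-++ is js k

  At-infix : ∀ pre is suf → At (pre ++ is ++ suf) (length pre) is
  At-infix pre []       suf = []
  At-infix pre (i ∷ is) suf =
      trans (cong (fetch (pre ++ i ∷ is ++ suf)) (sym (+-identityʳ (length pre))))
            (fetch-++ pre (i ∷ is ++ suf) 0)
    ∷ subst₂ (λ P k → At P k is)
        (++-assoc pre (i ∷ []) (is ++ suf))
        (trans (length-++ pre) (+-comm _ 1))
        (At-infix (pre ++ i ∷ []) is suf)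

  Store : Set
  Store = (ℕ → ℕ) × (ℕ → ℕ)

  -- Big-step semantics with exact step counts. Every computed or loaded value comes with a proof
  -- that it fits into a word, since an overflowing instruction has no successor state.
  data Ex (w : ℕ) : Cmd → Store → ℕ → Store → Set where
    ex-const : ∀ {r v ρ μ} → v < 2 ^ w →
               Ex w (const′ r v) (ρ , μ) 1 (ρ [ r ≔ v ] , μ)
    ex-op    : ∀ {o r s t ρ μ} → ⟦ o ⟧ (ρ s) (ρ t) < 2 ^ w →
               Ex w (op′ o r s t) (ρ , μ) 1 (ρ [ r ≔ ⟦ o ⟧ (ρ s) (ρ t) ] , μ)
    ex-load  : ∀ {r s ρ μ} → μ (ρ s) < 2 ^ w →
               Ex w (load′ r s) (ρ , μ) 1 (ρ [ r ≔ μ (ρ s) ] , μ)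
    ex-store : ∀ {r s ρ μ} → Ex w (store′ r s) (ρ , μ) 1 (ρ , μ [ ρ r ≔ ρ s ])
    ex-skip  : ∀ {σ} → Ex w skip σ 0 σ
    ex-seq   : ∀ {c c′ σ σ′ τ t t′} → Ex w c σ t σ′ → Ex w c′ σ′ t′ τ →
               Ex w (c ⨟ c′) σ (t + t′) τ
    ex-when₀ : ∀ {r c ρ μ} → ρ r ≡ 0 → Ex w (when r c) (ρ , μ) 1 (ρ , μ)
    ex-when₁ : ∀ {r c ρ μ t τ} → ρ r ≢ 0 → Ex w c (ρ , μ) t τ →
               Ex w (when r c) (ρ , μ) (suc t) τ
    ex-loop₀ : ∀ {r c ρ μ} → ρ (suc r) ≡ 0 → Ex w (loop r c) (ρ , μ) 1 (ρ , μ)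
    ex-loop₁ : ∀ {r c k ρ μ ρ′ μ′ t t′ τ} → ρ (suc r) ≡ suc k →
               1 < 2 ^ w → k < 2 ^ w →
               Ex w c (ρ [ 0 ≔ 1 ] [ suc r ≔ k ] , μ) t (ρ′ , μ′) →
               Ex w (loop r c) (ρ′ [ 0 ≔ 0 ] , μ′) t′ τ →
               -- Three instructions test the counter, load 1 and decrement; two more clear register
               -- 0 and jump back.
               Ex w (loop r c) (ρ , μ) (3 + (t + (2 + t′))) τ

  state : Label → Store → State
  state k (ρ , μ) = ⟨ k , ρ , μ ⟩

  module _ {w : ℕ} {P : Program} where

    step-const : ∀ {k r v ρ μ t τ} → fetch P k ≡ const r v → v < 2 ^ w →
                 Steps w P ⟨ suc k , ρ [ r ≔ v ] , μ ⟩ t τ →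
                 Steps w P ⟨ k , ρ , μ ⟩ (suc t) τ
    step-const e p q =
      trans (cong (λ i → exec w i _) e) (setReg-just w _ _ _ _ p) ◅ q

    step-op : ∀ {k o r s u v ρ μ t τ} → fetch P k ≡ op o r s u →
              ⟦ o ⟧ (ρ s) (ρ u) ≡ v → v < 2 ^ w →
              Steps w P ⟨ suc k , ρ [ r ≔ v ] , μ ⟩ t τ →
              Steps w P ⟨ k , ρ , μ ⟩ (suc t) τ
    step-op e refl p q =
      trans (cong (λ i → exec w i _) e) (setReg-just w _ _ _ _ p) ◅ q

    step-load : ∀ {k r s v ρ μ t τ} → fetch P k ≡ load r s →
                μ (ρ s) ≡ v → v < 2 ^ w →
                Steps w P ⟨ suc k , ρ [ r ≔ v ] , μ ⟩ t τ →
                Steps w P ⟨ k , ρ , μ ⟩ (suc t) τ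
    step-load e refl p q =
      trans (cong (λ i → exec w i _) e) (setReg-just w _ _ _ _ p) ◅ q

    step-store : ∀ {k r s ρ μ t τ} → fetch P k ≡ store r s →
                 Steps w P ⟨ suc k , ρ , μ [ ρ r ≔ ρ s ] ⟩ t τ →
                 Steps w P ⟨ k , ρ , μ ⟩ (suc t) τ
    step-store e q = cong (λ i → exec w i _) e ◅ q

    step-jz₀ : ∀ {k r l ρ μ t τ} → fetch P k ≡ jz r l → ρ r ≡ 0 →
               Steps w P ⟨ l , ρ , μ ⟩ t τ → Steps w P ⟨ k , ρ , μ ⟩ (suc t) τ
    step-jz₀ {k} {r} {l} {ρ} {μ} e p q = trans (cong (λ i → exec w i _) e)
      (cong (λ b → just ⟨ (if b then l else suc k) , ρ , μ ⟩) (cong (_≡ᵇ 0) p)) ◅ q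

    step-jz₁ : ∀ {k r l ρ μ t τ} → fetch P k ≡ jz r l → ρ r ≢ 0 →
               Steps w P ⟨ suc k , ρ , μ ⟩ t τ → Steps w P ⟨ k , ρ , μ ⟩ (suc t) τ
    step-jz₁ {k} {r} {l} {ρ} {μ} e p q = trans (cong (λ i → exec w i _) e)
      (cong (λ b → just ⟨ (if b then l else suc k) , ρ , μ ⟩) (≢⇒≡ᵇ (ρ r) 0 p)) ◅ q

  compile-correct : ∀ {w P} k c {σ t τ} → At P k (compile k c) → Ex w c σ t τ →
                    Steps w P (state k σ) t (state (end k c) τ)
  compile-correct k (const′ r v) (e ∷ []) (ex-const p) = step-const e p done
  compile-correct k (op′ o r s t) (e ∷ []) (ex-op p) = step-op e refl p done
  compile-correct k (load′ r s) (e ∷ []) (ex-load p) = step-load e refl p done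
  compile-correct k (store′ r s) (e ∷ []) ex-store = step-store e done
  compile-correct k skip [] ex-skip = done
  compile-correct {P = P} k (c ⨟ c′) a (ex-seq p q)
    with a₁ , a₂ ← At-++⁻ (compile k c) a =
       compile-correct k c a₁ p
    ◅◅ compile-correct (end k c) c′
         (subst (λ l → At P l (compile (end k c) c′)) (length-compile k c) a₂) q
  compile-correct k (when r c) (e ∷ a) (ex-when₀ p) = step-jz₀ e p done
  compile-correct k (when r c) (e ∷ a) (ex-when₁ p q) =
    step-jz₁ e p (compile-correct (suc k) c a q)
  compile-correct k (loop r c) (e ∷ a) (ex-loop₀ p) = step-jz₀ e p done
  compile-correct {w} {P} k (loop r c) (e₁ ∷ e₂ ∷ e₃ ∷ a)
    (ex-loop₁ {k = m} {ρ} {μ} {ρ′} {μ′} p 1<2^w m<2^w body rest)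
    with a₁ , a₂ ← At-++⁻ (compile (3 + k) c) a
    with e₄ ∷ e₅ ∷ [] ← subst (λ l → At P l (const 0 0 ∷ jz 0 k ∷ []))
                              (length-compile (3 + k) c) a₂ =
    step-jz₁ e₁ (λ q → 0≢1+n (trans (sym q) p))
    (step-const e₂ 1<2^w
    (step-op e₃ (cong (_∸ 1) p) m<2^w
    (compile-correct (3 + k) c a₁ body
    ◅◅ step-const e₄ (<-trans z<s 1<2^w)
    (step-jz₀ e₅ refl
    (compile-correct k (loop r c) (e₁ ∷ e₂ ∷ e₃ ∷ a) rest)))))

  -- Invariant rule: `I k` describes the store with `k` rounds left. The body sees the counter
  -- already decremented and register 0 set to 1, and loop control adds 5 instructions per round.
  loop-count : ∀ {w r c} (I : ℕ → Store → Set) (B N : ℕ) →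
    (∀ {k σ} → I k σ → proj₁ σ (suc r) ≡ k) →
    (∀ {k ρ μ} → k < N → I (suc k) (ρ , μ) →
       ∃₂ λ t ρ′ → ∃[ μ′ ] Ex w c (ρ [ 0 ≔ 1 ] [ suc r ≔ k ] , μ) t (ρ′ , μ′) ×
         t ≤ B × I k (ρ′ [ 0 ≔ 0 ] , μ′)) →
    1 < 2 ^ w → N < 2 ^ w →
    ∀ {σ} → I N σ → ∃₂ λ t τ → Ex w (loop r c) σ t τ × t ≤ 1 + N * (5 + B) × I 0 τ
  loop-count I B zero    get body 1< N< {σ} i =
    _ , _ , ex-loop₀ (get i) , ≤-refl , i
  loop-count I B (suc N) get body 1< N< {σ} i
    with t , ρ′ , μ′ , x , t≤ , i′ ← body ≤-refl i
    with t′ , τ , y , t′≤ , i″ ←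
      loop-count I B N get (λ k<N → body (m<n⇒m<1+n k<N)) 1< (<-trans ≤-refl N<) i′ =
    _ , τ , ex-loop₁ (get i) 1< (<-trans ≤-refl N<) x y , bound , i″
    where
    open ≤-Reasoning
    bound : 3 + (t + (2 + t′)) ≤ 1 + (5 + B + N * (5 + B))
    bound = begin
      3 + (t + (2 + t′))               ≤⟨ +-monoʳ-≤ 3 (+-mono-≤ t≤ (+-monoʳ-≤ 2 t′≤)) ⟩
      3 + (B + (3 + N * (5 + B)))      ≡⟨ cong (3 +_) (+-assoc B 3 _) ⟨
      3 + (B + 3 + N * (5 + B))        ≡⟨ cong (λ x → 3 + (x + N * (5 + B))) (+-comm B 3) ⟩
      1 + (5 + B + N * (5 + B))        ∎

  -- Running P inside a larger program: its registers are shifted by s, its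
  -- addresses by the content of register 3, and every instruction becomes two.

  slot : Label → ℕ → Label
  slot k zero    = k
  slot k (suc l) = slot (2 + k) l

  slot-suc : ∀ k l → slot k (suc l) ≡ 2 + slot k l
  slot-suc k zero    = refl
  slot-suc k (suc l) = slot-suc (2 + k) l

  module Relocation (s : ℕ) (3<s : 3 < s) (k₀ : Label) (P : Program) where

    -- Beyond its end a program halts, so all labels there, however large, are sent to `exit`.
    dest : Label → Label
    dest l = slot k₀ (l ⊓ length P)

    exit : Label
    exit = slot k₀ (length P)

    -- Memory accesses use the first slot to add the base to the address, and `halt` uses it to make
    -- its jump unconditional; elsewhere it only touches the scratch register. The uniform width
    -- keeps the position of a label independent of the instructions before it.
    fst-instr snd-instr : Instr → Instr
    fst-instr (const r v)  = const 0 0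
    fst-instr (op o r a b) = const 0 0
    fst-instr (load r a)   = op add 0 3 (s + a)
    fst-instr (store r a)  = op add 0 3 (s + r)
    fst-instr (jz r l)     = const 0 0
    fst-instr halt         = const 0 0
    snd-instr (const r v)  = const (s + r) v
    snd-instr (op o r a b) = op o (s + r) (s + a) (s + b)
    snd-instr (load r a)   = load (s + r) 0
    snd-instr (store r a)  = store 0 (s + a)
    snd-instr (jz r l)     = jz (s + r) (dest l)
    snd-instr halt         = jz 0 exit

    relocate : Program → Program
    relocate []       = []
    relocate (i ∷ is) = fst-instr i ∷ snd-instr i ∷ relocate is

    fetch-relocate : ∀ {Q k} is → At Q k (relocate is) → ∀ {l} → l < length is →
      fetch Q (slot k l) ≡ fst-instr (fetch is l) ×
      fetch Q (suc (slot k l)) ≡ snd-instr (fetch is l)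
    fetch-relocate (i ∷ is) (e ∷ e′ ∷ a) {zero}  p       = e , e′
    fetch-relocate (i ∷ is) (e ∷ e′ ∷ a) {suc l} (s≤s p) = fetch-relocate is a p

    fetch-beyond : ∀ is {l} → length is ≤ l → fetch is l ≡ halt
    fetch-beyond []       p       = refl
    fetch-beyond (i ∷ is) (s≤s p) = fetch-beyond is p

    private
      s+≢ : ∀ {x} → x ≤ 3 → ∀ r → s + r ≢ x
      s+≢ x≤3 r refl = <⇒≱ 3<s (≤-trans (m≤m+n s r) x≤3)

      update-shift : ∀ f r v j → (f [ s + r ≔ v ]) (s + j) ≡ ((f ∘ (s +_)) [ r ≔ v ]) j
      update-shift f r v j with j ≟ r
      ... | yes refl = trans (update-same f (s + r) v) (sym (update-same (f ∘ (s +_)) r v))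
      ... | no j≢r = trans (update-other f (s + r) v (j≢r ∘ +-cancelˡ-≡ s _ _))
                           (sym (update-other (f ∘ (s +_)) r v j≢r))

    module _ (base : ℕ) where

      -- Register 0 stays unconstrained as scratch space, and so do the cells below `base`, which
      -- the relocated code cannot address.
      record _∼_ (σ τ : Store) : Set where
        constructor sim
        field
          regs : ∀ r → proj₁ τ (s + r) ≡ proj₁ σ r
          adds : proj₁ τ 3 ≡ base
          mems : ∀ a → proj₂ τ (base + a) ≡ proj₂ σ a

      -- Addresses come from registers. The original machine uses them as they are, while the
      -- simulation computes base plus address, which has to fit into a word.
      Small : ℕ → Store → Set
      Small w σ = ∀ r → proj₁ σ r < 2 ^ w

      private
        congᵘ : ∀ {f g : ℕ → ℕ} → (∀ j → f j ≡ g j) → ∀ r {v v′} → v ≡ v′ →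
                ∀ j → (f [ r ≔ v ]) j ≡ (g [ r ≔ v′ ]) j
        congᵘ p r refl j with j ≡ᵇ r
        ... | true  = refl
        ... | false = p j

        scratch : ∀ {σ ρ μ} v → σ ∼ (ρ , μ) → σ ∼ (ρ [ 0 ≔ v ] , μ)
        scratch {ρ = ρ} v (sim regs adds mems) =
          sim (λ r → trans (update-other ρ 0 v (s+≢ z≤n r)) (regs r)) adds mems

        set : ∀ {ρ μ ρ′ μ′} r {v v′} → (ρ , μ) ∼ (ρ′ , μ′) → v′ ≡ v →
              (ρ [ r ≔ v ] , μ) ∼ (ρ′ [ s + r ≔ v′ ] , μ′)
        set {ρ′ = ρ′} r (sim regs adds mems) e = sim
          (λ j → trans (update-shift ρ′ r _ j) (congᵘ regs r e j))
          (trans (update-other ρ′ (s + r) _ (≢-sym (s+≢ ≤-refl r))) adds)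
          mems

        put : ∀ {ρ μ ρ′ μ′} a {a′ v v′} → (ρ , μ) ∼ (ρ′ , μ′) → a′ ≡ base + a → v′ ≡ v →
              (ρ , μ [ a ≔ v ]) ∼ (ρ′ , μ′ [ a′ ≔ v′ ])
        put {μ = μ} {μ′ = μ′} a {v = v} (sim regs adds mems) refl refl = sim regs adds pointwise
          where
          pointwise : ∀ j → (μ′ [ base + a ≔ v ]) (base + j) ≡ (μ [ a ≔ v ]) j
          pointwise j with j ≟ a
          ... | yes refl = trans (update-same μ′ (base + a) v) (sym (update-same μ a v))
          ... | no j≢a = trans (update-other μ′ (base + a) v (j≢a ∘ +-cancelˡ-≡ base _ _))
                               (trans (mems j) (sym (update-other μ a v j≢a)))

        small-set : ∀ {w σ} r v → Small w σ → v < 2 ^ w → Small w (proj₁ σ [ r ≔ v ] , proj₂ σ)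
        small-set r v sm v< j with j ≡ᵇ r
        ... | true  = v<
        ... | false = sm j

        0<2^ : ∀ w → 0 < 2 ^ w
        0<2^ w = m^n>0 2 w

      module _ {w w′ : ℕ} (w≤w′ : w ≤ w′)
               (fits : ∀ {a} → a < 2 ^ w → base + a < 2 ^ w′)
               {Q : Program} (at : At Q k₀ (relocate P)) where

        private
          widen : ∀ {a} → a < 2 ^ w → a < 2 ^ w′
          widen p = <-≤-trans p (^-monoʳ-≤ 2 w≤w′)

          -- The two simulating instructions are kept as a function that prefixes them to any
          -- continuation, so no intermediate state has to be named.
          data Simulated (l : Label) (τ : Store) (σ₁ : State) : Set where
            simulated : ∀ τ₁ → (reg σ₁ , mem σ₁) ∼ τ₁ → Small w (reg σ₁ , mem σ₁) →
              (∀ {t υ} → Steps w′ Q (state (dest (pc σ₁)) τ₁) t υ →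
                         Steps w′ Q (state (dest l) τ) (2 + t) υ) →
              Simulated l τ σ₁

        module _ {l : Label} (l<P : l < length P)
                 (e₁ : fetch Q (slot k₀ l) ≡ fst-instr (fetch P l))
                 (e₂ : fetch Q (suc (slot k₀ l)) ≡ snd-instr (fetch P l)) where

          private
            start : dest l ≡ slot k₀ l
            start = cong (slot k₀) (m≤n⇒m⊓n≡m (<⇒≤ l<P))

            next : dest (suc l) ≡ 2 + slot k₀ l
            next = trans (cong (slot k₀) (m≤n⇒m⊓n≡m l<P)) (slot-suc k₀ l)

            from : ∀ {τ t υ} → Steps w′ Q (state (slot k₀ l) τ) t υ →
                   Steps w′ Q (state (dest l) τ) t υ
            from {τ} {t} {υ} = subst (λ k → Steps w′ Q (state k τ) t υ) (sym start)

            to : ∀ {τ t υ} → Steps w′ Q (state (dest (suc l)) τ) t υ →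
                 Steps w′ Q (state (2 + slot k₀ l) τ) t υ
            to {τ} {t} {υ} = subst (λ k → Steps w′ Q (state k τ) t υ) next

          simulate-instr : ∀ i {ρ μ ρ′ μ′ σ₁} →
            fst-instr i ≡ fst-instr (fetch P l) → snd-instr i ≡ snd-instr (fetch P l) →
            exec w i ⟨ l , ρ , μ ⟩ ≡ just σ₁ → (ρ , μ) ∼ (ρ′ , μ′) → Small w (ρ , μ) →
            Simulated l (ρ′ , μ′) σ₁
          simulate-instr (const r v) f₁ f₂ x r∼ sm
            with v <ᵇ 2 ^ w in v< | x
          ... | true | refl = simulated _ (set r (scratch 0 r∼) refl)
                  (small-set {w} {_ , λ _ → 0} r v sm v<2^w)
                  λ st → from (step-const (trans e₁ (sym f₁)) (0<2^ w′)
                              (step-const (trans e₂ (sym f₂)) (widen v<2^w) (to st)))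
            where v<2^w = <ᵇ⇒< v (2 ^ w) (subst T (sym v<) tt)
          simulate-instr (op o r a b) {ρ} {ρ′ = ρ′} f₁ f₂ x r∼ sm
            with ⟦ o ⟧ (ρ a) (ρ b) <ᵇ 2 ^ w in v< | x
          ... | true | refl = simulated _ (set r (scratch 0 r∼) refl)
                  (small-set {w} {_ , λ _ → 0} r _ sm v<2^w)
                  λ st → from (step-const (trans e₁ (sym f₁)) (0<2^ w′)
                              (step-op (trans e₂ (sym f₂))
                                (cong₂ ⟦ o ⟧ (_∼_.regs (scratch 0 r∼) a)
                                    (_∼_.regs (scratch 0 r∼) b))
                                (widen v<2^w) (to st)))
            where
            v<2^w = <ᵇ⇒< _ (2 ^ w) (subst T (sym v<) tt)
          simulate-instr (load r a) {ρ} {μ} f₁ f₂ x r∼ sm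
            with μ (ρ a) <ᵇ 2 ^ w in v< | x
          ... | true | refl = simulated _ (set r (scratch _ r∼) refl)
                  (small-set {w} {_ , λ _ → 0} r _ sm v<2^w)
                  λ st → from (step-op (trans e₁ (sym f₁))
                                (cong₂ _+_ (_∼_.adds r∼) (_∼_.regs r∼ a)) (fits (sm a))
                              (step-load (trans e₂ (sym f₂)) (_∼_.mems r∼ (ρ a))
                                (widen v<2^w) (to st)))
            where v<2^w = <ᵇ⇒< _ (2 ^ w) (subst T (sym v<) tt)
          simulate-instr (store r a) {ρ} {μ} f₁ f₂ refl r∼ sm =
            simulated _ (put (ρ r) (scratch _ r∼) refl (_∼_.regs (scratch _ r∼) a)) sm
              λ st → from (step-op (trans e₁ (sym f₁))
                            (cong₂ _+_ (_∼_.adds r∼) (_∼_.regs r∼ r)) (fits (sm r))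
                          (step-store (trans e₂ (sym f₂)) (to st)))
          simulate-instr (jz r m) {ρ} f₁ f₂ x r∼ sm with ρ r in ρr | x
          ... | zero | refl = simulated _ (scratch 0 r∼) sm
                  λ st → from (step-const (trans e₁ (sym f₁)) (0<2^ w′)
                              (step-jz₀ (trans e₂ (sym f₂))
                                (trans (_∼_.regs (scratch 0 r∼) r) ρr) st))
          ... | suc _ | refl = simulated _ (scratch 0 r∼) sm
                  λ st → from (step-const (trans e₁ (sym f₁)) (0<2^ w′)
                              (step-jz₁ (trans e₂ (sym f₂))
                                (λ p → 0≢1+n (trans (sym p)
                                    (trans (_∼_.regs (scratch 0 r∼) r) ρr)))
                                (to st)))
          simulate-instr halt f₁ f₂ () r∼ sm

        simulate : ∀ {σ t τ υ} → Runs w P σ t τ → (reg σ , mem σ) ∼ υ →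
                   Small w (reg σ , mem σ) →
                   ∃₂ λ t′ υ′ → Steps w′ Q (state (dest (pc σ)) υ) t′ (state exit υ′) ×
                     t′ ≤ 2 + 2 * t × proj₁ υ′ s ≡ reg τ 0
        -- The program may stop at an explicit `halt`, which takes two more steps to leave, or
        -- beyond its last instruction, where `dest` already is `exit`.
        simulate {σ} {υ = ρ′ , μ′} (stop h) r∼ sm with pc σ <? length P
        ... | yes l<P with e₁ , e₂ ← fetch-relocate P at l<P =
          _ , _ , subst (λ k → Steps w′ Q (state k (ρ′ , μ′)) 2 _)
                    (sym (cong (slot k₀) (m≤n⇒m⊓n≡m (<⇒≤ l<P))))
                    (step-const (trans e₁ (cong fst-instr h)) (0<2^ w′)
                    (step-jz₀ (trans e₂ (cong snd-instr h)) refl done))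
            , ≤-refl
            , trans (cong (ρ′ [ 0 ≔ 0 ]) (sym (+-identityʳ s)))
                    (_∼_.regs (scratch 0 r∼) 0)
        ... | no l≮P = _ , _
            , subst (λ k → Steps w′ Q (state (dest (pc σ)) (ρ′ , μ′)) 0 (state k (ρ′ , μ′)))
                    (cong (slot k₀) (m≥n⇒m⊓n≡n (≮⇒≥ l≮P))) done
            , z≤n
            , trans (cong ρ′ (sym (+-identityʳ s))) (_∼_.regs r∼ 0)
        simulate {σ} {υ = ρ′ , μ′} (step {t = t} x rest) r∼ sm with pc σ <? length P
        ... | no l≮P = contradiction
                (trans (sym x) (cong (λ i → exec w i σ) (fetch-beyond P (≮⇒≥ l≮P)))) λ ()
        ... | yes l<P
          with e₁ , e₂ ← fetch-relocate P at l<P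
          with simulated τ₁ r∼₁ sm₁ k ←
            simulate-instr l<P e₁ e₂ (fetch P (pc σ)) refl refl x r∼ sm
          with t′ , υ′ , st , t′≤ , out ← simulate rest r∼₁ sm₁ =
          _ , υ′ , k st , bound , out
          where
          open ≤-Reasoning
          bound : 2 + t′ ≤ 2 + 2 * suc t
          bound = begin
            2 + t′          ≤⟨ +-monoʳ-≤ 2 t′≤ ⟩
            2 + (2 + 2 * t) ≡⟨ cong (2 +_) (*-suc 2 t) ⟨
            2 + 2 * suc t   ∎

  -- Expressions over the input

  data Arith : Set where
    plus minus times over rem shift : Arith

  toOp : Arith → Op
  toOp plus  = add
  toOp minus = sub
  toOp times = mul
  toOp over  = div
  toOp rem   = mod
  toOp shift = shr

  infixl 6 _⊞_ _⊟_
  infixl 7 _⊠_ _⊘_ _⊛_ _≫_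

  data Exp : Set where
    #n #U #i #j : Exp
    lit         : ℕ → Exp
    bin         : Arith → Exp → Exp → Exp
    ld          : Exp → Exp

  pattern _⊞_ a b = bin plus a b
  pattern _⊟_ a b = bin minus a b
  pattern _⊠_ a b = bin times a b
  pattern _⊘_ a b = bin over a b
  pattern _⊛_ a b = bin rem a b
  pattern _≫_ a b = bin shift a b

  record Env : Set where
    constructor env
    field
      n U i j : ℕ
      inp     : ℕ → ℕ

  eval : Exp → Env → ℕ
  eval #n          E = Env.n E
  eval #U          E = Env.U E
  eval #i          E = Env.i E
  eval #j          E = Env.j E
  eval (lit c)     E = c
  eval (bin o a b) E = ⟦ toOp o ⟧ (eval a E) (eval b E)
  eval (ld a)      E = Env.inp E (eval a E)

  -- Only addresses below base are guaranteed to hold the input.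
  Reads : ℕ → Exp → Env → Set
  Reads base (bin o a b) E = Reads base a E × Reads base b E
  Reads base (ld a)      E = Reads base a E × eval a E < base
  Reads base _           E = ⊤

  -- Values grow at most like X ^ deg e when the variables are bounded by X.
  deg height cost : Exp → ℕ
  deg (lit c)     = suc c
  deg (bin o a b) = deg a + deg b
  deg (ld a)      = deg a
  deg _           = 1
  height (bin o a b) = height a ⊔ suc (height b)
  height (ld a)      = height a
  height _           = 1
  cost (lit c)     = 1
  cost (bin o a b) = cost a + (cost b + 1)
  cost (ld a)      = cost a + 1
  cost _           = 2

  move : Reg → Reg → Cmd
  move d r = const′ d 0 ⨟ op′ add d r d

  -- Stack discipline: the value of `e` ends up in `d`, and only the `height e` registers from `d`
  -- on are touched.
  calc : Exp → Reg → Cmd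
  calc #n          d = move d 1
  calc #U          d = move d 2
  calc #i          d = move d 5
  calc #j          d = move d 6
  calc (lit c)     d = const′ d c
  calc (bin o a b) d = calc a d ⨟ calc b (suc d) ⨟ op′ (toOp o) d d (suc d)
  calc (ld a)      d = calc a d ⨟ load′ d d

  record Within (X : ℕ) (E : Env) : Set where
    field
      n≤   : Env.n E ≤ X
      U≤   : Env.U E ≤ X
      i≤   : Env.i E ≤ X
      j≤   : Env.j E ≤ X
      inp≤ : ∀ a → Env.inp E a ≤ X

  -- Register allocation of the reduction program: 0 is scratch, 1 and 2 hold n and U, 3 the base of
  -- the output, 4 the next free cell, 5 and 6 the loop counters, and expressions are evaluated on a
  -- stack from 7 on.
  record Loaded (base : ℕ) (E : Env) (σ : Store) : Set where
    field
      r₁  : proj₁ σ 1 ≡ Env.n E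
      r₂  : proj₁ σ 2 ≡ Env.U E
      r₅  : proj₁ σ 5 ≡ Env.i E
      r₆  : proj₁ σ 6 ≡ Env.j E
      low : ∀ a → a < base → proj₂ σ a ≡ Env.inp E a

  -- Positive degrees keep all bounds X ^ `deg e` at 2 or more, which is why a literal `c` has
  -- degree `suc c` rather than `c`.
  deg>0 : ∀ e → 0 < deg e
  deg>0 #n          = z<s
  deg>0 #U          = z<s
  deg>0 #i          = z<s
  deg>0 #j          = z<s
  deg>0 (lit c)     = z<s
  deg>0 (bin o a b) = <-≤-trans (deg>0 a) (m≤m+n (deg a) (deg b))
  deg>0 (ld a)      = deg>0 a

  m<2^m : ∀ m → m < 2 ^ m
  m<2^m zero    = z<s
  m<2^m (suc m) = begin-strict
    suc m         <⟨ +-monoʳ-< 1 (m<2^m m) ⟩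
    1 + 2 ^ m     ≤⟨ +-monoˡ-≤ (2 ^ m) (m^n>0 2 m) ⟩
    2 ^ m + 2 ^ m ≡⟨ cong (2 ^ m +_) (+-identityʳ (2 ^ m)) ⟨
    2 ^ suc m     ∎
    where open ≤-Reasoning

  m≤m^n : ∀ m n .{{_ : NonZero m}} → 0 < n → m ≤ m ^ n
  m≤m^n m n n>0 = ≤-trans (≤-reflexive (sym (^-identityʳ m))) (^-monoʳ-≤ m n>0)

  -- Bounds sums like products, so that degrees add up under every operation alike.
  m+n≤m*n : ∀ {m n} → 2 ≤ m → 2 ≤ n → m + n ≤ m * n
  m+n≤m*n {m} {n} 2≤m 2≤n with ≤-total m n
  ... | inj₁ m≤n = begin
    m + n ≤⟨ +-monoˡ-≤ n m≤n ⟩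
    n + n ≡⟨ cong (n +_) (+-identityʳ n) ⟨
    2 * n ≤⟨ *-monoˡ-≤ n 2≤m ⟩
    m * n ∎
    where open ≤-Reasoning
  ... | inj₂ n≤m = begin
    m + n ≤⟨ +-monoʳ-≤ m n≤m ⟩
    m + m ≡⟨ cong (m +_) (+-identityʳ m) ⟨
    2 * m ≡⟨ *-comm 2 m ⟩
    m * 2 ≤⟨ *-monoʳ-≤ m 2≤n ⟩
    m * n ∎
    where open ≤-Reasoning

  shr-≤ : ∀ x y → ⟦ shr ⟧ x y ≤ x
  shr-≤ x zero    = ≤-refl
  shr-≤ x (suc y) = ≤-trans (m/n≤m (⟦ shr ⟧ x y) 2) (shr-≤ x y)

  module _ {X : ℕ} (2≤X : 2 ≤ X) where

    private instance
      X-nonZero : NonZero X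
      X-nonZero = >-nonZero (<-≤-trans z<s 2≤X)

    arith-bound : ∀ o {x y a b} → 0 < a → 0 < b → x ≤ X ^ a → y ≤ X ^ b →
                  ⟦ toOp o ⟧ x y ≤ X ^ (a + b)
    arith-bound o {x} {y} {a} {b} 0<a 0<b x≤ y≤ = go o y y≤
      where
      open ≤-Reasoning
      grow : ∀ {z} → z ≤ x → z ≤ X ^ (a + b)
      grow z≤x = ≤-trans z≤x (≤-trans x≤ (^-monoʳ-≤ X (m≤m+n a b)))
      go : ∀ o y → y ≤ X ^ b → ⟦ toOp o ⟧ x y ≤ X ^ (a + b)
      go plus y y≤ = begin
        x + y           ≤⟨ +-mono-≤ x≤ y≤ ⟩
        X ^ a + X ^ b   ≤⟨ m+n≤m*n (≤-trans 2≤X (m≤m^n X a 0<a)) (≤-trans 2≤X (m≤m^n X b 0<b)) ⟩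
        X ^ a * X ^ b   ≡⟨ ^-distribˡ-+-* X a b ⟨
        X ^ (a + b)     ∎
      go times y y≤ = begin
        x * y           ≤⟨ *-mono-≤ x≤ y≤ ⟩
        X ^ a * X ^ b   ≡⟨ ^-distribˡ-+-* X a b ⟨
        X ^ (a + b)     ∎
      go minus y       y≤ = grow (m∸n≤m x y)
      go over  zero    y≤ = z≤n
      go over  (suc y) y≤ = grow (m/n≤m x (suc y))
      go rem   zero    y≤ = z≤n
      go rem   (suc y) y≤ = grow (m%n≤m x (suc y))
      go shift y       y≤ = grow (shr-≤ x y)

    eval-bound : ∀ {E} → Within X E → ∀ e → eval e E ≤ X ^ deg e
    eval-bound W #n          = ≤-trans (Within.n≤ W) (m≤m^n X 1 z<s)
    eval-bound W #U          = ≤-trans (Within.U≤ W) (m≤m^n X 1 z<s)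
    eval-bound W #i          = ≤-trans (Within.i≤ W) (m≤m^n X 1 z<s)
    eval-bound W #j          = ≤-trans (Within.j≤ W) (m≤m^n X 1 z<s)
    eval-bound W (lit c)     = begin
      c         ≤⟨ <⇒≤ (m<2^m c) ⟩
      2 ^ c     ≤⟨ ^-monoˡ-≤ c 2≤X ⟩
      X ^ c     ≤⟨ ^-monoʳ-≤ X (n≤1+n c) ⟩
      X ^ suc c ∎
      where open ≤-Reasoning
    eval-bound W (bin o a b) =
      arith-bound o (deg>0 a) (deg>0 b) (eval-bound W a) (eval-bound W b)
    eval-bound W (ld a)      = ≤-trans (Within.inp≤ W _) (m≤m^n X (deg a) (deg>0 a))

    module _ {w base : ℕ} {E : Env} (W : Within X E) where

      Calculates : Exp → Reg → ℕ → Store → Set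
      Calculates e d h (ρ , μ) = ∃[ ρ′ ] Ex w (calc e d) (ρ , μ) (cost e) (ρ′ , μ) ×
        ρ′ d ≡ eval e E × (∀ x → x < d ⊎ d + h ≤ x → ρ′ x ≡ ρ x)

      Loaded-respects : ∀ {ρ ρ′ μ d} → 7 ≤ d → (∀ x → x < d → ρ′ x ≡ ρ x) →
                        Loaded base E (ρ , μ) → Loaded base E (ρ′ , μ)
      Loaded-respects 7≤d k L = record
        { r₁ = trans (k 1 (at 1)) (Loaded.r₁ L) ; r₂ = trans (k 2 (at 2)) (Loaded.r₂ L)
        ; r₅ = trans (k 5 (at 5)) (Loaded.r₅ L) ; r₆ = trans (k 6 (at 6)) (Loaded.r₆ L)
        ; low = Loaded.low L }
        where
        at : ∀ x {x<7 : T (x <ᵇ 7)} → x < _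
        at x {p} = <-≤-trans (<ᵇ⇒< x 7 p) 7≤d

      private
        outside : ∀ {x d h} → 0 < h → x < d ⊎ d + h ≤ x → x ≢ d
        outside 0<h (inj₁ x<d) refl = <-irrefl refl x<d
        outside {x} 0<h (inj₂ p) refl = <-irrefl refl (<-≤-trans (m<m+n x 0<h) p)

      calc-correct : ∀ e d {σ} → 7 ≤ d → X ^ deg e < 2 ^ w → Reads base e E → Loaded base E σ →
                     Calculates e d (height e) σ
      calc-var : ∀ d r {v ρ μ} → r < d → v ≤ X → X ^ 1 < 2 ^ w → ρ r ≡ v →
        ∃[ ρ′ ] Ex w (move d r) (ρ , μ) 2 (ρ′ , μ) × ρ′ d ≡ v ×
          (∀ x → x < d ⊎ d + 1 ≤ x → ρ′ x ≡ ρ x)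
      calc-var d r {v} {ρ} r<d v≤X X<2^w ρr =
        _ , ex-seq (ex-const (≤-<-trans z≤n X<2^w))
                   (ex-op (subst (_< 2 ^ w) (sym value) v<2^w))
        , trans (update-same (ρ [ d ≔ 0 ]) d _) value
        , λ x p → trans (update-other (ρ [ d ≔ 0 ]) d _ (outside z<s p))
            (update-other ρ d _ (outside z<s p))
        where
        v<2^w = ≤-<-trans v≤X (subst (_< 2 ^ w) (^-identityʳ X) X<2^w)
        value : (ρ [ d ≔ 0 ]) r + (ρ [ d ≔ 0 ]) d ≡ v
        value = trans (cong₂ _+_ (trans (update-other ρ d 0 (<⇒≢ r<d)) ρr) (update-same ρ d 0))
                      (+-identityʳ v)
      calc-correct #n d 7≤d X< rd L =
        calc-var d 1 (<-≤-trans (<ᵇ⇒< 1 7 tt) 7≤d) (Within.n≤ W) X< (Loaded.r₁ L)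
      calc-correct #U d 7≤d X< rd L =
        calc-var d 2 (<-≤-trans (<ᵇ⇒< 2 7 tt) 7≤d) (Within.U≤ W) X< (Loaded.r₂ L)
      calc-correct #i d 7≤d X< rd L =
        calc-var d 5 (<-≤-trans (<ᵇ⇒< 5 7 tt) 7≤d) (Within.i≤ W) X< (Loaded.r₅ L)
      calc-correct #j d 7≤d X< rd L =
        calc-var d 6 (<-≤-trans (<ᵇ⇒< 6 7 tt) 7≤d) (Within.j≤ W) X< (Loaded.r₆ L)
      calc-correct (lit c) d {ρ , μ} 7≤d X< rd L =
        _ , ex-const (≤-<-trans (eval-bound W (lit c)) X<) , update-same ρ d c
        , λ x p → update-other ρ d _ (outside z<s p)
      calc-correct (bin o a b) d {ρ , μ} 7≤d X< (rda , rdb) L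
        with ρ₁ , x₁ , v₁ , k₁ ← calc-correct a d {ρ , μ} 7≤d
               (≤-<-trans (^-monoʳ-≤ X (m≤m+n (deg a) (deg b))) X<) rda L
        with ρ₂ , x₂ , v₂ , k₂ ← calc-correct b (suc d) {ρ₁ , μ} (m≤n⇒m≤1+n 7≤d)
               (≤-<-trans (^-monoʳ-≤ X (m≤n+m (deg b) (deg a))) X<) rdb
               (Loaded-respects 7≤d (λ x x<d → k₁ x (inj₁ x<d)) L) =
        _ , ex-seq x₁ (ex-seq x₂ (ex-op (subst (_< 2 ^ w) (sym value)
              (≤-<-trans (eval-bound W (bin o a b)) X<))))
        , trans (update-same ρ₂ d _) value
        , kept
        where
        value : ⟦ toOp o ⟧ (ρ₂ d) (ρ₂ (suc d)) ≡ eval (bin o a b) E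
        value = cong₂ ⟦ toOp o ⟧ (trans (k₂ d (inj₁ ≤-refl)) v₁) v₂
        split : ∀ x → x < d ⊎ d + (height a ⊔ suc (height b)) ≤ x →
                (x < suc d ⊎ suc d + height b ≤ x) × (x < d ⊎ d + height a ≤ x) × x ≢ d
        split x (inj₁ p) = inj₁ (m<n⇒m<1+n p) , inj₁ p , <⇒≢ p
        split x (inj₂ p) =
            inj₂ (≤-trans (≤-reflexive (sym (+-suc d (height b))))
                          (≤-trans (+-monoʳ-≤ d (m≤n⊔m (height a) _)) p))
          , inj₂ (≤-trans (+-monoʳ-≤ d (m≤m⊔n (height a) _)) p)
          , ≢-sym (<⇒≢ (<-≤-trans (m<m+n d (<-≤-trans z<s (m≤n⊔m (height a) (suc (height b)))))
              p))
        kept : ∀ x → x < d ⊎ d + (height a ⊔ suc (height b)) ≤ x → _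
        kept x p with p₁ , p₂ , p₃ ← split x p =
          trans (update-other ρ₂ d _ p₃) (trans (k₂ x p₁) (k₁ x p₂))
      calc-correct (ld a) d {ρ , μ} 7≤d X< (rda , lo) L
        with ρ₁ , x₁ , v₁ , k₁ ← calc-correct a d {ρ , μ} 7≤d X< rda L =
        _ , ex-seq x₁ (ex-load (subst (_< 2 ^ w) (sym value)
              (≤-<-trans (eval-bound W (ld a)) X<)))
        , trans (update-same ρ₁ d _) value
        , λ x p → trans (update-other ρ₁ d _ (outside (height>0 a) p)) (k₁ x p)
        where
        value : μ (ρ₁ d) ≡ Env.inp E (eval a E)
        value = trans (cong μ v₁) (Loaded.low L _ lo)
        height>0 : ∀ e → 0 < height e
        height>0 #n          = z<s
        height>0 #U          = z<s
        height>0 #i          = z<s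
        height>0 #j          = z<s
        height>0 (lit c)     = z<s
        height>0 (bin o a b) = <-≤-trans z<s (m≤n⊔m (height a) (suc (height b)))
        height>0 (ld a)      = height>0 a

  -- Graphs given by rules that emit edges

  record Rule : Set where
    field
      count₁ count₂ cond src dst : Exp

  open Rule

  flat : List (ℕ × ℕ) → List ℕ
  flat = concatMap λ (x , y) → x ∷ y ∷ []

  flat-++ : ∀ xs ys → flat (xs ++ ys) ≡ flat xs ++ flat ys
  flat-++ xs ys = concatMap-++ _ xs ys

  length-flat : ∀ xs → length (flat xs) ≡ 2 * length xs
  length-flat []       = refl
  length-flat (x ∷ xs) = trans (cong (2 +_) (length-flat xs)) (sym (*-suc 2 (length xs)))

  padded-snoc : ∀ xs v k → padded (xs ++ v ∷ []) k ≡ (padded xs [ length xs ≔ v ]) k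
  padded-snoc []       v zero    = refl
  padded-snoc []       v (suc k) = refl
  padded-snoc (x ∷ xs) v zero    = refl
  padded-snoc (x ∷ xs) v (suc k) = padded-snoc xs v k

  infixr 6 _&_

  _&_ : Env → ℕ × ℕ → Env
  E & (k , l) = record E { i = k ; j = l }

  emit₂ : Rule → Env → ℕ → ℕ → List (ℕ × ℕ)
  emit₂ r E k l =
    if eval (cond r) (E & (k , l)) ≡ᵇ 0 then []
    else (eval (src r) (E & (k , l)) , eval (dst r) (E & (k , l))) ∷ []

  -- The loops of `ruleCode` count down, and `downFrom` lists the indices in the same order; thus
  -- list and memory agree cell by cell.
  emit₁ : Rule → Env → ℕ → List (ℕ × ℕ)
  emit₁ r E k = concatMap (emit₂ r E k) (downFrom (eval (count₂ r) (E & (k , 0))))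

  emit : Rule → Env → List (ℕ × ℕ)
  emit r E = concatMap (emit₁ r E) (downFrom (eval (count₁ r) (E & (0 , 0))))

  emits : ∀ {R} → (Fin R → Rule) → Env → List (ℕ × ℕ)
  emits {zero}  rs E = []
  emits {suc R} rs E = emit (rs 0F) E ++ emits (rs ∘ Fin.suc) E

  emit₂-inactive : ∀ r E {k l} → eval (cond r) (E & (k , l)) ≡ 0 → emit₂ r E k l ≡ []
  emit₂-inactive r E p rewrite p = refl

  emit₂-active : ∀ r E {k l} → eval (cond r) (E & (k , l)) ≢ 0 →
    emit₂ r E k l ≡ (eval (src r) (E & (k , l)) , eval (dst r) (E & (k , l))) ∷ []
  emit₂-active r E {k} {l} p rewrite ≢⇒≡ᵇ (eval (cond r) (E & (k , l))) 0 p = refl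

  assign : Reg → Exp → Cmd
  assign r e = calc e 7 ⨟ const′ 0 0 ⨟ op′ add r 7 0

  push : Cmd
  push = store′ 4 7 ⨟ const′ 0 1 ⨟ op′ add 4 4 0

  emitCode : Rule → Cmd
  emitCode r = calc (src r) 7 ⨟ push ⨟ calc (dst r) 7 ⨟ push

  ruleCode : Rule → Cmd
  ruleCode r =
    -- With the shifted register index, `loop 4` counts in register 5 and `loop 5` in register 6,
    -- where expressions find `#i` and `#j`.
    assign 5 (count₁ r) ⨟ loop 4 (
      assign 6 (count₂ r) ⨟ loop 5 (
        calc (cond r) 7 ⨟ when 7 (emitCode r)))

  rulesCode : ∀ {R} → (Fin R → Rule) → Cmd
  rulesCode {zero}  rs = skip
  rulesCode {suc R} rs = ruleCode (rs 0F) ⨟ rulesCode (rs ∘ Fin.suc)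

  bodyCost : Rule → ℕ
  bodyCost r = cost (cond r) + (1 + (cost (src r) + (3 + (cost (dst r) + 3))))

  ruleCost : Env → Rule → ℕ → ℕ
  ruleCost E r T₂ = cost (count₁ r) + 2 + (1 + eval (count₁ r) (E & (0 , 0)) *
    (5 + (cost (count₂ r) + 2 + (1 + T₂ * (5 + bodyCost r)))))

  rulesCost : ∀ {R} → Env → (Fin R → Rule) → (Fin R → ℕ) → ℕ
  rulesCost {zero}  E rs T₂ = 0
  rulesCost {suc R} E rs T₂ =
    ruleCost E (rs 0F) (T₂ 0F) + rulesCost E (rs ∘ Fin.suc) (T₂ ∘ Fin.suc)

  -- The bound on the outer index becomes the bound on the variables of the inner count, and the
  -- bound on that count the one for the remaining expressions. Iterated powers multiply the
  -- degrees.
  ruleDeg : Rule → ℕ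
  ruleDeg r = deg (count₁ r) * (deg (count₂ r) * (deg (cond r) + (deg (src r) + deg (dst r))))

  ruleHeight : Rule → ℕ
  ruleHeight r = height (count₁ r) + (height (count₂ r) +
    (height (cond r) + (height (src r) + height (dst r))))

  -- s bounds the registers used, and everything from address base on is free.
  module Emission (w s base : ℕ) (7<s : 7 < s) (E : Env) (hdr : ℕ) where

    -- Cell `base` holds the number of vertices. The next one is left for the number of edges, which
    -- is known only at the end, so the edges start at `2 + base`. By `high`, the registers of the
    -- relocated program keep their initial value 0.
    record Inv (k l : ℕ) (zs : List ℕ) (σ : Store) : Set where
      field
        loaded : Loaded base (E & (k , l)) σ
        r₃     : proj₁ σ 3 ≡ base
        r₄     : proj₁ σ 4 ≡ 2 + base + length zs
        high   : ∀ r → s ≤ r → proj₁ σ r ≡ 0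
        head   : proj₂ σ base ≡ hdr
        out    : ∀ a → proj₂ σ (2 + base + a) ≡ padded zs a

    open Inv
    open Loaded

    s≤⇒≢ : ∀ {r} x {_ : T (x <ᵇ 8)} → s ≤ r → r ≢ x
    s≤⇒≢ x {p} s≤r refl = <⇒≱ (<-≤-trans (<ᵇ⇒< x 8 p) 7<s) s≤r

    inv-update : ∀ {k l k′ l′ zs ρ ρ′ μ} → ρ′ 1 ≡ ρ 1 → ρ′ 2 ≡ ρ 2 → ρ′ 3 ≡ ρ 3 →
      ρ′ 4 ≡ ρ 4 → ρ′ 5 ≡ k′ → ρ′ 6 ≡ l′ → (∀ r → s ≤ r → ρ′ r ≡ ρ r) →
      Inv k l zs (ρ , μ) → Inv k′ l′ zs (ρ′ , μ)
    inv-update e₁ e₂ e₃ e₄ e₅ e₆ e v = record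
      { loaded = record { r₁ = trans e₁ (r₁ (loaded v)) ; r₂ = trans e₂ (r₂ (loaded v))
                        ; r₅ = e₅ ; r₆ = e₆ ; low = low (loaded v) }
      ; r₃ = trans e₃ (r₃ v) ; r₄ = trans e₄ (r₄ v)
      ; high = λ r p → trans (e r p) (high v r p) ; head = head v ; out = out v }

    inv-scratch : ∀ {k l zs ρ μ} v → Inv k l zs (ρ , μ) → Inv k l zs (ρ [ 0 ≔ v ] , μ)
    inv-scratch {ρ = ρ} v I = inv-update refl refl refl refl (r₅ (loaded I)) (r₆ (loaded I))
      (λ r p → update-other ρ 0 v (s≤⇒≢ 0 p)) I

    inv-set₅ : ∀ {k l zs ρ μ k′ v} → v ≡ k′ → Inv k l zs (ρ , μ) → Inv k′ l zs (ρ [ 5 ≔ v ] , μ)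
    inv-set₅ {ρ = ρ} {v = v} e I = inv-update refl refl refl refl e (r₆ (loaded I))
      (λ r p → update-other ρ 5 v (s≤⇒≢ 5 p)) I

    inv-set₆ : ∀ {k l zs ρ μ l′ v} → v ≡ l′ → Inv k l zs (ρ , μ) → Inv k l′ zs (ρ [ 6 ≔ v ] , μ)
    inv-set₆ {ρ = ρ} {v = v} e I = inv-update refl refl refl refl (r₅ (loaded I)) e
      (λ r p → update-other ρ 6 v (s≤⇒≢ 6 p)) I

    module _ {X : ℕ} (2≤X : 2 ≤ X) {k l : ℕ} (W : Within X (E & (k , l))) where

      Computable : Exp → Set
      Computable e = X ^ deg e < 2 ^ w × Reads base e (E & (k , l)) × 7 + height e ≤ s

      calc-inv : ∀ e → Computable e → ∀ {zs ρ μ} → Inv k l zs (ρ , μ) →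
        ∃[ ρ′ ] Ex w (calc e 7) (ρ , μ) (cost e) (ρ′ , μ) ×
          ρ′ 7 ≡ eval e (E & (k , l)) × Inv k l zs (ρ′ , μ)
      calc-inv e (X< , rd , h) {ρ = ρ} I
        with ρ′ , x , v , kept ← calc-correct 2≤X {w} W e 7 ≤-refl X< rd (loaded I) =
        ρ′ , x , v , inv-update (lo 1) (lo 2) (lo 3) (lo 4)
          (trans (lo 5) (r₅ (loaded I))) (trans (lo 6) (r₆ (loaded I)))
          (λ r p → kept r (inj₂ (≤-trans h p))) I
        where
        lo : ∀ x {_ : T (x <ᵇ 7)} → ρ′ x ≡ ρ x
        lo x {p} = kept x (inj₁ (<ᵇ⇒< x 7 p))

      private
        +0< : ∀ {e} → Computable e → ∀ {v} → v ≡ eval e (E & (k , l)) → v + 0 < 2 ^ w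
        +0< {e} (X< , _) refl = subst (_< 2 ^ w) (sym (+-identityʳ _))
          (≤-<-trans (eval-bound 2≤X W e) X<)

      0<2^w : ∀ {e} → Computable e → 0 < 2 ^ w
      0<2^w (X< , _) = ≤-<-trans z≤n X<

      1<2^w : ∀ {e} → Computable e → 1 < 2 ^ w
      1<2^w {e} (X< , _) = <-trans 2≤X^ X<
        where
        2≤X^ : 2 ≤ X ^ deg e
        2≤X^ = ≤-trans 2≤X (m≤m^n X (deg e) {{>-nonZero (<-≤-trans z<s 2≤X)}} (deg>0 e))

      assign₅ : ∀ e → Computable e → ∀ {zs ρ μ} → Inv k l zs (ρ , μ) →
        ∃[ ρ′ ] Ex w (assign 5 e) (ρ , μ) (cost e + 2) (ρ′ , μ) ×
          Inv (eval e (E & (k , l))) l zs (ρ′ , μ)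
      assign₅ e c I with ρ′ , x , v , I′ ← calc-inv e c I =
        _ , ex-seq x (ex-seq (ex-const (0<2^w c)) (ex-op (+0< c v)))
          , inv-set₅ (trans (+-identityʳ _) v) (inv-scratch 0 I′)

      assign₆ : ∀ e → Computable e → ∀ {zs ρ μ} → Inv k l zs (ρ , μ) →
        ∃[ ρ′ ] Ex w (assign 6 e) (ρ , μ) (cost e + 2) (ρ′ , μ) ×
          Inv k (eval e (E & (k , l))) zs (ρ′ , μ)
      assign₆ e c I with ρ′ , x , v , I′ ← calc-inv e c I =
        _ , ex-seq x (ex-seq (ex-const (0<2^w c)) (ex-op (+0< c v)))
          , inv-set₆ (trans (+-identityʳ _) v) (inv-scratch 0 I′)

    push-inv : ∀ {k l zs ρ μ v} → 1 < 2 ^ w → 3 + base + length zs < 2 ^ w → ρ 7 ≡ v →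
      Inv k l zs (ρ , μ) →
      ∃₂ λ ρ′ μ′ → Ex w push (ρ , μ) 3 (ρ′ , μ′) × Inv k l (zs ++ v ∷ []) (ρ′ , μ′)
    push-inv {zs = zs} {ρ} {μ} {v} 1< room refl I =
      _ , _ , ex-seq ex-store (ex-seq (ex-const 1<) (ex-op (subst (_< 2 ^ w) (sym next) room)))
      , record
        { loaded = record { r₁ = r₁ (loaded I) ; r₂ = r₂ (loaded I)
                          ; r₅ = r₅ (loaded I) ; r₆ = r₆ (loaded I)
                          ; low = λ a p → trans (update-other μ (ρ 4) v (below p))
                              (low (loaded I) a p) }
        ; r₃ = r₃ I
        ; r₄ = trans next (cong (2 +_) (trans (sym (+-suc base (length zs)))
                 (cong (base +_) (sym (trans (length-++ zs) (+-comm _ 1))))))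
        ; high = λ r p → trans (update-other (ρ [ 0 ≔ 1 ]) 4 _ (s≤⇒≢ 4 p))
                        (trans (update-other ρ 0 1 (s≤⇒≢ 0 p)) (high I r p))
        ; head = trans (update-other μ (ρ 4) v λ p → m≢1+m+n base (trans p (trans (r₄ I)
                   (cong suc (sym (+-suc base (length zs))))))) (head I)
        ; out = λ a → trans (write a) (sym (padded-snoc zs v a)) }
      where
      next : ρ 4 + 1 ≡ 3 + base + length zs
      next = trans (+-comm _ 1) (cong suc (r₄ I))
      below : ∀ {a} → a < base → a ≢ ρ 4
      below p refl = <⇒≱ p (≤-trans (m≤n+m base 2)
                       (≤-trans (m≤m+n (2 + base) (length zs)) (≤-reflexive (sym (r₄ I)))))
      write : ∀ a → (μ [ ρ 4 ≔ v ]) (2 + base + a) ≡ (padded zs [ length zs ≔ v ]) a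
      write a with a ≟ length zs
      ... | yes refl = trans (cong (λ b → (μ [ b ≔ v ]) (2 + base + a)) (r₄ I))
                      (trans (update-same μ (2 + base + a) v) (sym (update-same (padded zs) a v)))
      ... | no a≢ = trans (update-other μ (ρ 4) v
                            (λ p → a≢ (+-cancelˡ-≡ (2 + base) _ _ (trans p (r₄ I)))))
                      (trans (out I a) (sym (update-other (padded zs) (length zs) v a≢)))

    Room : List (ℕ × ℕ) → Set
    Room xs = 2 + base + 2 * length xs < 2 ^ w

    room-++ : ∀ xs ys → Room (xs ++ ys) → Room xs
    room-++ xs ys p = ≤-<-trans (+-monoʳ-≤ (2 + base) (*-monoʳ-≤ 2
      (≤-trans (m≤m+n (length xs) (length ys)) (≤-reflexive (sym (length-++ xs)))))) p

    length-snoc : ∀ zs (x : ℕ) → 3 + base + length (zs ++ x ∷ []) ≡ 4 + base + length zs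
    length-snoc zs x = trans (cong (3 + base +_) (trans (length-++ zs) (+-comm _ 1)))
                             (cong (3 +_) (+-suc base _))

    room-flat : ∀ xs x y → Room (xs ++ (x , y) ∷ []) → 4 + base + length (flat xs) < 2 ^ w
    room-flat xs x y = subst (_< 2 ^ w) $ begin
      2 + base + 2 * length (xs ++ (x , y) ∷ [])
        ≡⟨ cong (2 + base +_) (length-flat (xs ++ (x , y) ∷ [])) ⟨
      2 + base + length (flat (xs ++ (x , y) ∷ []))
        ≡⟨ cong (λ zs → 2 + base + length zs) (flat-++ xs _) ⟩
      2 + base + length (flat xs ++ x ∷ y ∷ [])
        ≡⟨ cong (2 + base +_) (trans (length-++ (flat xs)) (+-comm _ 2)) ⟩
      2 + base + (2 + length (flat xs))
        ≡⟨ cong (2 +_) (trans (+-suc base _) (cong suc (+-suc base _))) ⟩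
      4 + base + length (flat xs) ∎
      where open ≡-Reasoning

    record Admissible (X : ℕ) (r : Rule) : Set where
      field
        small   : X ^ ruleDeg r < 2 ^ w
        shallow : 7 + ruleHeight r ≤ s
        reads₁  : Reads base (count₁ r) (E & (0 , 0))
        reads₂  : ∀ {k} → k < eval (count₁ r) (E & (0 , 0)) → Reads base (count₂ r) (E & (k , 0))
        readsᵇ  : ∀ {k l} → k < eval (count₁ r) (E & (0 , 0)) →
                  l < eval (count₂ r) (E & (k , 0)) →
                  Reads base (cond r) (E & (k , l)) × Reads base (src r) (E & (k , l)) ×
                  Reads base (dst r) (E & (k , l))

    module _ {X : ℕ} (2≤X : 2 ≤ X) (W₀ : Within X (E & (0 , 0)))
             {r : Rule} (A : Admissible X r) where

      open Admissible A

      private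
        d₁ = deg (count₁ r)
        d₂ = deg (count₂ r)
        d₃ = deg (cond r) + (deg (src r) + deg (dst r))
        Y = X ^ d₁
        Z = Y ^ d₂

        instance
          nonZero-X : NonZero X
          nonZero-X = >-nonZero (<-≤-trans z<s 2≤X)
          nonZero-Y : NonZero Y
          nonZero-Y = m^n≢0 X d₁
          nonZero-Z : NonZero Z
          nonZero-Z = m^n≢0 Y d₂

        X≤Y : X ≤ Y
        X≤Y = m≤m^n X d₁ (deg>0 (count₁ r))

        Y≤Z : Y ≤ Z
        Y≤Z = m≤m^n Y d₂ (deg>0 (count₂ r))

        Z^d₃< : Z ^ d₃ < 2 ^ w
        Z^d₃< = subst (_< 2 ^ w) (sym (trans (^-*-assoc Y d₂ d₃) (^-*-assoc X d₁ (d₂ * d₃))))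
            small

        Z< : Z < 2 ^ w
        Z< = ≤-<-trans (m≤m^n Z d₃ (<-≤-trans (deg>0 (cond r)) (m≤m+n (deg (cond r)) _))) Z^d₃<

        Y< : Y < 2 ^ w
        Y< = ≤-<-trans Y≤Z Z<

        N₁ = eval (count₁ r) (E & (0 , 0))
        N₂ : ℕ → ℕ
        N₂ k = eval (count₂ r) (E & (k , 0))

        N₁≤Y : N₁ ≤ Y
        N₁≤Y = eval-bound 2≤X W₀ (count₁ r)

        W₁ : ∀ {k} → k ≤ N₁ → Within Y (E & (k , 0))
        W₁ k≤ = record { n≤ = ≤-trans (Within.n≤ W₀) X≤Y ; U≤ = ≤-trans (Within.U≤ W₀) X≤Y
                       ; i≤ = ≤-trans k≤ N₁≤Y ; j≤ = z≤n
                       ; inp≤ = λ a → ≤-trans (Within.inp≤ W₀ a) X≤Y }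

        N₂≤Z : ∀ {k} → k ≤ N₁ → N₂ k ≤ Z
        N₂≤Z k≤ = eval-bound (≤-trans 2≤X X≤Y) (W₁ k≤) (count₂ r)

        W₂ : ∀ {k l} → k ≤ N₁ → l ≤ N₂ k → Within Z (E & (k , l))
        W₂ k≤ l≤ = record { n≤ = ≤-trans (Within.n≤ (W₁ k≤)) Y≤Z
                          ; U≤ = ≤-trans (Within.U≤ (W₁ k≤)) Y≤Z
                          ; i≤ = ≤-trans (Within.i≤ (W₁ k≤)) Y≤Z
                          ; j≤ = ≤-trans l≤ (N₂≤Z k≤)
                          ; inp≤ = λ a → ≤-trans (Within.inp≤ (W₁ k≤) a) Y≤Z }

        2≤Y : 2 ≤ Y
        2≤Y = ≤-trans 2≤X X≤Y

        2≤Z : 2 ≤ Z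
        2≤Z = ≤-trans 2≤Y Y≤Z

        h₁ = height (count₁ r)
        h₂ = height (count₂ r)
        hᶜ = height (cond r)
        hˢ = height (src r)
        hᵈ = height (dst r)

        fits-s : ∀ {h} → h ≤ ruleHeight r → 7 + h ≤ s
        fits-s p = ≤-trans (+-monoʳ-≤ 7 p) shallow

        ok₁ : Computable 2≤X W₀ (count₁ r)
        ok₁ = Y< , reads₁ , fits-s (m≤m+n h₁ _)

        ok₂ : ∀ {k} (k< : k < N₁) → Computable 2≤Y (W₁ (<⇒≤ k<)) (count₂ r)
        ok₂ k< = Z< , reads₂ k< , fits-s (≤-trans (m≤m+n h₂ _) (m≤n+m _ h₁))

        module _ {k l : ℕ} (k< : k < N₁) (l< : l < N₂ k) where
          okᶜ : Computable 2≤Z (W₂ (<⇒≤ k<) (<⇒≤ l<)) (cond r)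
          okᶜ = ≤-<-trans (^-monoʳ-≤ Z (m≤m+n (deg (cond r)) _)) Z^d₃<
              , proj₁ (readsᵇ k< l<)
              , fits-s (≤-trans (m≤m+n hᶜ _) (≤-trans (m≤n+m _ h₂) (m≤n+m _ h₁)))
          okˢ : Computable 2≤Z (W₂ (<⇒≤ k<) (<⇒≤ l<)) (src r)
          okˢ = ≤-<-trans (^-monoʳ-≤ Z (≤-trans (m≤m+n (deg (src r)) _) (m≤n+m _ (deg (cond r)))))
              Z^d₃<
              , proj₁ (proj₂ (readsᵇ k< l<))
              , fits-s (≤-trans (m≤m+n hˢ _) (≤-trans (m≤n+m _ hᶜ)
                  (≤-trans (m≤n+m _ h₂) (m≤n+m _ h₁))))
          okᵈ : Computable 2≤Z (W₂ (<⇒≤ k<) (<⇒≤ l<)) (dst r)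
          okᵈ = ≤-<-trans (^-monoʳ-≤ Z (≤-trans (m≤n+m (deg (dst r)) (deg (src r)))
              (m≤n+m _ (deg (cond r))))) Z^d₃<
              , proj₂ (proj₂ (readsᵇ k< l<))
              , fits-s (≤-trans (m≤n+m hᵈ hˢ) (≤-trans (m≤n+m _ hᶜ)
                  (≤-trans (m≤n+m _ h₂) (m≤n+m _ h₁))))

        1< : 1 < 2 ^ w
        1< = ≤-<-trans (≤-trans (n≤1+n 1) 2≤X) (≤-<-trans X≤Y Y<)

      emitCode-inv : ∀ {k l} → k < N₁ → l < N₂ k → ∀ xs {ρ μ} →
        let e = (eval (src r) (E & (k , l)) , eval (dst r) (E & (k , l))) in
        Room (xs ++ e ∷ []) → Inv k l (flat xs) (ρ , μ) →
        ∃₂ λ ρ′ μ′ → Ex w (emitCode r) (ρ , μ) (cost (src r) + (3 + (cost (dst r) + 3)))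
            (ρ′ , μ′) ×
          Inv k l (flat (xs ++ e ∷ [])) (ρ′ , μ′)
      emitCode-inv {k} {l} k< l< xs {ρ} {μ} room I
        with ρ₁ , x₁ , v₁ , I₁ ← calc-inv 2≤Z (W₂ (<⇒≤ k<) (<⇒≤ l<)) (src r) (okˢ k< l<) I
        with ρ₂ , μ₂ , x₂ , I₂ ← push-inv 1< (≤-<-trans (n≤1+n _) (room-flat xs _ _ room)) v₁ I₁
        with ρ₃ , x₃ , v₃ , I₃ ← calc-inv 2≤Z (W₂ (<⇒≤ k<) (<⇒≤ l<)) (dst r) (okᵈ k< l<) I₂
        with ρ₄ , μ₄ , x₄ , I₄ ← push-inv 1<
               (subst (_< 2 ^ w) (sym (length-snoc (flat xs) _)) (room-flat xs _ _ room)) v₃ I₃ =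
        ρ₄ , μ₄ , ex-seq x₁ (ex-seq x₂ (ex-seq x₃ x₄))
        , subst (λ zs → Inv k l zs (ρ₄ , μ₄))
            (trans (++-assoc (flat xs) _ _) (sym (flat-++ xs _))) I₄

      body-inv : ∀ {k l} → k < N₁ → l < N₂ k → ∀ xs {ρ μ} →
        Room (xs ++ emit₂ r E k l) → Inv k l (flat xs) (ρ , μ) →
        ∃₂ λ t ρ′ → ∃[ μ′ ]
          Ex w (calc (cond r) 7 ⨟ when 7 (emitCode r)) (ρ , μ) t (ρ′ , μ′) ×
          t ≤ bodyCost r × Inv k l (flat (xs ++ emit₂ r E k l)) (ρ′ , μ′)
      body-inv {k} {l} k< l< xs {ρ} {μ} room I
        with ρ₁ , x₁ , v₁ , I₁ ← calc-inv 2≤Z (W₂ (<⇒≤ k<) (<⇒≤ l<)) (cond r) (okᶜ k< l<) I =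
        branch (eval (cond r) (E & (k , l)) ≟ 0)
        where
        branch : Dec (eval (cond r) (E & (k , l)) ≡ 0) →
          ∃₂ λ t ρ′ → ∃[ μ′ ]
            Ex w (calc (cond r) 7 ⨟ when 7 (emitCode r)) (ρ , μ) t (ρ′ , μ′) ×
            t ≤ bodyCost r × Inv k l (flat (xs ++ emit₂ r E k l)) (ρ′ , μ′)
        branch (yes p) = _ , _ , _ , ex-seq x₁ (ex-when₀ (trans v₁ p))
          , +-monoʳ-≤ (cost (cond r)) (s≤s z≤n)
          , subst (λ zs → Inv k l (flat zs) (ρ₁ , μ))
              (sym (trans (cong (xs ++_) (emit₂-inactive r E p)) (++-identityʳ xs))) I₁
        branch (no p) = finish (emitCode-inv k< l< xs
          (subst (λ ys → Room (xs ++ ys)) (emit₂-active r E p) room) I₁)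
          where
          e = eval (src r) (E & (k , l)) , eval (dst r) (E & (k , l))
          finish : (∃₂ λ ρ₂ μ₂ → Ex w (emitCode r) (ρ₁ , μ)
              (cost (src r) + (3 + (cost (dst r) + 3))) (ρ₂ , μ₂) ×
              Inv k l (flat (xs ++ e ∷ [])) (ρ₂ , μ₂)) → _
          finish (ρ₂ , μ₂ , x₂ , I₂) =
            _ , _ , _ , ex-seq x₁ (ex-when₁ (λ q → p (trans (sym v₁) q)) x₂)
            , ≤-refl
            , subst (λ ys → Inv k l (flat (xs ++ ys)) (ρ₂ , μ₂)) (sym (emit₂-active r E p)) I₂

      -- The emitted part `ys` is tied to the final list `all` by what the remaining rounds will
      -- append, so one bound on the length of `all` makes room for every single push.
      Inner : ℕ → List (ℕ × ℕ) → ℕ → Store → Set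
      Inner k all l σ =
        ∃[ ys ] Inv k l (flat ys) σ × ys ++ concatMap (emit₂ r E k) (downFrom l) ≡ all

      Outer : List (ℕ × ℕ) → ℕ → Store → Set
      Outer all k σ =
        ∃[ ys ] Inv k 0 (flat ys) σ × ys ++ concatMap (emit₁ r E) (downFrom k) ≡ all

      inner-step : ∀ {k} → k < N₁ → ∀ all → Room all → ∀ {l ρ μ} → l < N₂ k →
        Inner k all (suc l) (ρ , μ) →
        ∃₂ λ t ρ′ → ∃[ μ′ ] Ex w (calc (cond r) 7 ⨟ when 7 (emitCode r))
            (ρ [ 0 ≔ 1 ] [ 6 ≔ l ] , μ) t (ρ′ , μ′) ×
          t ≤ bodyCost r × Inner k all l (ρ′ [ 0 ≔ 0 ] , μ′)
      inner-step {k} k< all room {l} l< (ys , J , eq)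
        with eq′ ← trans (++-assoc ys (emit₂ r E k l) _) eq
        with t , ρ′ , μ′ , x , t≤ , J′ ← body-inv k< l< ys
               (room-++ (ys ++ emit₂ r E k l) _ (subst Room (sym eq′) room))
               (inv-set₆ refl (inv-scratch 1 J)) =
        t , ρ′ , μ′ , x , t≤ , ys ++ emit₂ r E k l , inv-scratch 0 J′ , eq′

      inner-loop : ∀ {k} → k < N₁ → ∀ T₂ → N₂ k ≤ T₂ → ∀ xs {σ} → Room (xs ++ emit₁ r E k) →
        Inv k (N₂ k) (flat xs) σ →
        ∃₂ λ t τ → Ex w (loop 5 (calc (cond r) 7 ⨟ when 7 (emitCode r))) σ t τ ×
          t ≤ 1 + T₂ * (5 + bodyCost r) × Inv k 0 (flat (xs ++ emit₁ r E k)) τ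
      inner-loop {k} k< T₂ N₂≤ xs {σ} room I
        with t , τ , x , t≤ , ys , J , eq ← loop-count (Inner k (xs ++ emit₁ r E k))
          (bodyCost r) (N₂ k) (λ (_ , J , _) → r₆ (loaded J)) (inner-step k< _ room) 1<
          (≤-<-trans (N₂≤Z (<⇒≤ k<)) Z<) (xs , I , refl) =
        t , τ , x , ≤-trans t≤ (s≤s (*-monoˡ-≤ (5 + bodyCost r) N₂≤))
        , subst (λ zs → Inv k 0 (flat zs) τ) (trans (sym (++-identityʳ ys)) eq) J

      outer-step : ∀ T₂ → (∀ {k} → k < N₁ → N₂ k ≤ T₂) → ∀ all → Room all →
        ∀ {k ρ μ} → k < N₁ → Outer all (suc k) (ρ , μ) →
        ∃₂ λ t ρ′ → ∃[ μ′ ]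
          Ex w (assign 6 (count₂ r) ⨟ loop 5 (calc (cond r) 7 ⨟ when 7 (emitCode r)))
            (ρ [ 0 ≔ 1 ] [ 5 ≔ k ] , μ) t (ρ′ , μ′) ×
          t ≤ cost (count₂ r) + 2 + (1 + T₂ * (5 + bodyCost r)) ×
          Outer all k (ρ′ [ 0 ≔ 0 ] , μ′)
      outer-step T₂ N₂≤ all room {k} k< (ys , J , eq)
        with eq′ ← trans (++-assoc ys (emit₁ r E k) _) eq
        with ρ₂ , x₂ , J₂ ← assign₆ 2≤Y (W₁ (<⇒≤ k<)) (count₂ r) (ok₂ k<)
               (inv-set₅ refl (inv-scratch 1 J))
        with t , τ , x , t≤ , J′ ← inner-loop k< T₂ (N₂≤ k<) ys
               (room-++ (ys ++ emit₁ r E k) _ (subst Room (sym eq′) room)) J₂ =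
        _ , _ , _ , ex-seq x₂ x , +-monoʳ-≤ (cost (count₂ r) + 2) t≤
        , ys ++ emit₁ r E k , inv-scratch 0 J′ , eq′

      rule-inv : ∀ T₂ → (∀ {k} → k < N₁ → N₂ k ≤ T₂) → ∀ xs {σ} → Room (xs ++ emit r E) →
        Inv 0 0 (flat xs) σ →
        ∃₂ λ t τ → Ex w (ruleCode r) σ t τ × t ≤ ruleCost E r T₂ ×
          Inv 0 0 (flat (xs ++ emit r E)) τ
      rule-inv T₂ N₂≤ xs {ρ , μ} room I
        with ρ₁ , x₁ , I₁ ← assign₅ 2≤X W₀ (count₁ r) ok₁ I
        with t , τ , x , t≤ , ys , J , eq ← loop-count (Outer (xs ++ emit r E))
          (cost (count₂ r) + 2 + (1 + T₂ * (5 + bodyCost r))) N₁ (λ (_ , J , _) → r₅ (loaded J))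
          (outer-step T₂ N₂≤ _ room) 1< (≤-<-trans N₁≤Y Y<) (xs , I₁ , refl) =
        _ , τ , ex-seq x₁ x , +-monoʳ-≤ (cost (count₁ r) + 2) t≤
        , subst (λ zs → Inv 0 0 (flat zs) τ) (trans (sym (++-identityʳ ys)) eq) J

  rules-inv : ∀ {w s base X R} (7<s : 7 < s) (E : Env) (hdr : ℕ) → 2 ≤ X →
    Within X (E & (0 , 0)) → (rs : Fin R → Rule) (T₂ : Fin R → ℕ) →
    (∀ p → Emission.Admissible w s base 7<s E hdr X (rs p)) →
    (∀ p {k} → k < eval (Rule.count₁ (rs p)) (E & (0 , 0)) →
       eval (Rule.count₂ (rs p)) (E & (k , 0)) ≤ T₂ p) →
    ∀ xs {σ} → 2 + base + 2 * length (xs ++ emits rs E) < 2 ^ w →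
    Emission.Inv w s base 7<s E hdr 0 0 (flat xs) σ →
    ∃₂ λ t τ → Ex w (rulesCode rs) σ t τ × t ≤ rulesCost E rs T₂ ×
      Emission.Inv w s base 7<s E hdr 0 0 (flat (xs ++ emits rs E)) τ
  rules-inv {w} {s} {base} {X} {zero} 7<s E hdr 2≤X W rs T₂ A N₂≤ xs {σ} room I =
    0 , σ , ex-skip , z≤n
    , subst (λ zs → Emission.Inv w s base 7<s E hdr 0 0 (flat zs) σ) (sym (++-identityʳ xs)) I
  rules-inv {w} {s} {base} {X} {suc R} 7<s E hdr 2≤X W rs T₂ A N₂≤ xs {σ} room I =
    first (rule-inv 2≤X W (A 0F) (T₂ 0F) (N₂≤ 0F) xs
            (room-++ (xs ++ emit (rs 0F) E) _ room′) I)
    where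
    open Emission w s base 7<s E hdr
    es₀ = emit (rs 0F) E
    es₁ = emits (rs ∘ Fin.suc) E
    room′ : Room ((xs ++ es₀) ++ es₁)
    room′ = subst Room (sym (++-assoc xs es₀ es₁)) room
    Result = ∃₂ λ t τ → Ex w (rulesCode rs) σ t τ × t ≤ rulesCost E rs T₂ ×
      Inv 0 0 (flat (xs ++ emits rs E)) τ
    second : ∀ {t τ} → Ex w (ruleCode (rs 0F)) σ t τ →
      t ≤ ruleCost E (rs 0F) (T₂ 0F) →
      (∃₂ λ t′ υ → Ex w (rulesCode (rs ∘ Fin.suc)) τ t′ υ ×
        t′ ≤ rulesCost E (rs ∘ Fin.suc) (T₂ ∘ Fin.suc) ×
        Inv 0 0 (flat ((xs ++ es₀) ++ es₁)) υ) → Result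
    second x t≤ (t′ , υ , y , t′≤ , J) =
      _ , υ , ex-seq x y , +-mono-≤ t≤ t′≤
      , subst (λ zs → Inv 0 0 (flat zs) υ) (++-assoc xs es₀ es₁) J
    first : (∃₂ λ t τ → Ex w (ruleCode (rs 0F)) σ t τ ×
        t ≤ ruleCost E (rs 0F) (T₂ 0F) × Inv 0 0 (flat (xs ++ es₀)) τ) → Result
    first (t , τ , x , t≤ , J) = second x t≤
      (rules-inv 7<s E hdr 2≤X W (rs ∘ Fin.suc) (T₂ ∘ Fin.suc) (A ∘ Fin.suc)
        (λ p → N₂≤ (Fin.suc p)) (xs ++ es₀) room′ J)

  -- Writing the encoded graph behind the input

  baseExp : Exp
  baseExp = lit 2 ⊞ lit 2 ⊠ (#n ⊠ #U)

  prelude : Exp → Cmd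
  prelude order =
    const′ 0 0 ⨟ load′ 1 0 ⨟ const′ 0 1 ⨟ load′ 2 0 ⨟
    -- The base is the length of the encoded instance, two numbers and two families of n U bits.
    assign 3 baseExp ⨟
    calc order 7 ⨟ store′ 3 7 ⨟
    const′ 4 2 ⨟ op′ add 4 3 4

  -- Register 4 has advanced by two cells per edge since it pointed to base + 2, so subtracting and
  -- halving recovers the number of edges for the cell that was left free.
  finale : Cmd
  finale =
    const′ 0 2 ⨟ op′ sub 7 4 3 ⨟ op′ sub 7 7 0 ⨟ op′ div 7 7 0 ⨟
    const′ 0 1 ⨟ op′ add 0 3 0 ⨟ store′ 0 7

  build : ∀ {R} → (Fin R → Rule) → Exp → Cmd
  build rs order = prelude order ⨟ rulesCode rs ⨟ finale

  module Build {w s X R : ℕ} (7<s : 7 < s) (E : Env) (2≤X : 2 ≤ X) (W : Within X (E & (0 , 0)))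
    (rs : Fin R → Rule) (order : Exp) where

    E₀ : Env
    E₀ = E & (0 , 0)

    base hdr : ℕ
    base = eval baseExp E₀
    hdr  = eval order E₀

    open Emission w s base 7<s E hdr

    es : List (ℕ × ℕ)
    es = emits rs E

    record Buildable : Set where
      field
        input₀    : Env.inp E 0 ≡ Env.n E
        input₁    : Env.inp E 1 ≡ Env.U E
        input-end : ∀ a → base ≤ a → Env.inp E a ≡ 0
        order<    : X ^ deg order < 2 ^ w
        base<     : X ^ deg baseExp < 2 ^ w
        order-h   : 7 + height order ≤ s
        base-h    : 7 + height baseExp ≤ s
        order-rd  : Reads base order E₀
        room      : 2 + base + 2 * length es < 2 ^ w
        rules-ok  : ∀ p → Admissible X (rs p)

    record Built (σ : Store) : Set where
      field
        base-reg : proj₁ σ 3 ≡ base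
        high-reg : ∀ r → s ≤ r → proj₁ σ r ≡ 0
        memory   : ∀ a → proj₂ σ (base + a) ≡ padded (hdr ∷ length es ∷ flat es) a

    module _ (B : Buildable) where

      open Buildable B

      private
        inp = Env.inp E

        X<2^w : X < 2 ^ w
        X<2^w = ≤-<-trans (m≤m^n X (deg order) {{>-nonZero (<-≤-trans z<s 2≤X)}} (deg>0 order))
            order<

        2< : 2 < 2 ^ w
        2< = ≤-<-trans 2≤X X<2^w

        1< : 1 < 2 ^ w
        1< = <-trans ≤-refl 2<

        2+base< : 2 + base < 2 ^ w
        2+base< = ≤-<-trans (m≤m+n (2 + base) _) room

        base<2^w : base < 2 ^ w
        base<2^w = ≤-<-trans (m≤n+m base 2) 2+base<

        ρ₀ : ℕ → ℕ
        ρ₀ = (λ _ → 0) [ 0 ≔ 0 ] [ 1 ≔ inp 0 ] [ 0 ≔ 1 ] [ 2 ≔ inp 1 ]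

        load< : ∀ a → inp a < 2 ^ w
        load< a = ≤-<-trans (Within.inp≤ W a) X<2^w

        ρ₀-high : ∀ r → s ≤ r → ρ₀ r ≡ 0
        ρ₀-high r p = trans (update-other ((λ _ → 0) [ 0 ≔ 0 ] [ 1 ≔ inp 0 ] [ 0 ≔ 1 ]) 2 (inp 1)
            (s≤⇒≢ 2 p))
          (trans (update-other ((λ _ → 0) [ 0 ≔ 0 ] [ 1 ≔ inp 0 ]) 0 1 (s≤⇒≢ 0 p))
          (trans (update-other ((λ _ → 0) [ 0 ≔ 0 ]) 1 (inp 0) (s≤⇒≢ 1 p))
                 (update-other (λ _ → 0) 0 0 (s≤⇒≢ 0 p))))

        loaded₀ : Loaded base E₀ (ρ₀ , inp)
        loaded₀ = record { r₁ = input₀ ; r₂ = input₁ ; r₅ = refl ; r₆ = refl ; low = λ _ _ →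
            refl }

      prelude-inv : ∃₂ λ t τ → Ex w (prelude order) ((λ _ → 0) , inp) t τ ×
        t ≤ 9 + (cost baseExp + cost order) × Inv 0 0 [] τ
      prelude-inv = base-step (calc-correct 2≤X {w} {base} W baseExp 7 ≤-refl base< _ loaded₀)
        where
        Result = ∃₂ λ t τ → Ex w (prelude order) ((λ _ → 0) , inp) t τ ×
          t ≤ 9 + (cost baseExp + cost order) × Inv 0 0 [] τ
        order-step : ∀ {ρ₁} → Ex w (calc baseExp 7) (ρ₀ , inp) (cost baseExp) (ρ₁ , inp) →
          ρ₁ 7 + 0 ≡ base → (∀ x → x < 7 ⊎ 7 + height baseExp ≤ x → ρ₁ x ≡ ρ₀ x) →
          Calculates 2≤X {w} {base} W order 7 (height order) (ρ₁ [ 0 ≔ 0 ] [ 3 ≔ ρ₁ 7 + 0 ] , inp)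
              →
          Result
        order-step {ρ₁} x₁ v₁ k₁ (ρ₂ , x₂ , v₂ , k₂) =
          _ , _
          , ex-seq (ex-const (<-trans z<s 1<)) (ex-seq (ex-load (load< 0)) (ex-seq (ex-const 1<)
            (ex-seq (ex-load (load< 1)) (ex-seq (ex-seq x₁ (ex-seq (ex-const (<-trans z<s 1<))
            (ex-op (subst (_< 2 ^ w) (sym v₁) base<2^w))))
                (ex-seq x₂ (ex-seq ex-store (ex-seq (ex-const 2<)
            (ex-op (subst (_< 2 ^ w) (sym ptr) 2+base<)))))))))
          , ≤-reflexive time
          , record
            { loaded = record
              { r₁ = trans (lo 1) (trans (lo₁ 1) input₀) ; r₂ =
                  trans (lo 2) (trans (lo₁ 2) input₁)
              ; r₅ = trans (lo 5) (lo₁ 5) ; r₆ = trans (lo 6) (lo₁ 6)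
              ; low = λ a p → update-other inp _ _ (λ q → <⇒≢ p (trans q base₃)) }
            ; r₃ = base₃
            ; r₄ = trans ptr (sym (+-identityʳ (2 + base)))
            ; high = λ r p → trans (update-other (ρ₂ [ 4 ≔ 2 ]) 4 _ (s≤⇒≢ 4 p))
                            (trans (update-other ρ₂ 4 2 (s≤⇒≢ 4 p))
                            (trans (k₂ r (inj₂ (≤-trans order-h p)))
                            (trans (update-other (ρ₁ [ 0 ≔ 0 ]) 3 _ (s≤⇒≢ 3 p))
                            (trans (update-other ρ₁ 0 0 (s≤⇒≢ 0 p))
                            (trans (k₁ r (inj₂ (≤-trans base-h p))) (ρ₀-high r p))))))
            ; head = trans (cong (λ b → (inp [ b ≔ ρ₂ 7 ]) base) base₃)
                           (trans (update-same inp base _) v₂)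
            ; out = λ a → trans (update-other inp _ _ (λ q → m≢1+m+n base
                      (trans (sym (trans q base₃)) (cong suc (sym (+-suc base a))))))
                      (input-end _ (≤-trans (m≤n+m base 2) (m≤m+n (2 + base) a))) }
          where
          lo : ∀ x {_ : T (x <ᵇ 7)} → ρ₂ x ≡ (ρ₁ [ 0 ≔ 0 ] [ 3 ≔ ρ₁ 7 + 0 ]) x
          lo x {p} = k₂ x (inj₁ (<ᵇ⇒< x 7 p))
          lo₁ : ∀ x {_ : T (x <ᵇ 7)} → ρ₁ x ≡ ρ₀ x
          lo₁ x {p} = k₁ x (inj₁ (<ᵇ⇒< x 7 p))
          base₃ : ρ₂ 3 ≡ base
          base₃ = trans (lo 3) v₁
          ptr : ρ₂ 3 + 2 ≡ 2 + base
          ptr = trans (+-comm (ρ₂ 3) 2) (cong (2 +_) base₃)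
          time : 1 + (1 + (1 + (1 + (cost baseExp + 2 + (cost order + (1 + (1 + 1)))))))
                 ≡ 9 + (cost baseExp + cost order)
          time = cong (4 +_) (begin
            cost baseExp + 2 + (cost order + 3) ≡⟨ +-assoc (cost baseExp + 2) (cost order) 3 ⟨
            cost baseExp + 2 + cost order + 3   ≡⟨ +-comm _ 3 ⟩
            5 + (cost baseExp + cost order)     ∎)
            where open ≡-Reasoning
        base-step : Calculates 2≤X {w} {base} W baseExp 7 (height baseExp) (ρ₀ , inp) → Result
        base-step (ρ₁ , x₁ , v₁ , k₁) = order-step x₁ (trans (+-identityʳ _) v₁) k₁
          (calc-correct 2≤X {w} W order 7 ≤-refl order< order-rd record
            { r₁ = trans (k₁ 1 (inj₁ (<ᵇ⇒< 1 7 tt))) input₀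
            ; r₂ = trans (k₁ 2 (inj₁ (<ᵇ⇒< 2 7 tt))) input₁
            ; r₅ = k₁ 5 (inj₁ (<ᵇ⇒< 5 7 tt))
            ; r₆ = k₁ 6 (inj₁ (<ᵇ⇒< 6 7 tt))
            ; low = λ _ _ → refl })

      finale-built : ∀ {ρ μ} → Inv 0 0 (flat es) (ρ , μ) →
        ∃[ τ ] Ex w finale (ρ , μ) 7 τ × Built τ
      finale-built {ρ} {μ} I =
        _ , ex-seq (ex-const 2<) (ex-seq (ex-op (≤-<-trans (m∸n≤m (ρ 4) (ρ 3)) ptr<))
          (ex-seq (ex-op (subst (_< 2 ^ w) (sym v₂) 2len<))
              (ex-seq (ex-op (subst (_< 2 ^ w) (sym v₃) len<))
          (ex-seq (ex-const 1<) (ex-seq (ex-op (subst (_< 2 ^ w) (sym v₄)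
              (<-trans ≤-refl 2+base<))) ex-store)))))
        , record
          { base-reg = Inv.r₃ I
          ; high-reg = λ r p → trans (update-other ρ₅ 0 _ (s≤⇒≢ 0 p))
              (trans (update-other ρ₄ 0 1 (s≤⇒≢ 0 p)) (trans (update-other ρ₃ 7 _ (s≤⇒≢ 7 p))
              (trans (update-other ρ₂ 7 _ (s≤⇒≢ 7 p)) (trans (update-other ρ₁ 7 _ (s≤⇒≢ 7 p))
              (trans (update-other ρ 0 2 (s≤⇒≢ 0 p)) (Inv.high I r p))))))
          ; memory = mem′ }
        where
        ρ₁ = ρ [ 0 ≔ 2 ]
        ρ₂ = ρ₁ [ 7 ≔ ρ 4 ∸ ρ 3 ]
        ρ₃ = ρ₂ [ 7 ≔ ρ 4 ∸ ρ 3 ∸ 2 ]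
        ρ₄ = ρ₃ [ 7 ≔ (ρ 4 ∸ ρ 3 ∸ 2) / 2 ]
        ρ₅ = ρ₄ [ 0 ≔ 1 ]
        ptr : ρ 4 ≡ base + (2 + 2 * length es)
        ptr = trans (Inv.r₄ I) (trans (cong (2 + base +_) (length-flat es))
          (sym (trans (+-suc base _) (cong suc (+-suc base _)))))
        ptr< : ρ 4 < 2 ^ w
        ptr< = subst (_< 2 ^ w) (sym (trans (Inv.r₄ I) (cong (2 + base +_) (length-flat es))))
            room
        v₂ : ρ 4 ∸ ρ 3 ∸ 2 ≡ 2 * length es
        v₂ = cong (_∸ 2) (trans (cong₂ _∸_ ptr (Inv.r₃ I)) (m+n∸m≡n base _))
        2len< : 2 * length es < 2 ^ w
        2len< = ≤-<-trans (m≤n+m _ (2 + base)) room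
        v₃ : (ρ 4 ∸ ρ 3 ∸ 2) / 2 ≡ length es
        v₃ = trans (cong (_/ 2) (trans v₂ (*-comm 2 (length es)))) (m*n/n≡m (length es) 2)
        len< : length es < 2 ^ w
        len< = ≤-<-trans (m≤m+n (length es) _) 2len<
        v₄ : ρ 3 + 1 ≡ 1 + base
        v₄ = trans (+-comm (ρ 3) 1) (cong suc (Inv.r₃ I))
        L = (ρ 4 ∸ ρ 3 ∸ 2) / 2
        mem′ : ∀ a → (μ [ ρ 3 + 1 ≔ L ]) (base + a) ≡ padded (hdr ∷ length es ∷ flat es) a
        mem′ zero = trans (update-other μ (ρ 3 + 1) L
            (λ q → m≢1+m+n base {0} (trans (sym (+-identityʳ base))
                (trans q (trans v₄ (cong suc (sym (+-identityʳ base))))))))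
          (trans (cong μ (+-identityʳ base)) (Inv.head I))
        mem′ (suc zero) = trans (cong (λ b → (μ [ b ≔ L ]) (base + 1)) (trans v₄ (+-comm 1 base)))
          (trans (update-same μ (base + 1) L) v₃)
        mem′ (suc (suc a)) = trans (update-other μ (ρ 3 + 1) L
            (λ q → 0≢1+n (suc-injective (sym (+-cancelˡ-≡ base _ _
                (trans q (trans v₄ (+-comm 1 base))))))))
          (trans (cong μ (trans (+-suc base (suc a)) (cong suc (+-suc base a)))) (Inv.out I a))

      build-correct : ∀ T₂ →
        (∀ p {k} → k < eval (Rule.count₁ (rs p)) E₀ → eval (Rule.count₂ (rs p)) (E & (k , 0)) ≤ T₂
            p) →
        ∃₂ λ t τ → Ex w (build rs order) ((λ _ → 0) , inp) t τ ×
          t ≤ 9 + (cost baseExp + cost order) + (rulesCost E rs T₂ + 7) × Built τ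
      build-correct T₂ N₂≤ = step₁ prelude-inv
        where
        Result = ∃₂ λ t τ → Ex w (build rs order) ((λ _ → 0) , inp) t τ ×
          t ≤ 9 + (cost baseExp + cost order) + (rulesCost E rs T₂ + 7) × Built τ
        step₂ : ∀ {t τ} → Ex w (prelude order) ((λ _ → 0) , inp) t τ →
            t ≤ 9 + (cost baseExp + cost order) →
          (∃₂ λ t′ υ → Ex w (rulesCode rs) τ t′ υ × t′ ≤ rulesCost E rs T₂ ×
            Inv 0 0 (flat es) υ) → Result
        step₂ x t≤ (t′ , (ρ , μ) , y , t′≤ , J) with τ , z , b ← finale-built J =
          _ , τ , ex-seq x (ex-seq y z) , +-mono-≤ t≤ (+-monoˡ-≤ 7 t′≤) , b
        step₁ : (∃₂ λ t τ → Ex w (prelude order) ((λ _ → 0) , inp) t τ ×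
          t ≤ 9 + (cost baseExp + cost order) × Inv 0 0 [] τ) → Result
        step₁ (t , τ , x , t≤ , I) = step₂ x t≤
          (rules-inv 7<s E hdr 2≤X W rs T₂ rules-ok N₂≤ [] room I)

  -- Output 0 encodes the radius ∞, and x + 1 encodes x.
  verdict : ℕ → ℕ → ℕ
  verdict T zero    = 0
  verdict T (suc x) = if T ∸ x ≡ᵇ 0 then 0 else 1

  verdict-yes : ∀ {T x} → x < T → verdict T (suc x) ≡ 1
  verdict-yes {T} {x} x<T
    rewrite ≢⇒≡ᵇ (T ∸ x) 0 (λ p → <⇒≢ (m<n⇒0<n∸m x<T) (sym p)) = refl

  verdict-no : ∀ {T x} → T ≤ x → verdict T (suc x) ≡ 0
  verdict-no {T} {x} T≤x rewrite m≤n⇒m∸n≡0 T≤x = refl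

  -- Register `s` is the relocated output register. For an output x + 1, the difference `suc T` - (x
  -- + 1) is T - x, which is positive exactly if x < T.
  decide : ℕ → ℕ → Cmd
  decide s T = const′ 0 0 ⨟ when s (const′ 1 (suc T) ⨟ op′ sub 1 1 s ⨟ when 1 (const′ 0 1))

  decide-correct : ∀ {w s T σ} → 7 < s → suc T < 2 ^ w →
    ∃₂ λ t τ → Ex w (decide s T) σ t τ × t ≤ 6 × proj₁ τ 0 ≡ verdict T (proj₁ σ s)
  decide-correct {w} {s} {T} {ρ , μ} 7<s T< = go (ρ s) refl
    where
    keep₀ : (ρ [ 0 ≔ 0 ]) s ≡ ρ s
    keep₀ = update-other ρ 0 0 (λ p → <⇒≢ (<-trans (z<s {6}) 7<s) (sym p))
    keep₁ : (ρ [ 0 ≔ 0 ] [ 1 ≔ suc T ]) s ≡ ρ s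
    keep₁ = trans (update-other (ρ [ 0 ≔ 0 ]) 1 _
        (λ p → <⇒≢ (<-trans (s≤s (z<s {5})) 7<s) (sym p))) keep₀
    0< : 0 < 2 ^ w
    0< = <-trans z<s T<
    go : ∀ x → ρ s ≡ x →
      ∃₂ λ t τ → Ex w (decide s T) (ρ , μ) t τ × t ≤ 6 × proj₁ τ 0 ≡ verdict T (ρ s)
    go zero p = _ , _ , ex-seq (ex-const 0<) (ex-when₀ (trans keep₀ p))
              , s≤s (s≤s z≤n) , sym (cong (verdict T) p)
    go (suc x) p = branch (T ∸ x ≟ 0)
      where
      diff : suc T ∸ (ρ [ 0 ≔ 0 ] [ 1 ≔ suc T ]) s ≡ T ∸ x
      diff = cong (suc T ∸_) (trans keep₁ p)
      s≢0 : (ρ [ 0 ≔ 0 ]) s ≢ 0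
      s≢0 q = 0≢1+n (trans (sym q) (trans keep₀ p))
      diff< : suc T ∸ (ρ [ 0 ≔ 0 ] [ 1 ≔ suc T ]) s < 2 ^ w
      diff< = ≤-<-trans (m∸n≤m (suc T) ((ρ [ 0 ≔ 0 ] [ 1 ≔ suc T ]) s)) T<
      branch : Dec (T ∸ x ≡ 0) →
        ∃₂ λ t τ → Ex w (decide s T) (ρ , μ) t τ × t ≤ 6 × proj₁ τ 0 ≡ verdict T (ρ s)
      branch (yes q) = _ , _ , ex-seq (ex-const 0<) (ex-when₁ s≢0 (ex-seq (ex-const T<)
          (ex-seq (ex-op diff<) (ex-when₀ (trans diff q)))))
        , s≤s (s≤s (s≤s (s≤s (s≤s z≤n))))
        , sym (trans (cong (verdict T) p) (verdict-no {T} {x} (m∸n≡0⇒m≤n q)))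
      branch (no q) = _ , _ , ex-seq (ex-const 0<) (ex-when₁ s≢0 (ex-seq (ex-const T<)
          (ex-seq (ex-op diff<) (ex-when₁ (λ r → q (trans (sym diff) r))
            (ex-const (≤-<-trans (s≤s z≤n) T<))))))
        , ≤-refl
        , sym (trans (cong (verdict T) p) (verdict-yes {T} {x} (≰⇒> λ le → q (m≤n⇒m∸n≡0 le))))

  module Solver {R : ℕ} (s : ℕ) (7<s : 7 < s) (rs : Fin R → Rule) (order : Exp)
                (T : ℕ) (P : Program) where

    k₀ : Label
    k₀ = end 0 (build rs order)

    open Relocation s (≤-trans (s≤s (s≤s (s≤s (s≤s z≤n)))) 7<s) k₀ P public

    solver : Program
    solver = compile 0 (build rs order) ++ relocate P ++ compile exit (decide s T)

    private
      length-relocate : ∀ k is → k + length (relocate is) ≡ slot k (length is)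
      length-relocate k []       = +-identityʳ k
      length-relocate k (i ∷ is) = trans (trans (+-suc k _) (cong suc (+-suc k _)))
                                         (length-relocate (2 + k) is)

      at-build : At solver 0 (compile 0 (build rs order))
      at-build = At-infix [] (compile 0 (build rs order)) _

      at-relocate : At solver k₀ (relocate P)
      at-relocate = subst (λ k → At solver k (relocate P)) (length-compile 0 (build rs order))
        (At-infix (compile 0 (build rs order)) (relocate P) _)

      before : Program
      before = compile 0 (build rs order) ++ relocate P

      length-before : length before ≡ exit
      length-before = trans (length-++ (compile 0 (build rs order)))
        (trans (cong (_+ length (relocate P)) (length-compile 0 (build rs order)))
               (length-relocate k₀ P))

      at-decide : At solver exit (compile exit (decide s T))
      at-decide = subst₂ (λ Q k → At Q k (compile exit (decide s T)))
        (trans (++-assoc (compile 0 (build rs order)) (relocate P) _)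
          (cong (λ is → compile 0 (build rs order) ++ relocate P ++ is) (++-identityʳ _)))
        length-before (At-infix before (compile exit (decide s T)) [])

      final : fetch solver (end exit (decide s T)) ≡ halt
      final = fetch-beyond solver (≤-reflexive (begin
        length solver
          ≡⟨ cong length (++-assoc (compile 0 (build rs order)) (relocate P) _) ⟨
        length (before ++ compile exit (decide s T))
          ≡⟨ length-++ before ⟩
        length before + length (compile exit (decide s T))
          ≡⟨ cong (_+ length (compile exit (decide s T))) length-before ⟩
        exit + length (compile exit (decide s T))
          ≡⟨ length-compile exit (decide s T) ⟩
        end exit (decide s T) ∎))
        where open ≡-Reasoning

    module _ {w w′ X : ℕ} {E : Env} (2≤X : 2 ≤ X) (W : Within X (E & (0 , 0))) where

      open Build {w′} 7<s E 2≤X W rs order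

      solver-correct : Buildable → w ≤ w′ → (∀ {a} → a < 2 ^ w → base + a < 2 ^ w′) →
        suc T < 2 ^ w′ → ∀ T₂ →
        (∀ p {k} → k < eval (Rule.count₁ (rs p)) E₀ → eval (Rule.count₂ (rs p)) (E & (k , 0)) ≤ T₂
            p) →
        ∀ {t τ} → Runs w P (initial (hdr ∷ length es ∷ flat es)) t τ →
        ∃₂ λ t′ τ′ → Runs w′ solver ⟨ 0 , (λ _ → 0) , Env.inp E ⟩ t′ τ′ ×
          output τ′ ≡ verdict T (output τ) ×
          t′ ≤ 9 + (cost baseExp + cost order) + (rulesCost E rs T₂ + 7) + (2 + 2 * t) + 6
      solver-correct B w≤w′ fits T< T₂ N₂≤ {t} {τ} run = step₁ (build-correct B T₂ N₂≤)
        where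
        Result = ∃₂ λ t′ τ′ → Runs w′ solver ⟨ 0 , (λ _ → 0) , Env.inp E ⟩ t′ τ′ ×
          output τ′ ≡ verdict T (output τ) ×
          t′ ≤ 9 + (cost baseExp + cost order) + (rulesCost E rs T₂ + 7) + (2 + 2 * t) + 6
        t₀ = 9 + (cost baseExp + cost order) + (rulesCost E rs T₂ + 7)
        step₃ : ∀ {t₁ t₂ σ υ} → t₁ ≤ t₀ → t₂ ≤ 2 + 2 * t →
          Steps w′ solver ⟨ 0 , (λ _ → 0) , Env.inp E ⟩ t₁ (state k₀ σ) →
          Steps w′ solver (state k₀ σ) t₂ (state exit υ) → proj₁ υ s ≡ output τ →
          (∃₂ λ t₃ υ′ → Ex w′ (decide s T) υ t₃ υ′ × t₃ ≤ 6 × proj₁ υ′ 0 ≡ verdict T (proj₁ υ s))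
              →
          Result
        step₃ t₁≤ t₂≤ x y out (t₃ , υ′ , z , t₃≤ , res) =
          _ , _ , Steps⇒Runs ((x ◅◅ y) ◅◅ compile-correct exit (decide s T) at-decide z) final
          , trans res (cong (verdict T) out) , +-mono-≤ (+-mono-≤ t₁≤ t₂≤) t₃≤
        step₂ : ∀ {t₁ σ} → t₁ ≤ t₀ →
          Steps w′ solver ⟨ 0 , (λ _ → 0) , Env.inp E ⟩ t₁ (state k₀ σ) →
          (∃₂ λ t₂ υ → Steps w′ solver (state (dest 0) σ) t₂ (state exit υ) ×
             t₂ ≤ 2 + 2 * t × proj₁ υ s ≡ output τ) → Result
        step₂ t₁≤ x (t₂ , υ , y , t₂≤ , out) = step₃ t₁≤ t₂≤ x y out (decide-correct 7<s T<)
        step₁ : (∃₂ λ t₁ σ → Ex w′ (build rs order) ((λ _ → 0) , Env.inp E) t₁ σ ×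
          t₁ ≤ t₀ × Built σ) → Result
        step₁ (t₁ , σ , x , t₁≤ , built) =
          step₂ t₁≤ (compile-correct 0 (build rs order) at-build x)
            (simulate base w≤w′ fits at-relocate run
              (sim (λ r → Built.high-reg built (s + r) (m≤m+n s r)) (Built.base-reg built)
                  (Built.memory built))
              (λ _ → m^n>0 2 w))

  -- Distances and radii

  infix 4 _≤∞_
  _≤∞_ : ℕ∞ → ℕ∞ → Set
  _≤∞_ = _≤⁺_

  ≤∞-trans : ∀ {a b c} → a ≤∞ b → b ≤∞ c → a ≤∞ c
  ≤∞-trans = Sup.≤⁺-trans ≤-trans

  d-upper : ∀ {G u v k} → Path G u k v → d G u v ≤∞ [ k ]
  d-upper {G} {u} {v} p with distance G u v
  ... | [ _ ] , _ , least = [ least _ p ]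
  ... | ⊤⁺ , none = ⊥-elim (none _ p)

  d-lower : ∀ {G u v k} → (∀ {j} → Path G u j v → k ≤ j) → [ k ] ≤∞ d G u v
  d-lower {G} {u} {v} lower with distance G u v
  ... | [ _ ] , p , _ = [ lower p ]
  ... | ⊤⁺ , none = _ ≤⊤⁺

  +∞-mono : ∀ {a b c e} → a ≤∞ b → c ≤∞ e → a +∞ c ≤∞ b +∞ e
  +∞-mono (_ ≤⊤⁺) _       = _ ≤⊤⁺
  +∞-mono [ p ]   [ q ]   = [ +-mono-≤ p q ]
  +∞-mono [ p ]   (_ ≤⊤⁺) = _ ≤⊤⁺

  infixr 5 _⊙_
  _⊙_ : ∀ {G u v w j k} → Path G u j v → Path G v k w → Path G u (j + k) w
  []      ⊙ q = q
  (e ∷ p) ⊙ q = e ∷ (p ⊙ q)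

  minOver-≤ : ∀ {n} (f : Fin n → ℕ∞) x {b} → f x ≤∞ b → minOver f ≤∞ b
  minOver-≤ f x p = Extrema.min≤v⁺ ⊤⁺ _ (inj₂ (Any.map⁺ (lose (∈-allFin x) p)))

  ≤-minOver : ∀ {n} (f : Fin n → ℕ∞) {b} → (∀ x → b ≤∞ f x) → b ≤∞ minOver f
  ≤-minOver f p = Extrema.v≤min⁺ (_ ≤⊤⁺) (All.map⁺ (All.tabulate⁺ p))

  maxOver-≤ : ∀ {n} (f : Fin n → ℕ∞) {b} → (∀ x → f x ≤∞ b) → maxOver f ≤∞ b
  maxOver-≤ f {b} p = Extrema.max≤v⁺ (zero-least b) (All.map⁺ (All.tabulate⁺ p))
    where
    zero-least : ∀ b → [ 0 ] ≤∞ b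
    zero-least [ _ ] = [ z≤n ]
    zero-least ⊤⁺    = _ ≤⊤⁺

  ≤-maxOver : ∀ {n} (f : Fin n → ℕ∞) x {b} → b ≤∞ f x → b ≤∞ maxOver f
  ≤-maxOver f x p = Extrema.v≤max⁺ [ 0 ] _ (inj₂ (Any.map⁺ (lose (∈-allFin x) p)))

  -- Emitted edges and their distinctness

  concatMap-unique : ∀ {A B : Set} (f : A → List B) {xs} → Unique xs →
    (∀ {a} → a ∈ xs → Unique (f a)) →
    (∀ {a b y} → a ∈ xs → b ∈ xs → y ∈ f a → y ∈ f b → a ≡ b) → Unique (concatMap f xs)
  concatMap-unique f {[]}     u v sep = []
  concatMap-unique f {x ∷ xs} (x∉ ∷ u) v sep = Unique.++⁺ (v (here refl))
    (concatMap-unique f u (v ∘ there) (λ p q → sep (there p) (there q)))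
    disjoint
    where
    disjoint : ∀ {y} → ¬ (y ∈ f x × y ∈ concatMap f xs)
    disjoint (p , q) with a , a∈ , y∈ ← find (∈-concatMap⁻ f q) =
      All.lookup x∉ a∈ (sep (here refl) (there a∈) p y∈)

  module _ (E : Env) where

    Active : Rule → ℕ → ℕ → Set
    Active r k l = eval (Rule.cond r) (E & (k , l)) ≢ 0

    edge : Rule → ℕ → ℕ → ℕ × ℕ
    edge r k l = eval (Rule.src r) (E & (k , l)) , eval (Rule.dst r) (E & (k , l))

    C₁ : Rule → ℕ
    C₁ r = eval (Rule.count₁ r) (E & (0 , 0))

    C₂ : Rule → ℕ → ℕ
    C₂ r k = eval (Rule.count₂ r) (E & (k , 0))

    ∈-emit₂⁻ : ∀ r {k l e} → e ∈ emit₂ r E k l → Active r k l × e ≡ edge r k l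
    ∈-emit₂⁻ r {k} {l} e∈ with eval (Rule.cond r) (E & (k , l))
    ∈-emit₂⁻ r () | zero
    ∈-emit₂⁻ r (here refl) | suc _ = (λ ()) , refl

    ∈-emit₂⁺ : ∀ r {k l} → Active r k l → edge r k l ∈ emit₂ r E k l
    ∈-emit₂⁺ r a = subst (edge r _ _ ∈_) (sym (emit₂-active r E a)) (here refl)

    ∈-emit₁⁻ : ∀ r {k e} → e ∈ emit₁ r E k → ∃[ l ] l < C₂ r k × Active r k l × e ≡ edge r k l
    ∈-emit₁⁻ r e∈ with l , l∈ , e∈′ ← find (∈-concatMap⁻ _ e∈) =
        l , ∈-downFrom⁻ l∈ , ∈-emit₂⁻ r e∈′

    ∈-emit⁻ : ∀ r {e} → e ∈ emit r E →
      ∃₂ λ k l → k < C₁ r × l < C₂ r k × Active r k l × e ≡ edge r k l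
    ∈-emit⁻ r e∈ with k , k∈ , e∈′ ← find (∈-concatMap⁻ _ e∈)
      with l , l< , a , eq ← ∈-emit₁⁻ r e∈′ = k , l , ∈-downFrom⁻ k∈ , l< , a , eq

    ∈-emit⁺ : ∀ r {k l} → k < C₁ r → l < C₂ r k → Active r k l → edge r k l ∈ emit r E
    ∈-emit⁺ r k< l< a = ∈-concatMap⁺ _ (lose (∈-downFrom⁺ k<)
      (∈-concatMap⁺ _ (lose (∈-downFrom⁺ l<) (∈-emit₂⁺ r a))))

    ∈-emits⁻ : ∀ {R} (rs : Fin R → Rule) {e} → e ∈ emits rs E → ∃[ p ] e ∈ emit (rs p) E
    ∈-emits⁻ {suc R} rs e∈ with ∈-++⁻ (emit (rs 0F) E) e∈
    ... | inj₁ q = 0F , q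
    ... | inj₂ q with p , r ← ∈-emits⁻ (rs ∘ Fin.suc) q = Fin.suc p , r

    ∈-emits⁺ : ∀ {R} (rs : Fin R → Rule) p {e} → e ∈ emit (rs p) E → e ∈ emits rs E
    ∈-emits⁺ rs 0F    e∈ = ∈-++⁺ˡ e∈
    ∈-emits⁺ rs (Fin.suc p) e∈ = ∈-++⁺ʳ (emit (rs 0F) E) (∈-emits⁺ (rs ∘ Fin.suc) p e∈)

    emits-unique : ∀ {R} (rs : Fin R → Rule) → (∀ p → Unique (emit (rs p) E)) →
      (∀ {p q e} → e ∈ emit (rs p) E → e ∈ emit (rs q) E → p ≡ q) → Unique (emits rs E)
    emits-unique {zero}  rs u sep = []
    emits-unique {suc R} rs u sep = Unique.++⁺ (u 0F)
      (emits-unique (rs ∘ Fin.suc) (u ∘ Fin.suc) (λ p q → Fin.suc-injective (sep p q)))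
      disjoint
      where
      disjoint : ∀ {y} → ¬ (y ∈ emit (rs 0F) E × y ∈ emits (rs ∘ Fin.suc) E)
      disjoint (x , y) with p , z ← ∈-emits⁻ (rs ∘ Fin.suc) y with () ← sep x z

  -- From emitted numbers to digraphs with structured vertices

  untype : ∀ {n} → Fin n × Fin n → ℕ × ℕ
  untype (x , y) = toℕ x , toℕ y

  untype-injective : ∀ {n} {e e′ : Fin n × Fin n} → untype e ≡ untype e′ → e ≡ e′
  untype-injective p = cong₂ _,_ (Fin.toℕ-injective (cong proj₁ p))
      (Fin.toℕ-injective (cong proj₂ p))

  untype-∈⁻ : ∀ {n} {e : Fin n × Fin n} {xs} → untype e ∈ map untype xs → e ∈ xs
  untype-∈⁻ {xs = xs} p with e′ , e′∈ , eq ← ∈-map⁻ untype p =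
    subst (_∈ xs) (sym (untype-injective eq)) e′∈

  -- A digraph must list its edges without repetition. This follows from `key`, which recovers the
  -- rule and both loop indices from the ends of an edge; its values on other pairs of vertices are
  -- arbitrary.
  record Presentation {R : ℕ} (rs : Fin R → Rule) (order : Exp) (E : Env) : Set₁ where
    N : ℕ
    N = eval order (E & (0 , 0))
    field
      Node      : Set
      vert      : Node → Fin N
      node      : Fin N → Node
      node-vert : ∀ u → node (vert u) ≡ u
      vert-node : ∀ x → vert (node x) ≡ x
      ends      : ∀ p (k : Fin (C₁ E (rs p))) → Fin (C₂ E (rs p) (toℕ k)) → Node × Node
      src-ok    : ∀ p k l → eval (Rule.src (rs p)) (E & (toℕ k , toℕ l)) ≡ toℕ
          (vert (proj₁ (ends p k l)))
      dst-ok    : ∀ p k l → eval (Rule.dst (rs p)) (E & (toℕ k , toℕ l)) ≡ toℕ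
          (vert (proj₂ (ends p k l)))
      key       : Node → Node → Fin R × ℕ × ℕ
      key-ends  : ∀ p k l → uncurry key (ends p k l) ≡ (p , toℕ k , toℕ l)
      N≢0       : N ≢ 0

    es : List (ℕ × ℕ)
    es = emits rs E

    data Edge : Node → Node → Set where
      by : ∀ p k l → Active E (rs p) (toℕ k) (toℕ l) →
           Edge (proj₁ (ends p k l)) (proj₂ (ends p k l))

    private
      code : Node × Node → ℕ × ℕ
      code (u , v) = toℕ (vert u) , toℕ (vert v)

      vert-injective : ∀ {u v} → vert u ≡ vert v → u ≡ v
      vert-injective p = trans (sym (node-vert _)) (trans (cong node p) (node-vert _))

      code-injective : ∀ {e e′} → code e ≡ code e′ → e ≡ e′
      code-injective p = cong₂ _,_ (vert-injective (Fin.toℕ-injective (cong proj₁ p)))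
                                   (vert-injective (Fin.toℕ-injective (cong proj₂ p)))

      edge-code : ∀ p k l → edge E (rs p) (toℕ k) (toℕ l) ≡ code (ends p k l)
      edge-code p k l = cong₂ _,_ (src-ok p k l) (dst-ok p k l)

      typed : ∀ p {k l} → k < C₁ E (rs p) → l < C₂ E (rs p) k →
        ∃₂ λ (k′ : Fin (C₁ E (rs p))) (l′ : Fin (C₂ E (rs p) (toℕ k′))) → toℕ k′ ≡ k × toℕ l′ ≡ l
      typed p {k} {l} k< l< =
          fromℕ< k<
        , Fin.cast (sym (cong (C₂ E (rs p)) (Fin.toℕ-fromℕ< k<))) (fromℕ< l<)
        , Fin.toℕ-fromℕ< k<
        , trans (Fin.toℕ-cast _ (fromℕ< l<)) (Fin.toℕ-fromℕ< l<)

      -- Equal pairs of numbers come from equal pairs of nodes, and `key` reads rule and indices off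
      -- these.
      collide : ∀ {p q k l k′ l′} → k < C₁ E (rs p) → l < C₂ E (rs p) k →
        k′ < C₁ E (rs q) → l′ < C₂ E (rs q) k′ → edge E (rs p) k l ≡ edge E (rs q) k′ l′ →
        (p , k , l) ≡ (q , k′ , l′)
      collide {p} {q} k< l< k′< l′< eq
        with a , b , refl , refl ← typed p k< l<
        with a′ , b′ , refl , refl ← typed q k′< l′< =
        trans (sym (key-ends p a b)) (trans (cong (uncurry key)
          (code-injective (trans (sym (edge-code p a b)) (trans eq (edge-code q a′ b′)))))
          (key-ends q a′ b′))

    es-unique : Unique es
    es-unique = emits-unique E rs
      (λ p → concatMap-unique _ (Unique.downFrom⁺ _)
        (λ k∈ → concatMap-unique _ (Unique.downFrom⁺ _) (λ {l} _ → single p l)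
          λ {l} {l′} l∈ l′∈ x y → same₂ p (∈-downFrom⁻ k∈) (∈-downFrom⁻ l∈) (∈-downFrom⁻ l′∈)
            (trans (sym (proj₂ (∈-emit₂⁻ E (rs p) x))) (proj₂ (∈-emit₂⁻ E (rs p) y))))
        (λ k∈ k′∈ x y → same₁ p (∈-downFrom⁻ k∈) (∈-downFrom⁻ k′∈) (∈-emit₁⁻ E (rs p) x)
            (∈-emit₁⁻ E (rs p) y)))
      (λ {p} {q} x y → same₀ (∈-emit⁻ E (rs p) x) (∈-emit⁻ E (rs q) y))
      where
      single : ∀ p l {k} → Unique (emit₂ (rs p) E k l)
      single p l {k} with eval (Rule.cond (rs p)) (E & (k , l)) ≡ᵇ 0
      ... | true  = []
      ... | false = [] ∷ []
      same₂ : ∀ p {k l l′} → k < C₁ E (rs p) → l < C₂ E (rs p) k → l′ < C₂ E (rs p) k →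
        edge E (rs p) k l ≡ edge E (rs p) k l′ → l ≡ l′
      same₂ p k< l< l′< eq = cong (proj₂ ∘ proj₂) (collide k< l< k< l′< eq)
      same₁ : ∀ p {k k′ e} → k < C₁ E (rs p) → k′ < C₁ E (rs p) →
        (∃[ l ] l < C₂ E (rs p) k × Active E (rs p) k l × e ≡ edge E (rs p) k l) →
        (∃[ l ] l < C₂ E (rs p) k′ × Active E (rs p) k′ l × e ≡ edge E (rs p) k′ l) → k ≡ k′
      same₁ p k< k′< (l , l< , _ , eq) (l′ , l′< , _ , eq′) =
        cong (proj₁ ∘ proj₂) (collide k< l< k′< l′< (trans (sym eq) eq′))
      same₀ : ∀ {p q e} →
        (∃₂ λ k l → k < C₁ E (rs p) × l < C₂ E (rs p) k × Active E (rs p) k l ×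
            e ≡ edge E (rs p) k l) →
        (∃₂ λ k l → k < C₁ E (rs q) × l < C₂ E (rs q) k × Active E (rs q) k l ×
            e ≡ edge E (rs q) k l) → p ≡ q
      same₀ (k , l , k< , l< , _ , eq) (k′ , l′ , k′< , l′< , _ , eq′) =
        cong proj₁ (collide k< l< k′< l′< (trans (sym eq) eq′))

    ∈-es⁻ : ∀ {e} → e ∈ es → ∃₂ λ u v → Edge u v × e ≡ code (u , v)
    ∈-es⁻ e∈ with p , e∈′ ← ∈-emits⁻ E rs e∈
      with k , l , k< , l< , a , refl ← ∈-emit⁻ E (rs p) e∈′
      with k′ , l′ , refl , refl ← typed p k< l< = _ , _ , by p k′ l′ a , edge-code p k′ l′

    ∈-es⁺ : ∀ {u v} → Edge u v → code (u , v) ∈ es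
    ∈-es⁺ (by p k l a) = ∈-emits⁺ E rs p (subst (_∈ emit (rs p) E) (edge-code p k l)
      (∈-emit⁺ E (rs p) (Fin.toℕ<n k) (Fin.toℕ<n l) a))

    private
      -- The program emits natural numbers, whereas a digraph has edges in `Fin`. Lifting the list
      -- entry by entry preserves its order and hence its encoding.
      attach : ∀ xs → (∀ {e} → e ∈ xs → e ∈ es) → ∃[ ys ] map untype ys ≡ xs
      attach []       p = [] , refl
      attach (x ∷ xs) p with u , v , _ , eq ← ∈-es⁻ (p (here refl))
        with ys , q ← attach xs (p ∘ there) = (vert u , vert v) ∷ ys , cong₂ _∷_ (sym eq) q

      fin-edges : ∃[ ys ] map untype ys ≡ es
      fin-edges = attach es id

    graph : Digraph
    graph = record
      { order         = N
      ; order-nonZero = ≢-nonZero N≢0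
      ; edges         = proj₁ fin-edges
      ; edges-unique  = AllPairs.map (λ p q → p (cong untype q))
          (AllPairs.map⁻ (subst Unique (sym (proj₂ fin-edges)) es-unique))
      }

    size-graph : size graph ≡ length es
    size-graph = trans (sym (length-map untype (proj₁ fin-edges))) (cong length (proj₂ fin-edges))

    -- Identifies the words written by the reduction program with the input that the approximation
    -- program expects.
    encode-graph : encodeDigraph graph ≡ N ∷ length es ∷ flat es
    encode-graph = cong₂ (λ k xs → N ∷ k ∷ xs) size-graph
      (trans (sym (concatMap-map _ untype (proj₁ fin-edges))) (cong flat (proj₂ fin-edges)))

    Walk : Node → ℕ → Node → Set
    Walk u k v = Path graph (vert u) k (vert v)

    walk-edge : ∀ {u v} → Edge u v → Walk u 1 v
    walk-edge e = untype-∈⁻ (subst (_ ∈_) (sym (proj₂ fin-edges)) (∈-es⁺ e)) ∷ []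

    Potential : (Node → ℕ) → Set
    Potential φ = ∀ p k l → Active E (rs p) (toℕ k) (toℕ l) →
      φ (proj₂ (ends p k l)) ≤ suc (φ (proj₁ (ends p k l)))

    potential-bound : ∀ φ → Potential φ → ∀ {x k y} → Path graph x k y →
                      φ (node y) ≤ k + φ (node x)
    potential-bound φ pot [] = ≤-refl
    potential-bound φ pot {x} {suc k} {y} (_∷_ {v = z} e path) = begin
      φ (node y)           ≤⟨ potential-bound φ pot path ⟩
      k + φ (node z)       ≤⟨ +-monoʳ-≤ k (along
          (∈-es⁻ (subst (untype (x , z) ∈_) (proj₂ fin-edges) (∈-map⁺ untype e)))) ⟩
      k + suc (φ (node x)) ≡⟨ +-suc k _ ⟩
      suc k + φ (node x)   ∎
      where
      open ≤-Reasoning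
      along : (∃₂ λ u v → Edge u v × untype (x , z) ≡ code (u , v)) →
          φ (node z) ≤ suc (φ (node x))
      along (_ , _ , by p k l a , eq) = subst₂ (λ u v → φ v ≤ suc (φ u))
        (sym (decoded (cong proj₁ (untype-injective eq))))
            (sym (decoded (cong proj₂ (untype-injective eq))))
        (pot p k l a)
        where
        decoded : ∀ {x u} → x ≡ vert u → node x ≡ u
        decoded q = trans (cong node q) (node-vert _)

    far : ∀ φ → Potential φ → ∀ {u v t} → φ u + t ≤ φ v → [ t ] ≤∞ d graph (vert u) (vert v)
    far φ pot {u} {v} {t} p = d-lower {graph} λ {j} path → +-cancelˡ-≤ (φ u) t j (begin
      φ u + t               ≤⟨ p ⟩
      φ v                   ≡⟨ cong φ (node-vert v) ⟨
      φ (node (vert v))     ≤⟨ potential-bound φ pot path ⟩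
      j + φ (node (vert u)) ≡⟨ cong (λ x → j + φ x) (node-vert u) ⟩
      j + φ u               ≡⟨ +-comm j (φ u) ⟩
      φ u + j               ∎)
      where open ≤-Reasoning

    infixr 5 _then_

    data _⟶⟨_⟩_ (u : Node) (t : ℕ) (v : Node) : Set where
      reach : ∀ {k} → k ≤ t → Walk u k v → u ⟶⟨ t ⟩ v

    _then_ : ∀ {u v x s t} → u ⟶⟨ s ⟩ v → v ⟶⟨ t ⟩ x → u ⟶⟨ s + t ⟩ x
    reach p w then reach q w′ = reach (+-mono-≤ p q) (w ⊙ w′)

    weaken : ∀ {u v s t} → s ≤ t → u ⟶⟨ s ⟩ v → u ⟶⟨ t ⟩ v
    weaken s≤t (reach p w) = reach (≤-trans p s≤t) w

    stay : ∀ {u} → u ⟶⟨ 0 ⟩ u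
    stay = reach z≤n []

    arrow : ∀ {u v} → Edge u v → u ⟶⟨ 1 ⟩ v
    arrow e = reach ≤-refl (walk-edge e)

    near : ∀ {u v t} → u ⟶⟨ t ⟩ v → d graph (vert u) (vert v) ≤∞ [ t ]
    near (reach p w) = ≤∞-trans (d-upper {graph} w) [ p ]

    dist : Node → Node → ℕ∞
    dist u v = d graph (vert u) (vert v)

    roundtrip-far : ∀ u v {s t} → [ s ] ≤∞ dist u v → [ t ] ≤∞ dist v u →
                    [ s + t ] ≤∞ dist u v +∞ dist v u
    roundtrip-far u v p q = +∞-mono p q

    roundtrip-near : ∀ {u v s t b} → u ⟶⟨ s ⟩ v → v ⟶⟨ t ⟩ u → s + t ≤ b →
                     dist u v +∞ dist v u ≤∞ [ b ]
    roundtrip-near p q s+t≤b = ≤∞-trans (+∞-mono (near p) (near q)) [ s+t≤b ]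

  -- The two radius problems differ only in how the two distances are combined.
  module Radius (_∙_ : ℕ∞ → ℕ∞ → ℕ∞) where

    radius : Digraph → ℕ∞
    radius G = minOver λ x → maxOver λ v → d G x v ∙ d G v x

    module _ {R : ℕ} {rs : Fin R → Rule} {order : Exp} {E : Env} (Γ : Presentation {R} rs order E)
        where

      open Presentation Γ

      radius-≤ : ∀ u {b} → (∀ v → dist u v ∙ dist v u ≤∞ b) →
                 radius graph ≤∞ b
      radius-≤ u {b} p = minOver-≤ _ (vert u) (maxOver-≤ _ λ x →
        subst (λ y → d graph (vert u) y ∙ d graph y (vert u) ≤∞ b) (vert-node x) (p (node x)))

      ≤-radius : ∀ {b} → (∀ u → ∃[ v ] b ≤∞ dist u v ∙ dist v u) →
                 b ≤∞ radius graph
      ≤-radius {b} p = ≤-minOver _ λ x → ≤-maxOver _ (vert (proj₁ (p (node x))))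
        (subst (λ y → b ≤∞ d graph y (vert (proj₁ (p (node x)))) ∙ d graph
            (vert (proj₁ (p (node x)))) y)
               (vert-node x) (proj₂ (p (node x))))

  -- Two families of sets and their bits in memory

  bit : Bool → ℕ
  bit b = if b then 1 else 0

  bit≢0⇒true : ∀ {b} → bit b ≢ 0 → b ≡ true
  bit≢0⇒true {true}  p = refl
  bit≢0⇒true {false} p = contradiction refl p

  true⇒bit≢0 : ∀ {b} → b ≡ true → bit b ≢ 0
  true⇒bit≢0 refl ()

  record Families : Set where
    field
      n U : ℕ
      a b : Fin n → Fin U → Bool
      inp : ℕ → ℕ
      inp-a : ∀ k e → inp (2 + (toℕ k * U + toℕ e)) ≡ bit (a k e)
      inp-b : ∀ k e → inp (2 + (n * U + (toℕ k * U + toℕ e))) ≡ bit (b k e)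

    E : Env
    E = env n U 0 0 inp

    Hit : Fin n → Fin n → Set
    Hit k j = ∃[ e ] a k e ≡ true × b j e ≡ true

    Hit? : ∀ k j → Dec (Hit k j)
    Hit? k j = Fin.any? λ e → (a k e Bool.≟ true) ×-dec (b j e Bool.≟ true)

    Hitting : Set
    Hitting = ∃[ k ] ∀ j → Hit k j

    missed : ¬ Hitting → ∀ k → ∃[ j ] ¬ Hit k j
    missed ¬h k = Fin.¬∀⟶∃¬ n (Hit k) (Hit? k) λ h → ¬h (k , h)

  -- The graph for the max radius

  module MaxGraph (L : ℕ) where

    K : ℕ
    K = suc L

    at′ : Exp → Exp → Exp
    at′ c i = lit 1 ⊞ (#U ⊞ (lit K ⊠ c ⊞ i))

    chains : Exp
    chains = lit 2 ⊞ (#n ⊞ #n)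

    -- Vertex 0 is the hub; then come the elements, and K vertices for each of the
    -- chains z⁰, z¹, aₖ and bₖ.  maxEnds shows the edges.
    maxRules : Fin 7 → Rule
    maxRules 0F = record
      { count₁ = #U ⊞ chains ⊠ lit K ; count₂ = lit 1 ; cond = lit 1
      ; src = lit 0 ; dst = lit 1 ⊞ #i }
    maxRules 1F = record
      { count₁ = chains ; count₂ = lit L ; cond = lit 1
      ; src = at′ #i #j ; dst = at′ #i (lit 1 ⊞ #j) }
    maxRules 2F = record
      { count₁ = #n ; count₂ = lit 1 ; cond = lit 1
      ; src = at′ (lit 2 ⊞ #i) (lit L) ; dst = lit 0 }
    maxRules 3F = record
      { count₁ = #n ; count₂ = lit 2 ; cond = lit 1
      ; src = at′ #j (lit L) ; dst = at′ (lit 2 ⊞ #i) (lit 0) }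
    maxRules 4F = record
      { count₁ = #U ; count₂ = lit 1 ; cond = lit 1
      ; src = lit 1 ⊞ #i ; dst = at′ (lit 0) (lit 0) }
    maxRules 5F = record
      { count₁ = #n ; count₂ = #U
      ; cond = ld (lit 2 ⊞ (#n ⊠ #U ⊞ (#i ⊠ #U ⊞ #j)))
      ; src = at′ (lit 2 ⊞ (#n ⊞ #i)) (lit L) ; dst = lit 1 ⊞ #j }
    maxRules 6F = record
      { count₁ = #n ; count₂ = #U ; cond = ld (lit 2 ⊞ (#i ⊠ #U ⊞ #j))
      ; src = lit 1 ⊞ #j ; dst = at′ (lit 2 ⊞ #i) (lit 0) }

    maxOrder : Exp
    maxOrder = lit 1 ⊞ (#U ⊞ chains ⊠ lit K)

    module _ (F : Families) where

      open Families F

      data Chain : Set where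
        z : Fin 2 → Chain
        A B : Fin n → Chain

      data Vertex : Set where
        hub   : Vertex
        elt   : Fin U → Vertex
        chain : Chain → Fin K → Vertex

      index : Chain → Fin (2 + (n + n))
      index (z s) = s Fin.↑ˡ (n + n)
      index (A k) = 2 Fin.↑ʳ (k Fin.↑ˡ n)
      index (B k) = 2 Fin.↑ʳ (n Fin.↑ʳ k)

      chainOf : Fin (2 + (n + n)) → Chain
      chainOf x = [ z , (λ y → [ A , B ]′ (Fin.splitAt n y)) ]′ (Fin.splitAt 2 x)

      chainOf-index : ∀ c → chainOf (index c) ≡ c
      chainOf-index (z s) rewrite Fin.splitAt-↑ˡ 2 s (n + n) = refl
      chainOf-index (A k) rewrite Fin.splitAt-↑ˡ n k n = refl
      chainOf-index (B k) rewrite Fin.splitAt-↑ʳ n n k = refl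

      index-chainOf : ∀ x → index (chainOf x) ≡ x
      index-chainOf 0F = refl
      index-chainOf 1F = refl
      index-chainOf (Fin.suc (Fin.suc x)) with Fin.splitAt n x in eq
      ... | inj₁ k = cong (2 Fin.↑ʳ_) (Fin.splitAt⁻¹-↑ˡ eq)
      ... | inj₂ k = cong (2 Fin.↑ʳ_) (Fin.splitAt⁻¹-↑ʳ eq)

      toVert : Vertex → Fin (1 + (U + (2 + (n + n)) * K))
      toVert hub         = 0F
      toVert (elt e)     = Fin.suc (e Fin.↑ˡ _)
      toVert (chain c i) = Fin.suc (U Fin.↑ʳ Fin.combine (index c) i)

      link : Fin ((2 + (n + n)) * K) → Vertex
      link x = chain (chainOf (proj₁ (Fin.remQuot {2 + (n + n)} K x)))
                     (proj₂ (Fin.remQuot {2 + (n + n)} K x))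

      spoke : Fin (U + (2 + (n + n)) * K) → Vertex
      spoke x = [ elt , link ]′ (Fin.splitAt U x)

      fromVert : Fin (1 + (U + (2 + (n + n)) * K)) → Vertex
      fromVert 0F    = hub
      fromVert (Fin.suc x) = spoke x

      from-to : ∀ u → fromVert (toVert u) ≡ u
      from-to hub         = refl
      from-to (elt e)     rewrite Fin.splitAt-↑ˡ U e ((2 + (n + n)) * K) = refl
      from-to (chain c i) = trans
        (cong [ elt , link ]′ (Fin.splitAt-↑ʳ U ((2 + (n + n)) * K) (Fin.combine (index c) i)))
        (trans (cong (λ q → chain (chainOf (proj₁ q)) (proj₂ q))
            (Fin.remQuot-combine (index c) i))
               (cong (λ c → chain c i) (chainOf-index c)))

      to-spoke : ∀ x → toVert (spoke x) ≡ Fin.suc x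
      to-spoke x with Fin.splitAt U x in eq
      ... | inj₁ e = cong Fin.suc (Fin.splitAt⁻¹-↑ˡ eq)
      ... | inj₂ y = cong Fin.suc (trans (cong (U Fin.↑ʳ_)
              (trans (cong (λ c → Fin.combine c (proj₂ (Fin.remQuot {2 + (n + n)} K y)))
                        (index-chainOf (proj₁ (Fin.remQuot {2 + (n + n)} K y))))
                     (Fin.combine-remQuot {2 + (n + n)} K y)))
              (Fin.splitAt⁻¹-↑ʳ eq))

      to-from : ∀ x → toVert (fromVert x) ≡ x
      to-from 0F    = refl
      to-from (Fin.suc x) = to-spoke x

      tip : Fin K
      tip = Fin.fromℕ L

      -- The hub is one step from every other vertex, so whoever reaches it quickly reaches
      -- everything quickly. The elements lead to `z 0F` in order that those outside the hitting set
      -- can reach it, too, within L + 2 steps.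
      maxEnds : ∀ p (k : Fin (C₁ E (maxRules p))) → Fin (C₂ E (maxRules p) (toℕ k)) → Vertex ×
          Vertex
      maxEnds 0F k l = hub , spoke k
      maxEnds 1F k l = chain (chainOf k) (Fin.inject₁ l) , chain (chainOf k) (Fin.suc l)
      maxEnds 2F k l = chain (A k) tip , hub
      maxEnds 3F k l = chain (z l) tip , chain (A k) 0F
      maxEnds 4F k l = elt k , chain (z 0F) 0F
      maxEnds 5F k l = chain (B k) tip , elt l
      maxEnds 6F k l = elt l , chain (A k) 0F

      private
        code-chain : ∀ c i {x y} → x ≡ toℕ (index c) → y ≡ toℕ i →
                     1 + (U + (K * x + y)) ≡ toℕ (toVert (chain c i))
        code-chain c i p q = cong suc (trans (cong (U +_)
            (trans (cong₂ (λ x y → K * x + y) p q) (sym (Fin.toℕ-combine (index c) i))))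
          (sym (Fin.toℕ-↑ʳ U (Fin.combine (index c) i))))

        code-elt : ∀ e → suc (toℕ e) ≡ toℕ (toVert (elt e))
        code-elt e = cong suc (sym (Fin.toℕ-↑ˡ e _))

        code-z : ∀ s → toℕ s ≡ toℕ (index (z s))
        code-z s = sym (Fin.toℕ-↑ˡ s (n + n))

        code-A : ∀ k → 2 + toℕ k ≡ toℕ (index (A k))
        code-A k = cong (2 +_) (sym (Fin.toℕ-↑ˡ k n))

        code-B : ∀ k → 2 + (n + toℕ k) ≡ toℕ (index (B k))
        code-B k = cong (2 +_) (sym (Fin.toℕ-↑ʳ n k))

        code-tip : L ≡ toℕ tip
        code-tip = sym (Fin.toℕ-fromℕ L)

      -- The shapes of the ends determine the rule: between two chains there are only the steps
      -- within a chain and the edges from a `z` to an `A`. Combinations that are no edges get dummy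
      -- values.
      maxKey : Vertex → Vertex → Fin 7 × ℕ × ℕ
      maxKey hub               v                 = 0F , pred (toℕ (toVert v)) , 0
      maxKey (chain (z s) i)   (chain (A k) j)   = 3F , toℕ k , toℕ s
      maxKey (chain c i)       (chain c′ j)      = 1F , toℕ (index c) , toℕ i
      maxKey (chain (A k) i)   hub               = 2F , toℕ k , 0
      maxKey (chain _ i)       hub               = 2F , 0 , 0
      maxKey (chain (B k) i)   (elt e)           = 5F , toℕ k , toℕ e
      maxKey (chain _ i)       (elt e)           = 5F , 0 , 0
      maxKey (elt e)           (chain (A k) j)   = 6F , toℕ k , toℕ e
      maxKey (elt e)           _                 = 4F , toℕ e , 0

      private
        key-chain : ∀ c i j → maxKey (chain c i) (chain c j) ≡ (1F , toℕ (index c) , toℕ i)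
        key-chain (z _) i j = refl
        key-chain (A _) i j = refl
        key-chain (B _) i j = refl

        src-ok : ∀ p k l → eval (Rule.src (maxRules p)) (E & (toℕ k , toℕ l)) ≡
                           toℕ (toVert (proj₁ (maxEnds p k l)))
        src-ok 0F k l = refl
        src-ok 1F k l = code-chain (chainOf k) (Fin.inject₁ l)
          (cong toℕ (sym (index-chainOf k))) (sym (Fin.toℕ-inject₁ l))
        src-ok 2F k l = code-chain (A k) tip (code-A k) code-tip
        src-ok 3F k l = code-chain (z l) tip (code-z l) code-tip
        src-ok 4F k l = code-elt k
        src-ok 5F k l = code-chain (B k) tip (code-B k) code-tip
        src-ok 6F k l = code-elt l

        dst-ok : ∀ p k l → eval (Rule.dst (maxRules p)) (E & (toℕ k , toℕ l)) ≡
                           toℕ (toVert (proj₂ (maxEnds p k l)))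
        dst-ok 0F k l = cong toℕ (sym (to-spoke k))
        dst-ok 1F k l = code-chain (chainOf k) (Fin.suc l) (cong toℕ (sym (index-chainOf k))) refl
        dst-ok 2F k l = refl
        dst-ok 3F k l = code-chain (A k) 0F (code-A k) refl
        dst-ok 4F k l = code-chain (z 0F) 0F refl refl
        dst-ok 5F k l = code-elt l
        dst-ok 6F k l = code-chain (A k) 0F (code-A k) refl

        key-ends : ∀ p k l → uncurry maxKey (maxEnds p k l) ≡ (p , toℕ k , toℕ l)
        key-ends 0F k 0F = cong (λ x → 0F , pred (toℕ x) , 0) (to-spoke k)
        key-ends 1F k l = trans (key-chain (chainOf k) (Fin.inject₁ l) (Fin.suc l))
          (cong₂ (λ x y → 1F , x , y) (cong toℕ (index-chainOf k)) (Fin.toℕ-inject₁ l))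
        key-ends 2F k 0F = refl
        key-ends 3F k l = refl
        key-ends 4F k 0F = refl
        key-ends 5F k l = refl
        key-ends 6F k l = refl

      maxPresentation : Presentation maxRules maxOrder E
      maxPresentation = record
        { Node = Vertex ; vert = toVert ; node = fromVert ; node-vert = from-to ; vert-node =
            to-from
        ; ends = maxEnds ; src-ok = src-ok ; dst-ok = dst-ok ; key = maxKey ; key-ends = key-ends
        ; N≢0 = λ () }

      open Presentation maxPresentation hiding (src-ok; dst-ok; key-ends)

      hub⟶ : ∀ {v} → v ≢ hub → hub ⟶⟨ 1 ⟩ v
      hub⟶ {v} v≢ with toVert v in eq
      ... | 0F  = contradiction (trans (sym (from-to v)) (cong fromVert eq)) v≢
      ... | Fin.suc x = subst (hub ⟶⟨ 1 ⟩_) (trans (cong fromVert (sym eq)) (from-to v))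
                              (arrow (by 0F x 0F λ ()))

      along : ∀ c i → chain c (Fin.inject₁ i) ⟶⟨ 1 ⟩ chain c (Fin.suc i)
      along c i = subst (λ c → chain c (Fin.inject₁ i) ⟶⟨ 1 ⟩ chain c (Fin.suc i))
        (chainOf-index c) (arrow (by 1F (index c) i λ ()))

      to-tip : ∀ c i → chain c i ⟶⟨ L ⟩ chain c tip
      to-tip c i = weaken (m∸n≤m L (toℕ i)) (go i)
        where
        go : ∀ i → chain c i ⟶⟨ L ∸ toℕ i ⟩ chain c tip
        go = Fin.>-weakInduction (λ i → chain c i ⟶⟨ L ∸ toℕ i ⟩ chain c tip)
          (weaken z≤n stay)
          λ i p → subst (λ t → chain c (Fin.inject₁ i) ⟶⟨ t ⟩ chain c tip)
            (trans (sym (+-∸-assoc 1 (Fin.toℕ<n i))) (cong (L ∸_) (sym (Fin.toℕ-inject₁ i))))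
            (along c i then p)

      module _ {k : Fin n} (hits : ∀ j → Hit k j) where

        centre : Vertex
        centre = chain (A k) 0F

        to-hub : centre ⟶⟨ L + 1 ⟩ hub
        to-hub = to-tip (A k) 0F then arrow (by 2F k 0F λ ())

        from-centre : ∀ v → centre ⟶⟨ L + 2 ⟩ v
        from-centre hub         = weaken (+-monoʳ-≤ L (n≤1+n 1)) to-hub
        from-centre (elt e)     = weaken (≤-reflexive (+-assoc L 1 1)) (to-hub then hub⟶ λ ())
        from-centre (chain c i) = weaken (≤-reflexive (+-assoc L 1 1)) (to-hub then hub⟶ λ ())

        z⟶centre : ∀ s i → chain (z s) i ⟶⟨ L + 1 ⟩ centre
        z⟶centre s i = to-tip (z s) i then arrow (by 3F k s λ ())

        to-centre : ∀ v → v ⟶⟨ L + 2 ⟩ centre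
        to-centre hub             = weaken (≤-trans (n≤1+n 1) (m≤n+m 2 L)) (hub⟶ λ ())
        to-centre (elt e)         = weaken (≤-reflexive (sym (+-suc L 1)))
          (arrow (by 4F e 0F λ ()) then z⟶centre 0F 0F)
        to-centre (chain (z s) i) = weaken (+-monoʳ-≤ L (n≤1+n 1)) (z⟶centre s i)
        to-centre (chain (A j) i) =
          to-tip (A j) i then arrow (by 2F j 0F λ ()) then hub⟶ λ ()
        -- This is the only case that depends on hitting: an element common to both sets leads from
        -- `B j` straight to the centre.
        to-centre (chain (B j) i) with e , a≡ , b≡ ← hits j =
          to-tip (B j) i
          then arrow (by 5F j e (λ p → true⇒bit≢0 b≡ (trans (sym (inp-b j e)) p)))
          then arrow (by 6F k e (λ p → true⇒bit≢0 a≡ (trans (sym (inp-a k e)) p)))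

      maxRadius-yes : Hitting → MaxRadius graph ≤∞ [ L + 2 ]
      maxRadius-yes (k , hits) = Radius.radius-≤ Max∞._⊔_ maxPresentation (centre hits) λ v →
        Max∞.⊔-lub (near (from-centre hits v)) (near (to-centre hits v))

      i≤L : ∀ (i : Fin K) → toℕ i ≤ L
      i≤L i = ≤-pred (Fin.toℕ<n i)

      -- Distances from the base of bⱼ, truncated at 2 L.
      module _ (j : Fin n) where

        φ : Vertex → ℕ
        φ hub             = L + L
        φ (elt e)         = if b j e then L else L + L
        φ (chain (z s) i) = L + toℕ i
        φ (chain (A k) i) = if does (Hit? k j) then L + toℕ i else L + L
        φ (chain (B k) i) = if does (k Fin.≟ j) then toℕ i else L + L

        φ≤ : ∀ v → φ v ≤ L + L
        φ≤ hub             = ≤-refl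
        φ≤ (elt e)         with b j e
        ... | true  = m≤m+n L L
        ... | false = ≤-refl
        φ≤ (chain (z s) i) = +-monoʳ-≤ L (i≤L i)
        φ≤ (chain (A k) i) with does (Hit? k j)
        ... | true  = +-monoʳ-≤ L (i≤L i)
        ... | false = ≤-refl
        φ≤ (chain (B k) i) with does (k Fin.≟ j)
        ... | true  = ≤-trans (i≤L i) (m≤m+n L L)
        ... | false = ≤-refl

        φ-along : ∀ c i → φ (chain c (Fin.suc i)) ≤ suc (φ (chain c (Fin.inject₁ i)))
        φ-along (z s) i rewrite Fin.toℕ-inject₁ i = ≤-reflexive (+-suc L (toℕ i))
        φ-along (A k) i with does (Hit? k j)
        ... | true rewrite Fin.toℕ-inject₁ i = ≤-reflexive (+-suc L (toℕ i))
        ... | false = n≤1+n _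
        φ-along (B k) i with does (k Fin.≟ j)
        ... | true rewrite Fin.toℕ-inject₁ i = ≤-refl
        ... | false = n≤1+n _

        -- No value exceeds 2 L, so edges that leave a vertex at 2 L are harmless. What remains is
        -- the way along the path of bⱼ and its elements to the sets; a set still at 2 L there would
        -- be missed by bⱼ in spite of a common element.
        φ-potential : Potential φ
        φ-potential 0F k l _ = m≤n⇒m≤1+n (φ≤ (spoke k))
        φ-potential 1F k l _ = φ-along (chainOf k) l
        φ-potential 2F k l _ with does (Hit? k j)
        ... | true rewrite Fin.toℕ-fromℕ L = n≤1+n _
        ... | false = n≤1+n _
        φ-potential 3F k l _ rewrite Fin.toℕ-fromℕ L = m≤n⇒m≤1+n (φ≤ (chain (A k) 0F))
        φ-potential 4F k l _ with b j k
        ... | true  = ≤-trans (≤-reflexive (+-identityʳ L)) (n≤1+n L)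
        ... | false = m≤n⇒m≤1+n (≤-trans (≤-reflexive (+-identityʳ L)) (m≤m+n L L))
        φ-potential 5F k l active with k Fin.≟ j
        ... | no _ = m≤n⇒m≤1+n (φ≤ (elt l))
        ... | yes refl
          rewrite bit≢0⇒true {b k l} (λ p → active (trans (inp-b k l) p)) | Fin.toℕ-fromℕ L =
              n≤1+n L
        φ-potential 6F k l active with b j l in b≡
        ... | false = m≤n⇒m≤1+n (φ≤ (chain (A k) 0F))
        ... | true with Hit? k j
        ...   | yes _ = ≤-trans (≤-reflexive (+-identityʳ L)) (n≤1+n L)
        ...   | no ¬h = contradiction (l , bit≢0⇒true {a k l} (λ p → active (trans (inp-a k l) p))
            , b≡) ¬h

        φ-base : φ (chain (B j) 0F) ≡ 0
        φ-base with j Fin.≟ j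
        ... | yes _ = refl
        ... | no ¬p = contradiction refl ¬p

        φ-missed : ∀ {k} i → ¬ Hit k j → φ (chain (A k) i) ≡ L + L
        φ-missed {k} i ¬h with Hit? k j
        ... | yes h = contradiction h ¬h
        ... | no _  = refl

        far-from-b : ∀ {k} i → ¬ Hit k j →
          [ L + L ] ≤∞ dist (chain (B j) 0F) (chain (A k) i)
        far-from-b {k} i ¬h = far φ φ-potential {chain (B j) 0F} {chain (A k) i}
          (≤-reflexive (trans (cong (_+ (L + L)) φ-base) (sym (φ-missed i ¬h))))

      -- Distances from the base of zˢ, truncated at 2 L.
      module _ (s : Fin 2) where

        ψ : Vertex → ℕ
        ψ (chain (z r) i) = if does (r Fin.≟ s) then toℕ i else L + L
        ψ (chain (A k) i) = L + toℕ i
        ψ _               = L + L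

        ψ≤ : ∀ v → ψ v ≤ L + L
        ψ≤ hub             = ≤-refl
        ψ≤ (elt e)         = ≤-refl
        ψ≤ (chain (z r) i) with does (r Fin.≟ s)
        ... | true  = ≤-trans (i≤L i) (m≤m+n L L)
        ... | false = ≤-refl
        ψ≤ (chain (A k) i) = +-monoʳ-≤ L (i≤L i)
        ψ≤ (chain (B k) i) = ≤-refl

        ψ-along : ∀ c i → ψ (chain c (Fin.suc i)) ≤ suc (ψ (chain c (Fin.inject₁ i)))
        ψ-along (z r) i with does (r Fin.≟ s)
        ... | true rewrite Fin.toℕ-inject₁ i = ≤-refl
        ... | false = n≤1+n _
        ψ-along (A k) i rewrite Fin.toℕ-inject₁ i = ≤-reflexive (+-suc L (toℕ i))
        ψ-along (B k) i = n≤1+n _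

        -- The path of zˢ ends at the sets, which start at L and lead on to the hub at 2 L. The
        -- other twin can stay at 2 L because it is entered only from the hub or from elements,
        -- which are at 2 L themselves.
        ψ-potential : Potential ψ
        ψ-potential 0F k l _ = m≤n⇒m≤1+n (ψ≤ (spoke k))
        ψ-potential 1F k l _ = ψ-along (chainOf k) l
        ψ-potential 2F k l _ rewrite Fin.toℕ-fromℕ L = n≤1+n _
        ψ-potential 3F k l _ with does (l Fin.≟ s)
        ... | true rewrite Fin.toℕ-fromℕ L = ≤-trans (≤-reflexive (+-identityʳ L)) (n≤1+n L)
        ... | false = m≤n⇒m≤1+n (ψ≤ (chain (A k) 0F))
        ψ-potential 4F k l _ = m≤n⇒m≤1+n (ψ≤ (chain (z 0F) 0F))
        ψ-potential 5F k l _ = m≤n⇒m≤1+n ≤-refl′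
          where
          ≤-refl′ : L + L ≤ L + L
          ≤-refl′ = ≤-refl
        ψ-potential 6F k l _ = m≤n⇒m≤1+n (ψ≤ (chain (A k) 0F))

        ψ-base : ψ (chain (z s) 0F) ≡ 0
        ψ-base with s Fin.≟ s
        ... | yes _ = refl
        ... | no ¬p = contradiction refl ¬p

        far-from-z : ∀ v → ψ v ≡ L + L → [ L + L ] ≤∞ dist (chain (z s) 0F) v
        far-from-z v p = far ψ ψ-potential {chain (z s) 0F} {v}
          (≤-reflexive (trans (cong (_+ (L + L)) ψ-base) (sym p)))

      -- The hub has distance at most 1 to everything, so each vertex is refuted by another one that
      -- cannot reach it quickly. The twin `z 1F` is there for the vertices on the path of `z 0F`.
      maxRadius-no : ¬ Hitting → [ L + L ] ≤∞ MaxRadius graph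
      maxRadius-no ¬h = Radius.≤-radius Max∞._⊔_ maxPresentation λ u → witness u (unreached u)
        where
        Unreached : Vertex → Set
        Unreached u = ∃[ v ] [ L + L ] ≤∞ dist v u
        unreached : ∀ u → Unreached u
        unreached hub              = chain (z 0F) 0F , far-from-z 0F hub refl
        unreached (elt e)          = chain (z 0F) 0F , far-from-z 0F (elt e) refl
        unreached (chain (z 0F) i) = chain (z 1F) 0F , far-from-z 1F (chain (z 0F) i) refl
        unreached (chain (z 1F) i) = chain (z 0F) 0F , far-from-z 0F (chain (z 1F) i) refl
        unreached (chain (A k) i)  =
          chain (B (proj₁ (missed ¬h k))) 0F , far-from-b (proj₁ (missed ¬h k)) i
              (proj₂ (missed ¬h k))
        unreached (chain (B j) i)  = chain (z 0F) 0F , far-from-z 0F (chain (B j) i) refl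
        witness : ∀ u → Unreached u →
          ∃[ v ] [ L + L ] ≤∞ dist u v Max∞.⊔ dist v u
        witness u (v , p) = v , ≤∞-trans p (Max∞.x≤y⊔x (dist u v) (dist v u))

  -- The graph for the roundtrip radius

  shr-halve : ∀ x e → ⟦ shr ⟧ (x / 2) e ≡ ⟦ shr ⟧ x (suc e)
  shr-halve x zero    = refl
  shr-halve x (suc e) = cong (_/ 2) (shr-halve x e)

  halve-< : ∀ {x e} → x < 2 ^ suc e → x / 2 < 2 ^ e
  halve-< {x} {e} p = m<n*o⇒m/o<n (subst (x <_) (*-comm 2 (2 ^ e)) p)

  shr-vanishes : ∀ {x} e → x < 2 ^ e → ⟦ shr ⟧ x e ≡ 0
  shr-vanishes     zero    p = n<1⇒n≡0 p
  shr-vanishes {x} (suc e) p =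
    trans (sym (shr-halve x e)) (shr-vanishes e (halve-< {x} {e} p))

  bits-determine : ∀ {x y} e → x < 2 ^ e → y < 2 ^ e →
    (∀ {i} → i < e → ⟦ shr ⟧ x i % 2 ≡ ⟦ shr ⟧ y i % 2) → x ≡ y
  bits-determine {x} {y} zero    p q eq = trans (n<1⇒n≡0 p) (sym (n<1⇒n≡0 q))
  bits-determine {x} {y} (suc e) p q eq = begin
    x                   ≡⟨ m≡m%n+[m/n]*n x 2 ⟩
    x % 2 + x / 2 * 2   ≡⟨ cong₂ (λ r s → r + s * 2) (eq z<s) halves ⟩
    y % 2 + y / 2 * 2   ≡⟨ m≡m%n+[m/n]*n y 2 ⟨
    y                   ∎
    where
    open ≡-Reasoning
    halves : x / 2 ≡ y / 2
    halves = bits-determine e (halve-< {x} {e} p) (halve-< {y} {e} q) λ {i} i<e →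
      trans (cong (_% 2) (shr-halve x i)) (trans (eq (s≤s i<e))
          (cong (_% 2) (sym (shr-halve y i))))

  neg : Fin 2 → Fin 2
  neg 0F = 1F
  neg 1F = 0F

  neg-neg : ∀ c → neg (neg c) ≡ c
  neg-neg 0F = refl
  neg-neg 1F = refl

  neg-≢ : ∀ c → neg c ≢ c
  neg-≢ 0F ()
  neg-≢ 1F ()

  ≢⇒neg : ∀ {c c′} → c ≢ c′ → c ≡ neg c′
  ≢⇒neg {0F} {0F} p = contradiction refl p
  ≢⇒neg {0F} {1F} p = refl
  ≢⇒neg {1F} {0F} p = refl
  ≢⇒neg {1F} {1F} p = contradiction refl p

  toℕ-neg : ∀ c → 1 ∸ toℕ c ≡ toℕ (neg c)
  toℕ-neg 0F = refl
  toℕ-neg 1F = refl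

  bitᶠ : Bool → Fin 2
  bitᶠ b = if b then 1F else 0F

  toℕ-bitᶠ : ∀ b → toℕ (bitᶠ b) ≡ bit b
  toℕ-bitᶠ true  = refl
  toℕ-bitᶠ false = refl

  lastDigit : ℕ → Fin 2
  lastDigit x = fromℕ< (m%n<n x 2)

  module RoundtripGraph (L : ℕ) where

    K : ℕ
    K = suc L

    at′ : Exp → Exp → Exp
    at′ c i = #n ⊞ #n ⊞ (lit K ⊠ c ⊞ i)

    -- In the rules for sets, the inner index is 2 e + s for position e and copy s, so halving it
    -- yields the position. Digits come after the 2 U slots of the elements, hence the offset in
    -- `idSlot`.
    coords setBit idBit bBit idSlot : Exp
    coords = #U ⊞ (lit 1 ⊞ #U)
    setBit = ld (lit 2 ⊞ (#i ⊠ #U ⊞ #j ⊘ lit 2))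
    idBit  = #i ≫ (#j ⊘ lit 2) ⊛ lit 2
    bBit   = ld (lit 2 ⊞ (#n ⊠ #U ⊞ (#i ⊠ #U ⊞ #j ⊘ lit 2)))
    idSlot = lit 2 ⊠ #U ⊞ #j

    -- First come the sets aₖ and bₖ, then K vertices for each chain; the chain of
    -- value c in copy s of coordinate e has index 4 e + 2 s + c.  rtEnds shows the edges.
    rtRules : Fin 8 → Rule
    rtRules 0F = record
      { count₁ = coords ⊠ lit 2 ⊠ lit 2 ; count₂ = lit L ; cond = lit 1
      ; src = at′ #i #j ; dst = at′ #i (lit 1 ⊞ #j) }
    rtRules 1F = record
      { count₁ = coords ⊠ lit 2 ; count₂ = lit 2 ; cond = lit 1
      ; src = at′ (lit 2 ⊠ #i ⊞ #j) (lit L) ; dst = at′ (lit 2 ⊠ #i ⊞ (lit 1 ⊟ #j)) (lit 0) }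
    rtRules 2F = record
      { count₁ = #n ; count₂ = #U ⊠ lit 2 ; cond = lit 1
      ; src = #i ; dst = at′ (lit 2 ⊠ #j ⊞ setBit) (lit 0) }
    rtRules 3F = record
      { count₁ = #n ; count₂ = #U ⊠ lit 2 ; cond = lit 1
      ; src = at′ (lit 2 ⊠ #j ⊞ (lit 1 ⊟ setBit)) (lit L) ; dst = #i }
    rtRules 4F = record
      { count₁ = #n ; count₂ = (lit 1 ⊞ #U) ⊠ lit 2 ; cond = lit 1
      ; src = #i ; dst = at′ (lit 2 ⊠ idSlot ⊞ idBit) (lit 0) }
    rtRules 5F = record
      { count₁ = #n ; count₂ = (lit 1 ⊞ #U) ⊠ lit 2 ; cond = lit 1
      ; src = at′ (lit 2 ⊠ idSlot ⊞ (lit 1 ⊟ idBit)) (lit L) ; dst = #i }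
    rtRules 6F = record
      { count₁ = #n ; count₂ = #U ⊠ lit 2 ; cond = bBit
      ; src = at′ (lit 2 ⊠ #j ⊞ lit 1) (lit L) ; dst = #n ⊞ #i }
    rtRules 7F = record
      { count₁ = #n ; count₂ = #U ⊠ lit 2 ; cond = bBit
      ; src = #n ⊞ #i ; dst = at′ (lit 2 ⊠ #j ⊞ lit 0) (lit 0) }

    rtOrder : Exp
    rtOrder = #n ⊞ #n ⊞ coords ⊠ lit 2 ⊠ lit 2 ⊠ lit K

    module _ (F : Families) where

      open Families F

      -- Coordinates: the elements of the universe, then the binary digits of
      -- the index of a set, which separate equal sets.
      Coord : Set
      Coord = Fin U ⊎ Fin (suc U)

      data Vertex : Set where
        A B : Fin n → Vertex
        ch  : Coord → (s c : Fin 2) → Fin K → Vertex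

      val : Fin n → Coord → Fin 2
      val k (inj₁ e) = bitᶠ (a k e)
      val k (inj₂ e) = lastDigit (⟦ shr ⟧ (toℕ k) (toℕ e))

      D C : ℕ
      D = U + suc U
      C = D * 2 * 2

      index : Coord → Fin 2 → Fin 2 → Fin C
      index q s c = Fin.combine (Fin.combine (Fin.join U (suc U) q) s) c

      toVert : Vertex → Fin (n + n + C * K)
      toVert (A k)        = (k Fin.↑ˡ n) Fin.↑ˡ (C * K)
      toVert (B k)        = (n Fin.↑ʳ k) Fin.↑ˡ (C * K)
      toVert (ch q s c i) = (n + n) Fin.↑ʳ Fin.combine (index q s c) i

      set : Fin (n + n) → Vertex
      set x = [ A , B ]′ (Fin.splitAt n x)

      chains₁ : Fin D → Fin 2 → Fin 2 → Fin K → Vertex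
      chains₁ q = ch (Fin.splitAt U q)

      chains₂ : Fin (D * 2) → Fin 2 → Fin K → Vertex
      chains₂ x = uncurry chains₁ (Fin.remQuot {D} 2 x)

      chains₃ : Fin C → Fin K → Vertex
      chains₃ x = uncurry chains₂ (Fin.remQuot {D * 2} 2 x)

      link : Fin (C * K) → Vertex
      link x = uncurry chains₃ (Fin.remQuot {C} K x)

      fromVert : Fin (n + n + C * K) → Vertex
      fromVert x = [ set , link ]′ (Fin.splitAt (n + n) x)

      chains₃-index : ∀ q s c i → chains₃ (index q s c) i ≡ ch q s c i
      chains₃-index q s c i = trans
        (cong (λ x → uncurry chains₂ x i) (Fin.remQuot-combine
            (Fin.combine (Fin.join U (suc U) q) s) c))
        (trans (cong (λ x → uncurry chains₁ x c i) (Fin.remQuot-combine (Fin.join U (suc U) q) s))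
               (cong (λ x → ch x s c i) (Fin.splitAt-join U (suc U) q)))

      from-to : ∀ u → fromVert (toVert u) ≡ u
      from-to (A k) = trans (cong [ set , link ]′ (Fin.splitAt-↑ˡ (n + n) (k Fin.↑ˡ n) (C * K)))
                            (cong [ A , B ]′ (Fin.splitAt-↑ˡ n k n))
      from-to (B k) = trans (cong [ set , link ]′ (Fin.splitAt-↑ˡ (n + n) (n Fin.↑ʳ k) (C * K)))
                            (cong [ A , B ]′ (Fin.splitAt-↑ʳ n n k))
      from-to (ch q s c i) = trans
        (cong [ set , link ]′ (Fin.splitAt-↑ʳ (n + n) (C * K) (Fin.combine (index q s c) i)))
        (trans (cong (uncurry chains₃) (Fin.remQuot-combine (index q s c) i))
            (chains₃-index q s c i))

      chains₂-slot : ∀ (x : Fin (D * 2)) c i →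
        toVert (chains₂ x c i) ≡ (n + n) Fin.↑ʳ Fin.combine (Fin.combine x c) i
      chains₂-slot x c i = cong (λ y → (n + n) Fin.↑ʳ Fin.combine (Fin.combine y c) i)
        (trans (cong (λ q → Fin.combine q (proj₂ (Fin.remQuot {D} 2 x)))
                     (Fin.join-splitAt U (suc U) (proj₁ (Fin.remQuot {D} 2 x))))
               (Fin.combine-remQuot {D} 2 x))

      chains₃-slot : ∀ (x : Fin C) i → toVert (chains₃ x i) ≡ (n + n) Fin.↑ʳ Fin.combine x i
      chains₃-slot x i = trans (chains₂-slot (proj₁ (Fin.remQuot {D * 2} 2 x))
          (proj₂ (Fin.remQuot {D * 2} 2 x)) i)
        (cong (λ y → (n + n) Fin.↑ʳ Fin.combine y i) (Fin.combine-remQuot {D * 2} 2 x))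

      link-slot : ∀ x → toVert (link x) ≡ (n + n) Fin.↑ʳ x
      link-slot x = trans (chains₃-slot (proj₁ (Fin.remQuot {C} K x))
          (proj₂ (Fin.remQuot {C} K x)))
        (cong ((n + n) Fin.↑ʳ_) (Fin.combine-remQuot {C} K x))

      to-set : ∀ y → toVert (set y) ≡ y Fin.↑ˡ (C * K)
      to-set y with Fin.splitAt n y in eq
      ... | inj₁ k = cong (Fin._↑ˡ (C * K)) (Fin.splitAt⁻¹-↑ˡ eq)
      ... | inj₂ k = cong (Fin._↑ˡ (C * K)) (Fin.splitAt⁻¹-↑ʳ eq)

      to-from : ∀ x → toVert (fromVert x) ≡ x
      to-from x with Fin.splitAt (n + n) x in eq
      ... | inj₁ y = trans (to-set y) (Fin.splitAt⁻¹-↑ˡ eq)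
      ... | inj₂ y = trans (link-slot y) (Fin.splitAt⁻¹-↑ʳ eq)

      tip : Fin K
      tip = Fin.fromℕ L

      elem : Fin (U * 2) → Fin U × Fin 2
      elem = Fin.remQuot {U} 2

      digit : Fin (suc U * 2) → Fin (suc U) × Fin 2
      digit = Fin.remQuot {suc U} 2

      enter leave : Fin n → Coord → Fin 2 → Vertex × Vertex
      enter k q s = A k , ch q s (val k q) 0F
      leave k q s = ch q s (neg (val k q)) tip , A k

      rtEnds : ∀ p (k : Fin (C₁ E (rtRules p))) → Fin (C₂ E (rtRules p) (toℕ k)) → Vertex × Vertex
      rtEnds 0F k l = chains₃ k (Fin.inject₁ l) , chains₃ k (Fin.suc l)
      rtEnds 1F k l = chains₂ k l tip , chains₂ k (neg l) 0F
      rtEnds 2F k l = enter k (inj₁ (proj₁ (elem l))) (proj₂ (elem l))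
      rtEnds 3F k l = leave k (inj₁ (proj₁ (elem l))) (proj₂ (elem l))
      rtEnds 4F k l = enter k (inj₂ (proj₁ (digit l))) (proj₂ (digit l))
      rtEnds 5F k l = leave k (inj₂ (proj₁ (digit l))) (proj₂ (digit l))
      rtEnds 6F k l = ch (inj₁ (proj₁ (elem l))) (proj₂ (elem l)) 1F tip , B k
      rtEnds 7F k l = B k , ch (inj₁ (proj₁ (elem l))) (proj₂ (elem l)) 0F 0F

      private
        toℕ-remQuot : ∀ m (x : Fin (m * 2)) →
          2 * toℕ (proj₁ (Fin.remQuot {m} 2 x)) + toℕ (proj₂ (Fin.remQuot {m} 2 x)) ≡ toℕ x
        toℕ-remQuot m x = trans (sym (Fin.toℕ-combine (proj₁ (Fin.remQuot {m} 2 x))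
            (proj₂ (Fin.remQuot {m} 2 x))))
          (cong toℕ (Fin.combine-remQuot {m} 2 x))

        half : ∀ m (x : Fin (m * 2)) → toℕ x / 2 ≡ toℕ (proj₁ (Fin.remQuot {m} 2 x))
        half m x = begin
          toℕ x / 2                 ≡⟨ cong (_/ 2) (toℕ-remQuot m x) ⟨
          (2 * toℕ q + toℕ r) / 2   ≡⟨ +-distrib-/-∣ˡ (toℕ r) (m∣m*n (toℕ q)) ⟩
          2 * toℕ q / 2 + toℕ r / 2 ≡⟨ cong₂ _+_
              (trans (cong (_/ 2) (*-comm 2 (toℕ q))) (m*n/n≡m (toℕ q) 2))
                                                 (m<n⇒m/n≡0 (Fin.toℕ<n r)) ⟩
          toℕ q + 0                 ≡⟨ +-identityʳ (toℕ q) ⟩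
          toℕ q                     ∎
          where
          open ≡-Reasoning
          q = proj₁ (Fin.remQuot {m} 2 x)
          r = proj₂ (Fin.remQuot {m} 2 x)

        code : ∀ (x : Fin C) (i : Fin K) {y j} → y ≡ toℕ x → j ≡ toℕ i →
               n + n + (K * y + j) ≡ toℕ ((n + n) Fin.↑ʳ Fin.combine x i)
        code x i p q = trans (cong (n + n +_) (trans (cong₂ (λ y j → K * y + j) p q)
          (sym (Fin.toℕ-combine x i)))) (sym (Fin.toℕ-↑ʳ (n + n) (Fin.combine x i)))

        code₂ : ∀ (x : Fin (D * 2)) (c : Fin 2) {y z} → y ≡ toℕ x → z ≡ toℕ c →
            2 * y + z ≡ toℕ (Fin.combine x c)
        code₂ x c refl refl = sym (Fin.toℕ-combine x c)

        code-elem : ∀ l → toℕ l ≡ toℕ (Fin.combine (Fin.join U (suc U) (inj₁ (proj₁ (elem l))))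
            (proj₂ (elem l)))
        code-elem l = trans (sym (toℕ-remQuot U l)) (trans
          (cong (λ x → 2 * x + toℕ (proj₂ (elem l))) (sym (Fin.toℕ-↑ˡ (proj₁ (elem l)) (suc U))))
          (sym (Fin.toℕ-combine (proj₁ (elem l) Fin.↑ˡ suc U) (proj₂ (elem l)))))

        code-digit : ∀ l → 2 * U + toℕ l ≡
          toℕ (Fin.combine (Fin.join U (suc U) (inj₂ (proj₁ (digit l)))) (proj₂ (digit l)))
        code-digit l = begin
          2 * U + toℕ l                       ≡⟨ cong (2 * U +_) (toℕ-remQuot (suc U) l) ⟨
          2 * U + (2 * toℕ e + toℕ s)         ≡⟨ +-assoc (2 * U) _ _ ⟨
          2 * U + 2 * toℕ e + toℕ s           ≡⟨ cong (_+ toℕ s) (*-distribˡ-+ 2 U (toℕ e)) ⟨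
          2 * (U + toℕ e) + toℕ s             ≡⟨ cong (λ x → 2 * x + toℕ s) (Fin.toℕ-↑ʳ U e) ⟨
          2 * toℕ (U Fin.↑ʳ e) + toℕ s        ≡⟨ Fin.toℕ-combine (U Fin.↑ʳ e) s ⟨
          toℕ (Fin.combine (U Fin.↑ʳ e) s)    ∎
          where
          open ≡-Reasoning
          e = proj₁ (digit l)
          s = proj₂ (digit l)

        code-A : ∀ k → toℕ k ≡ toℕ (toVert (A k))
        code-A k = sym (trans (Fin.toℕ-↑ˡ (k Fin.↑ˡ n) (C * K)) (Fin.toℕ-↑ˡ k n))

        code-B : ∀ k → n + toℕ k ≡ toℕ (toVert (B k))
        code-B k = sym (trans (Fin.toℕ-↑ˡ (n Fin.↑ʳ k) (C * K)) (Fin.toℕ-↑ʳ n k))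

        code-tip : L ≡ toℕ tip
        code-tip = sym (Fin.toℕ-fromℕ L)

        set-bit : ∀ k l → inp (2 + (toℕ k * U + toℕ l / 2)) ≡ toℕ (val k (inj₁ (proj₁ (elem l))))
        set-bit k l = trans (cong (λ x → inp (2 + (toℕ k * U + x))) (half U l))
          (trans (inp-a k (proj₁ (elem l))) (sym (toℕ-bitᶠ (a k (proj₁ (elem l))))))

        id-bit : ∀ (k : Fin n) l → ⟦ shr ⟧ (toℕ k) (toℕ l / 2) % 2 ≡ toℕ
            (val k (inj₂ (proj₁ (digit l))))
        id-bit k l = trans (cong (λ x → ⟦ shr ⟧ (toℕ k) x % 2) (half (suc U) l))
          (sym (Fin.toℕ-fromℕ< (m%n<n (⟦ shr ⟧ (toℕ k) (toℕ (proj₁ (digit l)))) 2)))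

        b-bit : ∀ k l → inp (2 + (n * U + (toℕ k * U + toℕ l / 2))) ≡ bit (b k (proj₁ (elem l)))
        b-bit k l = trans (cong (λ x → inp (2 + (n * U + (toℕ k * U + x)))) (half U l))
          (inp-b k (proj₁ (elem l)))

        negated : ∀ {x} c → x ≡ toℕ c → 1 ∸ x ≡ toℕ (neg c)
        negated c refl = toℕ-neg c

        src-ok : ∀ p k l → eval (Rule.src (rtRules p)) (E & (toℕ k , toℕ l)) ≡
                           toℕ (toVert (proj₁ (rtEnds p k l)))
        src-ok 0F k l = trans (code k (Fin.inject₁ l) refl (sym (Fin.toℕ-inject₁ l)))
          (cong toℕ (sym (chains₃-slot k (Fin.inject₁ l))))
        src-ok 1F k l = trans (code (Fin.combine k l) tip (code₂ k l refl refl) code-tip)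
          (cong toℕ (sym (chains₂-slot k l tip)))
        src-ok 2F k l = code-A k
        src-ok 3F k l = code _ tip (code₂ _ _ (code-elem l) (negated _ (set-bit k l))) code-tip
        src-ok 4F k l = code-A k
        src-ok 5F k l = code _ tip (code₂ _ _ (code-digit l) (negated _ (id-bit k l))) code-tip
        src-ok 6F k l = code _ tip (code₂ _ 1F (code-elem l) refl) code-tip
        src-ok 7F k l = code-B k

        dst-ok : ∀ p k l → eval (Rule.dst (rtRules p)) (E & (toℕ k , toℕ l)) ≡
                           toℕ (toVert (proj₂ (rtEnds p k l)))
        dst-ok 0F k l = trans (code k (Fin.suc l) refl refl)
          (cong toℕ (sym (chains₃-slot k (Fin.suc l))))
        dst-ok 1F k l = trans (code (Fin.combine k (neg l)) 0F
            (code₂ k (neg l) refl (toℕ-neg l)) refl)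
          (cong toℕ (sym (chains₂-slot k (neg l) 0F)))
        dst-ok 2F k l = code _ 0F (code₂ _ _ (code-elem l) (set-bit k l)) refl
        dst-ok 3F k l = code-A k
        dst-ok 4F k l = code _ 0F (code₂ _ _ (code-digit l) (id-bit k l)) refl
        dst-ok 5F k l = code-A k
        dst-ok 6F k l = code-B k
        dst-ok 7F k l = code _ 0F (code₂ _ 0F (code-elem l) refl) refl

      -- Between chains, a step within a chain keeps the value and the edge that closes a cycle
      -- negates it; comparing the values tells the two rules apart.
      rtKey : Vertex → Vertex → Fin 8 × ℕ × ℕ
      rtKey (ch q s c i) (ch q′ s′ c′ i′) =
        if does (c Fin.≟ c′) then (0F , toℕ (index q s c) , toℕ i)
        else (1F , toℕ (Fin.combine (Fin.join U (suc U) q) s) , toℕ c)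
      rtKey (A k)               (ch (inj₁ e) s c i) = 2F , toℕ k , toℕ (Fin.combine e s)
      rtKey (ch (inj₁ e) s c i) (A k)               = 3F , toℕ k , toℕ (Fin.combine e s)
      rtKey (A k)               (ch (inj₂ e) s c i) = 4F , toℕ k , toℕ (Fin.combine e s)
      rtKey (ch (inj₂ e) s c i) (A k)               = 5F , toℕ k , toℕ (Fin.combine e s)
      rtKey (ch (inj₁ e) s c i) (B k)               = 6F , toℕ k , toℕ (Fin.combine e s)
      rtKey (B k)               (ch (inj₁ e) s c i) = 7F , toℕ k , toℕ (Fin.combine e s)
      rtKey _                   _                   = 0F , 0 , 0

      private
        key-chain : ∀ q s c i i′ → rtKey (ch q s c i) (ch q s c i′)
            ≡ (0F , toℕ (index q s c) , toℕ i)
        key-chain q s c i i′ with c Fin.≟ c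
        ... | yes _ = refl
        ... | no ¬p = contradiction refl ¬p

        key-cycle : ∀ q s c i i′ → rtKey (ch q s c i) (ch q s (neg c) i′) ≡
                    (1F , toℕ (Fin.combine (Fin.join U (suc U) q) s) , toℕ c)
        key-cycle q s 0F i i′ = refl
        key-cycle q s 1F i i′ = refl

        unindex : ∀ m (x : Fin (m * 2)) →
          toℕ (Fin.combine (proj₁ (Fin.remQuot {m} 2 x)) (proj₂ (Fin.remQuot {m} 2 x))) ≡ toℕ x
        unindex m x = cong toℕ (Fin.combine-remQuot {m} 2 x)

        slot₂ : ∀ (x : Fin (D * 2)) → toℕ (Fin.combine (Fin.join U (suc U)
          (Fin.splitAt U (proj₁ (Fin.remQuot {D} 2 x)))) (proj₂ (Fin.remQuot {D} 2 x))) ≡ toℕ x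
        slot₂ x = trans (cong (λ q → toℕ (Fin.combine q (proj₂ (Fin.remQuot {D} 2 x))))
          (Fin.join-splitAt U (suc U) (proj₁ (Fin.remQuot {D} 2 x)))) (unindex D x)

        slot₃ : ∀ (x : Fin C) → toℕ (Fin.combine (Fin.combine (Fin.join U (suc U)
          (Fin.splitAt U (proj₁ (Fin.remQuot {D} 2 (proj₁ (Fin.remQuot {D * 2} 2 x))))))
          (proj₂ (Fin.remQuot {D} 2 (proj₁ (Fin.remQuot {D * 2} 2 x)))))
          (proj₂ (Fin.remQuot {D * 2} 2 x))) ≡ toℕ x
        slot₃ x = trans (cong (λ y → toℕ (Fin.combine y (proj₂ (Fin.remQuot {D * 2} 2 x))))
          (Fin.toℕ-injective (slot₂ (proj₁ (Fin.remQuot {D * 2} 2 x))))) (unindex (D * 2) x)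

        key-ends : ∀ p k l → uncurry rtKey (rtEnds p k l) ≡ (p , toℕ k , toℕ l)
        key-ends 0F k l = trans (key-chain
            (Fin.splitAt U (proj₁ (Fin.remQuot {D} 2 (proj₁ (Fin.remQuot {D * 2} 2 k))))) _ _
            (Fin.inject₁ l) (Fin.suc l))
          (cong₂ (λ x y → 0F , x , y) (slot₃ k) (Fin.toℕ-inject₁ l))
        key-ends 1F k l = trans (key-cycle (Fin.splitAt U (proj₁ (Fin.remQuot {D} 2 k))) _ l tip
            0F) (cong (λ x → 1F , x , toℕ l) (slot₂ k))
        key-ends 2F k l = cong (λ x → 2F , toℕ k , x) (unindex U l)
        key-ends 3F k l = cong (λ x → 3F , toℕ k , x) (unindex U l)
        key-ends 4F k l = cong (λ x → 4F , toℕ k , x) (unindex (suc U) l)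
        key-ends 5F k l = cong (λ x → 5F , toℕ k , x) (unindex (suc U) l)
        key-ends 6F k l = cong (λ x → 6F , toℕ k , x) (unindex U l)
        key-ends 7F k l = cong (λ x → 7F , toℕ k , x) (unindex U l)

        -- Even without sets and elements there remains one digit, whose cycles provide vertices.
        nonempty : n + n + C * K ≢ 0
        nonempty p = 0≢1+n (trans (sym (m+n≡0⇒n≡0 (n + n) p))
            (cong (λ x → x * 2 * 2 * K) (+-suc U U)))

      rtPresentation : Presentation rtRules rtOrder E
      rtPresentation = record
        { Node = Vertex ; vert = toVert ; node = fromVert ; node-vert = from-to ; vert-node =
            to-from
        ; ends = rtEnds ; src-ok = src-ok ; dst-ok = dst-ok ; key = rtKey ; key-ends = key-ends
        ; N≢0 = nonempty }

      open Presentation rtPresentation hiding (src-ok; dst-ok; key-ends; key)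

      module _ (off : Coord → Fin 2 → Fin 2 → ℕ) (α β : Fin n → ℕ) where

        -- All potentials on this graph rise with slope 1 along every chain, so that only the edges
        -- at the ends of chains have to be checked.
        level : Vertex → ℕ
        level (A k)        = α k
        level (B j)        = β j
        level (ch q s c i) = off q s c + toℕ i

        level-potential :
          (∀ q s c → off q s (neg c) ≤ suc (off q s c + L)) →
          (∀ k q s → off q s (val k q) ≤ suc (α k)) →
          (∀ k q s → α k ≤ suc (off q s (neg (val k q)) + L)) →
          (∀ j e s → b j e ≡ true → β j ≤ suc (off (inj₁ e) s 1F + L)) →
          (∀ j e s → b j e ≡ true → off (inj₁ e) s 0F ≤ suc (β j)) →
          Potential level
        level-potential cyc ent lea b-in b-out = λ where
            0F k l _ → chain≤ _ _ _ l
            1F k l _ → start≤ (tip≤ (cyc _ _ l))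
            2F k l _ → start≤ (ent k _ _)
            3F k l _ → tip≤ (lea k _ _)
            4F k l _ → start≤ (ent k _ _)
            5F k l _ → tip≤ (lea k _ _)
            6F k l active → tip≤ (b-in k _ _ (bit≢0⇒true λ p → active (trans (b-bit k l) p)))
            7F k l active → start≤ (b-out k _ _ (bit≢0⇒true λ p → active (trans (b-bit k l) p)))
          where
          chain≤ : ∀ q s c i → off q s c + toℕ (Fin.suc i) ≤ suc (off q s c + toℕ (Fin.inject₁ i))
          chain≤ q s c i rewrite Fin.toℕ-inject₁ i = ≤-reflexive (+-suc (off q s c) (toℕ i))
          start≤ : ∀ {x y} → x ≤ y → x + 0 ≤ y
          start≤ {x} p = ≤-trans (≤-reflexive (+-identityʳ x)) p
          tip≤ : ∀ {x y} → x ≤ suc (y + L) → x ≤ suc (y + toℕ tip)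
          tip≤ {x} {y} = subst (λ t → x ≤ suc (y + t)) code-tip

      -- Distances from aₖ, truncated at 2 L.
      module _ (k : Fin n) where

        off-a : Coord → Fin 2 → Fin 2 → ℕ
        off-a q s c = if does (c Fin.≟ val k q) then 0 else L

        α-a β-a : Fin n → ℕ
        α-a k′ = if does (k′ Fin.≟ k) then 0 else L
        β-a j  = if does (Hit? k j) then L else L + L

        off-a≤ : ∀ q s c → off-a q s c ≤ L
        off-a≤ q s c with does (c Fin.≟ val k q)
        ... | true  = z≤n
        ... | false = ≤-refl

        a-potential : Potential (level off-a α-a β-a)
        a-potential = level-potential off-a α-a β-a
          (λ q s c → m≤n⇒m≤1+n (≤-trans (off-a≤ q s (neg c)) (m≤n+m L _)))
          ent
          (λ k′ q s → m≤n⇒m≤1+n (≤-trans (α-a≤ k′) (m≤n+m L _)))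
          b-in
          (λ j e s _ → m≤n⇒m≤1+n (≤-trans (off-a≤ (inj₁ e) s 0F) (L≤β j)))
          where
          α-a≤ : ∀ k′ → α-a k′ ≤ L
          α-a≤ k′ with does (k′ Fin.≟ k)
          ... | true  = z≤n
          ... | false = ≤-refl
          L≤β : ∀ j → L ≤ β-a j
          L≤β j with does (Hit? k j)
          ... | true  = ≤-refl
          ... | false = m≤m+n L L
          ent : ∀ k′ q s → off-a q s (val k′ q) ≤ suc (α-a k′)
          ent k′ q s with k′ Fin.≟ k
          ... | no _ = m≤n⇒m≤1+n (off-a≤ q s (val k′ q))
          ... | yes refl with val k q Fin.≟ val k q
          ...   | yes _ = z≤n
          ...   | no ¬p = contradiction refl ¬p
          b-in : ∀ j e s → b j e ≡ true → β-a j ≤ suc (off-a (inj₁ e) s 1F + L)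
          b-in j e s b≡ with Hit? k j
          ... | yes _ = m≤n⇒m≤1+n (m≤n+m L _)
          -- Since e belongs to bⱼ, a miss means that it is not in aₖ. Then the chain of value 1 is
          -- not the one that `A k` enters, and it starts at L.
          ... | no ¬h with a k e in a≡
          ...   | true  = contradiction (e , a≡ , b≡) ¬h
          ...   | false = n≤1+n (L + L)

        far-a-b : ∀ j → ¬ Hit k j → [ L + L ] ≤∞ dist (A k) (B j)
        far-a-b j ¬h = far (level off-a α-a β-a) a-potential {A k} {B j} bound
          where
          bound : α-a k + (L + L) ≤ β-a j
          bound with k Fin.≟ k | Hit? k j
          ... | no ¬p | _     = contradiction refl ¬p
          ... | yes _ | yes h = contradiction h ¬h
          ... | yes _ | no _  = ≤-refl

      -- Distances from bⱼ, truncated at 2 L.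
      module _ (j : Fin n) where

        off-b : Coord → Fin 2 → Fin 2 → ℕ
        off-b (inj₁ e) s 0F = if b j e then 0 else L
        off-b _        s _  = L

        α-b β-b : Fin n → ℕ
        α-b k  = if does (Hit? k j) then L else L + L
        β-b j′ = if does (j′ Fin.≟ j) then 0 else L + L

        off-b≤ : ∀ q s c → off-b q s c ≤ L
        off-b≤ (inj₁ e) s 0F with b j e
        ... | true  = z≤n
        ... | false = ≤-refl
        off-b≤ (inj₁ e) s 1F = ≤-refl
        off-b≤ (inj₂ e) s c = ≤-refl

        b-potential : Potential (level off-b α-b β-b)
        b-potential = level-potential off-b α-b β-b
          (λ q s c → m≤n⇒m≤1+n (≤-trans (off-b≤ q s (neg c)) (m≤n+m L _)))
          (λ k q s → m≤n⇒m≤1+n (≤-trans (off-b≤ q s (val k q)) (L≤α k)))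
          lea
          (λ j′ e s _ → m≤n⇒m≤1+n (β-b≤ j′))
          b-out
          where
          L≤α : ∀ k → L ≤ α-b k
          L≤α k with does (Hit? k j)
          ... | true  = ≤-refl
          ... | false = m≤m+n L L
          β-b≤ : ∀ j′ → β-b j′ ≤ L + L
          β-b≤ j′ with does (j′ Fin.≟ j)
          ... | true  = z≤n
          ... | false = ≤-refl
          lea : ∀ k q s → α-b k ≤ suc (off-b q s (neg (val k q)) + L)
          lea k q s with Hit? k j
          ... | yes _ = m≤n⇒m≤1+n (m≤n+m L _)
          lea k (inj₂ e) s | no ¬h = n≤1+n (L + L)
          -- If e belongs to aₖ, then `A k` is reached from the chain of value 0. A miss means that
          -- bⱼ lacks e and does not enter that chain, which therefore starts at L.
          lea k (inj₁ e) s | no ¬h with a k e in a≡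
          ... | false = n≤1+n (L + L)
          ... | true with b j e in b≡
          ...   | true  = contradiction (e , a≡ , b≡) ¬h
          ...   | false = n≤1+n (L + L)
          b-out : ∀ j′ e s → b j′ e ≡ true → off-b (inj₁ e) s 0F ≤ suc (β-b j′)
          b-out j′ e s b≡ with j′ Fin.≟ j
          ... | no _ = m≤n⇒m≤1+n (≤-trans (off-b≤ (inj₁ e) s 0F) (m≤m+n L L))
          ... | yes refl rewrite b≡ = z≤n

        far-b-a : ∀ k → ¬ Hit k j → [ L + L ] ≤∞ dist (B j) (A k)
        far-b-a k ¬h = far (level off-b α-b β-b) b-potential {B j} {A k} bound
          where
          bound : β-b j + (L + L) ≤ α-b k
          bound with j Fin.≟ j | Hit? k j
          ... | no ¬p | _     = contradiction refl ¬p
          ... | yes _ | yes h = contradiction h ¬h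
          ... | yes _ | no _  = ≤-refl

      _≟ᶜ_ : (q r : Coord) → Dec (q ≡ r)
      _≟ᶜ_ = Sum.≡-dec Fin._≟_ Fin._≟_

      -- From a coordinate vertex to its twin: no set can tell the two apart.
      module _ (q : Coord) (s c : Fin 2) where

        off-t : Coord → Fin 2 → Fin 2 → ℕ
        off-t r t c′ =
          if does (r ≟ᶜ q) ∧ does (c′ Fin.≟ c) then (if does (t Fin.≟ s) then 0 else L + L) else L

        -- From the chain of value `c` one gets at most to the opposite chain, to sets whose value
        -- at `q` is opposite and, if `c` is 1F, to a `B`. None of these enters value `c` at `q`, so
        -- they may stay at L. Whatever can enter both copies is put at 2 L; a `B` enters chains of
        -- value 0.
        α-t : Fin n → ℕ
        α-t k = if does (val k q Fin.≟ c) then L + L else L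

        β-t : ℕ
        β-t = if does (c Fin.≟ 1F) then L else L + L

        off-t≤ : ∀ r t c′ → off-t r t c′ ≤ L + L
        off-t≤ r t c′ with does (r ≟ᶜ q) | does (c′ Fin.≟ c) | does (t Fin.≟ s)
        ... | true  | true  | true  = z≤n
        ... | true  | true  | false = ≤-refl
        ... | true  | false | _     = m≤m+n L L
        ... | false | _     | _     = m≤m+n L L

        off-t-L : ∀ r t c′ → (r ≡ q → c′ ≢ c) → off-t r t c′ ≡ L
        off-t-L r t c′ p with r ≟ᶜ q | c′ Fin.≟ c
        ... | yes r≡q | yes c′≡c = contradiction c′≡c (p r≡q)
        ... | yes _   | no _     = refl
        ... | no _    | _        = refl

        t-potential : Potential (level off-t α-t λ _ → β-t)
        t-potential = level-potential off-t α-t (λ _ → β-t) cyc ent lea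
          (λ _ e t _ → b-in e t) (λ _ e t _ → b-out e t)
          where
          α-≡ : ∀ k → val k q ≡ c → α-t k ≡ L + L
          α-≡ k p with val k q Fin.≟ c
          ... | yes _ = refl
          ... | no ¬p = contradiction p ¬p
          α-≢ : ∀ k → val k q ≢ c → α-t k ≡ L
          α-≢ k ¬p with val k q Fin.≟ c
          ... | yes p = contradiction p ¬p
          ... | no _  = refl
          β-≡ : c ≡ 1F → β-t ≡ L
          β-≡ refl = refl
          β-≢ : c ≢ 1F → β-t ≡ L + L
          β-≢ ¬p with c Fin.≟ 1F
          ... | yes p = contradiction p ¬p
          ... | no _  = refl
          exit≤ : ∀ {x} r t c′ → (r ≡ q → c′ ≢ c) → x ≡ L + L → x ≤ suc (off-t r t c′ + L)
          exit≤ r t c′ p refl rewrite off-t-L r t c′ p = n≤1+n (L + L)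
          cheap : ∀ {x} y → x ≡ L → x ≤ suc (y + L)
          cheap y refl = m≤n⇒m≤1+n (m≤n+m L y)
          enter≤ : ∀ {x} r t c′ → x ≡ L + L → off-t r t c′ ≤ suc x
          enter≤ r t c′ refl = m≤n⇒m≤1+n (off-t≤ r t c′)
          enter-L : ∀ {x} r t c′ → (r ≡ q → c′ ≢ c) → x ≡ L → off-t r t c′ ≤ suc x
          enter-L r t c′ p refl = m≤n⇒m≤1+n (≤-reflexive (off-t-L r t c′ p))
          cyc : ∀ r t c′ → off-t r t (neg c′) ≤ suc (off-t r t c′ + L)
          cyc r t c′ = go (c′ Fin.≟ c)
            where
            go : Dec (c′ ≡ c) → off-t r t (neg c′) ≤ suc (off-t r t c′ + L)
            go (yes refl) = cheap (off-t r t c′) (off-t-L r t (neg c′) λ _ → neg-≢ c′)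
            go (no c′≢c) = ≤-trans (off-t≤ r t (neg c′)) (exit≤ r t c′ (λ _ → c′≢c) refl)
          ent : ∀ k r t → off-t r t (val k r) ≤ suc (α-t k)
          ent k r t = go (val k q Fin.≟ c)
            where
            go : Dec (val k q ≡ c) → off-t r t (val k r) ≤ suc (α-t k)
            go (yes v≡c) = enter≤ r t (val k r) (α-≡ k v≡c)
            go (no v≢c)  = enter-L r t (val k r) (λ { refl → v≢c }) (α-≢ k v≢c)
          lea : ∀ k r t → α-t k ≤ suc (off-t r t (neg (val k r)) + L)
          lea k r t = go (val k q Fin.≟ c)
            where
            go : Dec (val k q ≡ c) → α-t k ≤ suc (off-t r t (neg (val k r)) + L)
            go (no v≢c)  = cheap (off-t r t (neg (val k r))) (α-≢ k v≢c)
            go (yes v≡c) = exit≤ r t (neg (val k r))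
              (λ { refl p → neg-≢ (val k r) (trans p (sym v≡c)) }) (α-≡ k v≡c)
          b-in : ∀ e t → β-t ≤ suc (off-t (inj₁ e) t 1F + L)
          b-in e t = go (c Fin.≟ 1F)
            where
            go : Dec (c ≡ 1F) → β-t ≤ suc (off-t (inj₁ e) t 1F + L)
            go (yes c≡1) = cheap (off-t (inj₁ e) t 1F) (β-≡ c≡1)
            go (no c≢1)  = exit≤ (inj₁ e) t 1F (λ _ p → c≢1 (sym p)) (β-≢ c≢1)
          b-out : ∀ e t → off-t (inj₁ e) t 0F ≤ suc β-t
          b-out e t = go (c Fin.≟ 1F)
            where
            go : Dec (c ≡ 1F) → off-t (inj₁ e) t 0F ≤ suc β-t
            go (yes c≡1) = enter-L (inj₁ e) t 0F (λ _ p → Fin.0≢1+n (trans p c≡1)) (β-≡ c≡1)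
            go (no c≢1)  = enter≤ (inj₁ e) t 0F (β-≢ c≢1)

        far-twin : ∀ i → [ L + L ] ≤∞ dist (ch q s c i) (ch q (neg s) c i)
        far-twin i = far (level off-t α-t λ _ → β-t) t-potential {ch q s c i} {ch q (neg s) c i}
            (begin
          off-t q s c + toℕ i + (L + L)     ≡⟨ cong (λ x → x + toℕ i + (L + L)) here₀ ⟩
          toℕ i + (L + L)                   ≡⟨ +-comm (toℕ i) (L + L) ⟩
          L + L + toℕ i                     ≡⟨ cong (_+ toℕ i) there₀ ⟨
          off-t q (neg s) c + toℕ i         ∎)
          where
          open ≤-Reasoning
          here₀ : off-t q s c ≡ 0
          here₀ with q ≟ᶜ q | c Fin.≟ c | s Fin.≟ s
          ... | no ¬p | _     | _     = contradiction refl ¬p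
          ... | yes _ | no ¬p | _     = contradiction refl ¬p
          ... | yes _ | yes _ | no ¬p = contradiction refl ¬p
          ... | yes _ | yes _ | yes _ = refl
          there₀ : off-t q (neg s) c ≡ L + L
          there₀ with q ≟ᶜ q | c Fin.≟ c | neg s Fin.≟ s
          ... | no ¬p | _     | _     = contradiction refl ¬p
          ... | yes _ | no ¬p | _     = contradiction refl ¬p
          ... | yes _ | yes _ | no _  = refl
          ... | yes _ | yes _ | yes p = contradiction p (neg-≢ s)

      module _ (n≤2^U : n ≤ 2 ^ U) where

        -- The digit of weight 2 ^ U vanishes for every aₖ.  The start of its cycle is
        -- far from all bⱼ.
        top : Coord
        top = inj₂ (Fin.fromℕ U)

        val-top : ∀ k → val k top ≡ 0F
        val-top k = Fin.toℕ-injective (trans (Fin.toℕ-fromℕ<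
            (m%n<n (⟦ shr ⟧ (toℕ k) (toℕ (Fin.fromℕ U))) 2))
          (cong (_% 2) (trans (cong (⟦ shr ⟧ (toℕ k)) (Fin.toℕ-fromℕ U))
            (shr-vanishes U (<-≤-trans (Fin.toℕ<n k) n≤2^U)))))

        off-o : Coord → Fin 2 → Fin 2 → ℕ
        off-o q t c = if does (q ≟ᶜ top) ∧ does (t Fin.≟ 0F) then
            (if does (c Fin.≟ 0F) then 0 else L) else L + L

        off-o≤ : ∀ q t c → off-o q t c ≤ L + L
        off-o≤ q t c with does (q ≟ᶜ top) | does (t Fin.≟ 0F) | does (c Fin.≟ 0F)
        ... | true  | true  | true  = z≤n
        ... | true  | true  | false = m≤m+n L L
        ... | true  | false | _     = ≤-refl
        ... | false | _     | _     = ≤-refl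

        -- All sets have value 0 at `top`, so its cycle is left only from the end of the chain of
        -- value 1, at level 2 L. Getting from a set to a `B` takes at least one more chain.
        o-potential : Potential (level off-o (λ _ → L + L) (λ _ → L + L + L))
        o-potential = level-potential off-o _ _ cyc
          (λ k q t → m≤n⇒m≤1+n (off-o≤ q t (val k q))) lea
          (λ j e t _ → n≤1+n _)
          (λ j e t _ → m≤n⇒m≤1+n (m≤m+n (L + L) L))
          where
          cyc : ∀ q t c → off-o q t (neg c) ≤ suc (off-o q t c + L)
          cyc q t c with does (q ≟ᶜ top) | does (t Fin.≟ 0F)
          cyc q t 0F | true  | true  = n≤1+n L
          cyc q t 1F | true  | true  = z≤n
          cyc q t c  | true  | false = m≤n⇒m≤1+n (m≤m+n (L + L) L)
          cyc q t c  | false | _     = m≤n⇒m≤1+n (m≤m+n (L + L) L)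
          lea : ∀ k q t → L + L ≤ suc (off-o q t (neg (val k q)) + L)
          lea k q t with q ≟ᶜ top | t Fin.≟ 0F
          ... | no _     | _     = m≤n⇒m≤1+n (m≤m+n (L + L) L)
          ... | yes _    | no _  = m≤n⇒m≤1+n (m≤m+n (L + L) L)
          ... | yes refl | yes _ rewrite val-top k = n≤1+n (L + L)

        off-i : Coord → Fin 2 → Fin 2 → ℕ
        off-i q t c = if does (q ≟ᶜ top) then L else 0

        off-i≤ : ∀ q t c → off-i q t c ≤ L
        off-i≤ q t c with does (q ≟ᶜ top)
        ... | true  = ≤-refl
        ... | false = z≤n

        -- The edges of a `B` lead into cycles of elements, and from these at least one whole chain
        -- has to be traversed to a set before the cycle of `top` can be entered.
        i-potential : Potential (level off-i (λ _ → L) (λ _ → 0))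
        i-potential = level-potential off-i _ _
          (λ q t c → m≤n⇒m≤1+n (≤-trans (off-i≤ q t (neg c)) (m≤n+m L _)))
          (λ k q t → m≤n⇒m≤1+n (off-i≤ q t (val k q)))
          (λ k q t → m≤n⇒m≤1+n (m≤n+m L _))
          (λ j e t _ → z≤n)
          (λ j e t _ → z≤n)

        origin : Vertex
        origin = ch top 0F 0F 0F

        top≡top : does (top ≟ᶜ top) ≡ true
        top≡top = dec-true (top ≟ᶜ top) refl

        far-origin-b : ∀ j → [ L + L + L ] ≤∞ dist origin (B j)
        far-origin-b j = far (level off-o _ _) o-potential {origin} {B j}
          (≤-reflexive (cong (λ x → x + 0 + (L + L + L)) zero-here))
          where
          zero-here : off-o top 0F 0F ≡ 0
          zero-here rewrite top≡top = refl

        far-b-origin : ∀ j → [ L ] ≤∞ dist (B j) origin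
        far-b-origin j = far (level off-i _ _) i-potential {B j} {origin}
          (≤-reflexive (trans (sym L-there) (sym (+-identityʳ (off-i top 0F 0F)))))
          where
          L-there : off-i top 0F 0F ≡ L
          L-there rewrite top≡top = refl

        rt-no : ¬ Hitting → [ L + L + (L + L) ] ≤∞ RoundtripRadius graph
        rt-no ¬h = Radius.≤-radius _+∞_ rtPresentation witness
          where
          rearrange : L + L + (L + L) ≡ L + (L + L + L)
          rearrange = trans (+-assoc L L (L + L)) (cong (L +_) (sym (+-assoc L L L)))
          witness : ∀ u → ∃[ v ] [ L + L + (L + L) ] ≤∞ dist u v +∞ dist v u
          witness (A k) = B j , roundtrip-far (A k) (B j) (far-a-b k j ¬hit) (far-b-a j k ¬hit)
            where
            j = proj₁ (missed ¬h k)
            ¬hit = proj₂ (missed ¬h k)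
          -- The two directions are unbalanced, L one way and 3 L the other, but only their sum
          -- counts.
          witness (B j) = origin , subst (λ t → [ t ] ≤∞ dist (B j) origin +∞ dist origin (B j))
            (sym rearrange) (roundtrip-far (B j) origin (far-b-origin j) (far-origin-b j))
          witness (ch q s c i) = twin , roundtrip-far (ch q s c i) twin (far-twin q s c i)
            (subst (λ t → [ L + L ] ≤∞ dist twin (ch q t c i)) (neg-neg s)
                (far-twin q (neg s) c i))
            where
            twin = ch q (neg s) c i

        into : ∀ k q s → A k ⟶⟨ 1 ⟩ ch q s (val k q) 0F
        into k (inj₁ e) s = subst (λ x → A k ⟶⟨ 1 ⟩ ch (inj₁ (proj₁ x)) (proj₂ x)
            (val k (inj₁ (proj₁ x))) 0F)
          (Fin.remQuot-combine e s) (arrow (by 2F k (Fin.combine e s) λ ()))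
        into k (inj₂ e) s = subst (λ x → A k ⟶⟨ 1 ⟩ ch (inj₂ (proj₁ x)) (proj₂ x)
            (val k (inj₂ (proj₁ x))) 0F)
          (Fin.remQuot-combine e s) (arrow (by 4F k (Fin.combine e s) λ ()))

        out : ∀ k q s → ch q s (neg (val k q)) tip ⟶⟨ 1 ⟩ A k
        out k (inj₁ e) s = subst (λ x → ch (inj₁ (proj₁ x)) (proj₂ x)
            (neg (val k (inj₁ (proj₁ x)))) tip ⟶⟨ 1 ⟩ A k)
          (Fin.remQuot-combine e s) (arrow (by 3F k (Fin.combine e s) λ ()))
        out k (inj₂ e) s = subst (λ x → ch (inj₂ (proj₁ x)) (proj₂ x)
            (neg (val k (inj₂ (proj₁ x)))) tip ⟶⟨ 1 ⟩ A k)
          (Fin.remQuot-combine e s) (arrow (by 5F k (Fin.combine e s) λ ()))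

        turn : ∀ q s c → ch q s c tip ⟶⟨ 1 ⟩ ch q s (neg c) 0F
        turn q s c = subst (λ r → ch r s c tip ⟶⟨ 1 ⟩ ch r s (neg c) 0F)
            (Fin.splitAt-join U (suc U) q)
          (subst (λ x → ch (Fin.splitAt U (proj₁ x)) (proj₂ x) c tip ⟶⟨ 1 ⟩
                        ch (Fin.splitAt U (proj₁ x)) (proj₂ x) (neg c) 0F)
            (Fin.remQuot-combine (Fin.join U (suc U) q) s)
            (arrow (by 1F (Fin.combine (Fin.join U (suc U) q) s) c λ ())))

        forth : ∀ q s c i → ch q s c (Fin.inject₁ i) ⟶⟨ 1 ⟩ ch q s c (Fin.suc i)
        forth q s c i = subst₂ (_⟶⟨ 1 ⟩_) (chains₃-index q s c (Fin.inject₁ i))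
            (chains₃-index q s c (Fin.suc i))
          (arrow (by 0F (index q s c) i λ ()))

        from-start : ∀ q s c i → ch q s c 0F ⟶⟨ toℕ i ⟩ ch q s c i
        from-start q s c = Fin.<-weakInduction (λ i → ch q s c 0F ⟶⟨ toℕ i ⟩ ch q s c i)
            stay
          λ i p → weaken (≤-reflexive (trans (+-comm _ 1) (cong suc (Fin.toℕ-inject₁ i))))
              (p then forth q s c i)

        to-tip : ∀ q s c i → ch q s c i ⟶⟨ L ∸ toℕ i ⟩ ch q s c tip
        to-tip q s c = Fin.>-weakInduction (λ i → ch q s c i ⟶⟨ L ∸ toℕ i ⟩ ch q s c tip)
          (weaken z≤n stay)
          λ i p → weaken (≤-reflexive
            (trans (sym (+-∸-assoc 1 (Fin.toℕ<n i))) (cong (L ∸_) (sym (Fin.toℕ-inject₁ i)))))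
            (forth q s c i then p)

        through : ∀ q s c → ch q s c 0F ⟶⟨ L ⟩ ch q s c tip
        through q s c = to-tip q s c 0F

        to-b : ∀ j e s → b j e ≡ true → ch (inj₁ e) s 1F tip ⟶⟨ 1 ⟩ B j
        to-b j e s b≡ = subst (λ x → ch (inj₁ (proj₁ x)) (proj₂ x) 1F tip ⟶⟨ 1 ⟩ B j)
            (Fin.remQuot-combine e s)
          (arrow (by 6F j (Fin.combine e s) λ p → true⇒bit≢0
            (subst (λ x → b j (proj₁ x) ≡ true) (sym (Fin.remQuot-combine e s)) b≡)
            (trans (sym (b-bit j (Fin.combine e s))) p)))

        from-b : ∀ j e s → b j e ≡ true → B j ⟶⟨ 1 ⟩ ch (inj₁ e) s 0F 0F
        from-b j e s b≡ = subst (λ x → B j ⟶⟨ 1 ⟩ ch (inj₁ (proj₁ x)) (proj₂ x) 0F 0F)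
            (Fin.remQuot-combine e s)
          (arrow (by 7F j (Fin.combine e s) λ p → true⇒bit≢0
            (subst (λ x → b j (proj₁ x) ≡ true) (sym (Fin.remQuot-combine e s)) b≡)
            (trans (sym (b-bit j (Fin.combine e s))) p)))

        separated : ∀ {k k′} → k ≢ k′ → ∃[ q ] val k q ≢ val k′ q
        separated {k} {k′} k≢k′ = inj₂ (proj₁ found) , proj₂ found
          where
          small : ∀ (k : Fin n) → toℕ k < 2 ^ U
          small k = <-≤-trans (Fin.toℕ<n k) n≤2^U
          place : ∀ {i} → i < U → Fin (suc U)
          place i<U = fromℕ< (m<n⇒m<1+n i<U)
          digit-of : ∀ k {i} (i<U : i < U) → toℕ (val k (inj₂ (place i<U))) ≡ ⟦ shr ⟧ (toℕ k) i
              % 2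
          digit-of k i<U = trans (Fin.toℕ-fromℕ< (m%n<n (⟦ shr ⟧ (toℕ k) (toℕ (place i<U))) 2))
            (cong (λ e → ⟦ shr ⟧ (toℕ k) e % 2) (Fin.toℕ-fromℕ< (m<n⇒m<1+n i<U)))
          coincide : (∀ e → val k (inj₂ e) ≡ val k′ (inj₂ e)) → k ≡ k′
          coincide same = Fin.toℕ-injective (bits-determine U (small k) (small k′) λ i<U →
            trans (sym (digit-of k i<U)) (trans (cong toℕ (same (place i<U))) (digit-of k′ i<U)))
          found : ∃[ e ] val k (inj₂ e) ≢ val k′ (inj₂ e)
          found = Fin.¬∀⟶∃¬ (suc U) (λ e → val k (inj₂ e) ≡ val k′ (inj₂ e))
            (λ e → val k (inj₂ e) Fin.≟ val k′ (inj₂ e)) (k≢k′ ∘ coincide)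

        A⟶A : ∀ {k k′} → k ≢ k′ → A k ⟶⟨ L + 2 ⟩ A k′
        A⟶A {k} {k′} k≢k′ with q , v≢ ← separated k≢k′ = weaken
          (≤-reflexive (trans (cong (1 +_) (+-comm L 1)) (+-comm 2 L)))
          (into k q 0F then through q 0F (val k q) then
            -- Two different values are opposite, so the chain entered by `A k` ends at `A k′`.
            subst (λ c → ch q 0F c tip ⟶⟨ 1 ⟩ A k′) (sym (≢⇒neg v≢)) (out k′ q 0F))

        module _ {k : Fin n} (hits : ∀ j → Hit k j) where

          budget : ℕ
          budget = (L + 2) + (L + 2)

          private
            -- A closed walk from `A k` through both chains of a cycle has 2 L + 3 steps. The two
            -- versions differ in whether the vertex lies on the first or the second chain.
            loop-length : ∀ i → i ≤ L → 1 + i + (L ∸ i + (1 + (L + 1))) ≤ budget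
            loop-length i i≤L = begin
              1 + i + (L ∸ i + (1 + (L + 1)))   ≡⟨ cong suc (+-assoc i (L ∸ i) _) ⟨
              1 + (i + (L ∸ i) + (1 + (L + 1))) ≡⟨ cong (λ x → 1 + (x + (1 + (L + 1))))
                  (m+[n∸m]≡n i≤L) ⟩
              1 + (L + (1 + (L + 1)))           ≡⟨ +-suc L (1 + (L + 1)) ⟨
              L + (2 + (L + 1))                 ≡⟨ +-assoc L 2 (L + 1) ⟨
              L + 2 + (L + 1)                   ≤⟨ +-monoʳ-≤ (L + 2) (+-monoʳ-≤ L (n≤1+n 1)) ⟩
              budget                            ∎
              where open ≤-Reasoning

            loop-length′ : ∀ i → i ≤ L → 1 + (L + (1 + i)) + (L ∸ i + 1) ≤ budget
            loop-length′ i i≤L = begin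
              1 + (L + (1 + i)) + (L ∸ i + 1)   ≡⟨ cong (_+ (L ∸ i + 1))
                  (trans (sym (+-suc L (1 + i))) (sym (+-assoc L 2 i))) ⟩
              L + 2 + i + (L ∸ i + 1)           ≡⟨ +-assoc (L + 2) i _ ⟩
              L + 2 + (i + (L ∸ i + 1))         ≡⟨ cong (L + 2 +_) (+-assoc i (L ∸ i) 1) ⟨
              L + 2 + (i + (L ∸ i) + 1)         ≡⟨ cong (λ x → L + 2 + (x + 1)) (m+[n∸m]≡n i≤L) ⟩
              L + 2 + (L + 1)                   ≤⟨ +-monoʳ-≤ (L + 2) (+-monoʳ-≤ L (n≤1+n 1)) ⟩
              budget                            ∎
              where open ≤-Reasoning

            L+2 : 1 + (L + 1) ≤ L + 2
            L+2 = ≤-reflexive (trans (cong (1 +_) (+-comm L 1)) (+-comm 2 L))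

          around : ∀ v → dist (A k) v +∞ dist v (A k) ≤∞ [ budget ]
          around (A k′) = go (k Fin.≟ k′)
            where
            go : Dec (k ≡ k′) → dist (A k) (A k′) +∞ dist (A k′) (A k) ≤∞ [ budget ]
            go (yes refl) = roundtrip-near {A k} {A k} stay stay z≤n
            go (no k≢k′)  = roundtrip-near {A k} {A k′} (A⟶A k≢k′) (A⟶A (≢-sym k≢k′)) ≤-refl
          -- `A k` has value 1 at the common element and enters the chain that ends at `B j`; in
          -- turn, `B j` enters the chain of value 0, which ends at `A k`.
          around (B j) = roundtrip-near {A k} {B j}
            (weaken L+2 (into k (inj₁ e) 0F then
              subst (λ c → ch (inj₁ e) 0F c 0F ⟶⟨ L + 1 ⟩ B j) (sym v≡1)
                (through (inj₁ e) 0F 1F then to-b j e 0F b≡)))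
            (weaken L+2 (from-b j e 0F b≡ then through (inj₁ e) 0F 0F then
              subst (λ c → ch (inj₁ e) 0F c tip ⟶⟨ 1 ⟩ A k) (cong neg v≡1) (out k (inj₁ e) 0F)))
            ≤-refl
            where
            e  = proj₁ (hits j)
            b≡ = proj₂ (proj₂ (hits j))
            v≡1 : val k (inj₁ e) ≡ 1F
            v≡1 = cong bitᶠ (proj₁ (proj₂ (hits j)))
          -- No hitting is involved here: from any set, one enters the cycle at the set's own value
          -- and returns after the opposite chain, having met all of its vertices.
          around (ch q s c i) = go c (c Fin.≟ val k q)
            where
            i≤L = ≤-pred (Fin.toℕ<n i)
            go : ∀ c → Dec (c ≡ val k q) → dist (A k) (ch q s c i) +∞ dist (ch q s c i) (A k) ≤∞ [
                budget ]
            go c (yes refl) = roundtrip-near {A k} {ch q s c i}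
              (into k q s then from-start q s c i)
              (to-tip q s c i then turn q s c then through q s (neg c) then out k q s)
              (loop-length (toℕ i) i≤L)
            go c (no c≢v) = subst (λ c → dist (A k) (ch q s c i) +∞ dist (ch q s c i) (A k) ≤∞ [
                budget ])
              (sym (≢⇒neg c≢v))
              (roundtrip-near {A k} {ch q s (neg (val k q)) i}
                (into k q s then through q s (val k q) then turn q s (val k q) then
                  from-start q s (neg (val k q)) i)
                (to-tip q s (neg (val k q)) i then out k q s)
                (loop-length′ (toℕ i) i≤L))

        rt-yes : Hitting → RoundtripRadius graph ≤∞ [ (L + 2) + (L + 2) ]
        rt-yes (k , hits) = Radius.radius-≤ _+∞_ rtPresentation (A k) (around hits)

  -- Running times

  ⌊log⌋-upper : ∀ j {n} → n < 2 ^ suc j → ⌊log₂ n ⌋ ≤ j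
  ⌊log⌋-upper zero {zero}            p = z≤n
  ⌊log⌋-upper zero {suc zero}        p = z≤n
  ⌊log⌋-upper zero {suc (suc n)}     (s≤s (s≤s ()))
  ⌊log⌋-upper (suc j) {n} p = m∸n≤o⇒m≤o+n′ (subst (_≤ j) (⌊log₂⌊n/2⌋⌋≡⌊log₂n⌋∸1 n)
    (⌊log⌋-upper j (*-cancelˡ-< 2 ⌊ n /2⌋ (2 ^ suc j) (≤-<-trans twice p))))
    where
    m∸n≤o⇒m≤o+n′ : ∀ {m} → m ∸ 1 ≤ j → m ≤ suc j
    m∸n≤o⇒m≤o+n′ {zero}  _ = z≤n
    m∸n≤o⇒m≤o+n′ {suc m} q = s≤s q
    twice : 2 * ⌊ n /2⌋ ≤ n
    twice = begin
      2 * ⌊ n /2⌋           ≡⟨ cong (⌊ n /2⌋ +_) (+-identityʳ ⌊ n /2⌋) ⟩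
      ⌊ n /2⌋ + ⌊ n /2⌋     ≤⟨ +-monoʳ-≤ ⌊ n /2⌋ (⌊n/2⌋≤⌈n/2⌉ n) ⟩
      ⌊ n /2⌋ + ⌈ n /2⌉     ≡⟨ ⌊n/2⌋+⌈n/2⌉≡n n ⟩
      n                     ∎
      where open ≤-Reasoning

  2^⌊log⌋≤n : ∀ n .{{_ : NonZero n}} → 2 ^ ⌊log₂ n ⌋ ≤ n
  2^⌊log⌋≤n n = go ⌊log₂ n ⌋ refl
    where
    go : ∀ l → ⌊log₂ n ⌋ ≡ l → 2 ^ l ≤ n
    go zero    _ = >-nonZero⁻¹ n
    go (suc l) p = ≮⇒≥ λ n< → <⇒≱ (n<1+n l) (subst (_≤ l) p (⌊log⌋-upper l n<))

  n≤2^⌈log⌉ : ∀ n → n ≤ 2 ^ ⌈log₂ n ⌉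
  n≤2^⌈log⌉ n = go ⌈log₂ n ⌉ n ≤-refl
    where
    go : ∀ j n → ⌈log₂ n ⌉ ≤ j → n ≤ 2 ^ j
    go zero zero          p = z≤n
    go zero (suc zero)    p = ≤-refl
    go zero (suc (suc n)) p = contradiction (≤-trans
        (⌈log₂⌉-mono-≤ {2} {suc (suc n)} (s≤s (s≤s z≤n))) p) λ ()
    go (suc j) n p = begin
      n                     ≡⟨ ⌊n/2⌋+⌈n/2⌉≡n n ⟨
      ⌊ n /2⌋ + ⌈ n /2⌉     ≤⟨ +-monoˡ-≤ ⌈ n /2⌉ (⌊n/2⌋≤⌈n/2⌉ n) ⟩
      ⌈ n /2⌉ + ⌈ n /2⌉     ≤⟨ +-mono-≤ half half ⟩
      2 ^ j + 2 ^ j         ≡⟨ cong (2 ^ j +_) (+-identityʳ (2 ^ j)) ⟨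
      2 ^ suc j             ∎
      where
      open ≤-Reasoning
      half : ⌈ n /2⌉ ≤ 2 ^ j
      half = go j ⌈ n /2⌉ (subst (_≤ j) (sym (⌈log₂⌈n/2⌉⌉≡⌈log₂n⌉∸1 n)) (∸-monoˡ-≤ 1 p))

  n<2^1+⌊log⌋ : ∀ n → n < 2 ^ suc ⌊log₂ n ⌋
  n<2^1+⌊log⌋ n = ≰⇒> λ q → <⇒≱ (n<1+n ⌊log₂ n ⌋)
    (≤-trans (≤-reflexive (sym (⌊log₂[2^n]⌋≡n (suc ⌊log₂ n ⌋)))) (⌊log₂⌋-mono-≤ q))

  ⌈log⌉≤1+⌊log⌋ : ∀ n → ⌈log₂ n ⌉ ≤ suc ⌊log₂ n ⌋
  ⌈log⌉≤1+⌊log⌋ n = ≤-trans (⌈log₂⌉-mono-≤ (<⇒≤ (n<2^1+⌊log⌋ n))) (≤-reflexive (⌈log₂2^n⌉≡n _))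

  ^-distribʳ-* : ∀ k x y → (x * y) ^ k ≡ x ^ k * y ^ k
  ^-distribʳ-* zero    x y = refl
  ^-distribʳ-* (suc k) x y = trans (cong (x * y *_) (^-distribʳ-* k x y))
      ([m*n]*[o*p]≡[m*o]*[n*p] x y (x ^ k) (y ^ k))

  -- Division with remainder gives `suc l` ≤ (l / k + 1) k, and applying x + 1 ≤ 2 ^ x to the
  -- quotient turns this into k 2 ^ (l / k), whose k-th power is at most k ^ k 2 ^ l.
  1+l^k≤ : ∀ l k .{{_ : NonZero k}} → suc l ^ k ≤ k ^ k * 2 ^ l
  1+l^k≤ l k = begin
    suc l ^ k                   ≤⟨ ^-monoˡ-≤ k base ⟩
    (k * 2 ^ (l / k)) ^ k       ≡⟨ ^-distribʳ-* k k (2 ^ (l / k)) ⟩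
    k ^ k * (2 ^ (l / k)) ^ k   ≡⟨ cong (k ^ k *_) (^-*-assoc 2 (l / k) k) ⟩
    k ^ k * 2 ^ (l / k * k)     ≤⟨ *-monoʳ-≤ (k ^ k) (^-monoʳ-≤ 2 (m/n*n≤m l k)) ⟩
    k ^ k * 2 ^ l               ∎
    where
    open ≤-Reasoning
    base : suc l ≤ k * 2 ^ (l / k)
    base = begin
      suc l                   ≡⟨ cong suc (m≡m%n+[m/n]*n l k) ⟩
      suc (l % k) + l / k * k ≤⟨ +-monoˡ-≤ (l / k * k) (m%n<n l k) ⟩
      suc (l / k) * k         ≤⟨ *-monoˡ-≤ k (m<2^m (l / k)) ⟩
      2 ^ (l / k) * k         ≡⟨ *-comm _ k ⟩
      k * 2 ^ (l / k)         ∎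

  log^k≤ : ∀ n k .{{_ : NonZero n}} .{{_ : NonZero k}} → suc ⌊log₂ n ⌋ ^ k ≤ k ^ k * n
  log^k≤ n k = ≤-trans (1+l^k≤ ⌊log₂ n ⌋ k) (*-monoʳ-≤ (k ^ k) (2^⌊log⌋≤n n))

  +-^-≤ : ∀ x y k → (x + y) ^ k ≤ 2 ^ k * (x ^ k + y ^ k)
  +-^-≤ x y k = begin
    (x + y) ^ k               ≤⟨ ^-monoˡ-≤ k sum≤ ⟩
    (2 * (x ⊔ y)) ^ k         ≡⟨ ^-distribʳ-* k 2 (x ⊔ y) ⟩
    2 ^ k * (x ⊔ y) ^ k       ≤⟨ *-monoʳ-≤ (2 ^ k) max≤ ⟩
    2 ^ k * (x ^ k + y ^ k)   ∎
    where
    open ≤-Reasoning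
    sum≤ : x + y ≤ 2 * (x ⊔ y)
    sum≤ = ≤-trans (+-mono-≤ (m≤m⊔n x y) (m≤n⊔m x y))
                   (≤-reflexive (cong (x ⊔ y +_) (sym (+-identityʳ (x ⊔ y)))))
    max≤ : (x ⊔ y) ^ k ≤ x ^ k + y ^ k
    max≤ with ⊔-sel x y
    ... | inj₁ p rewrite p = m≤m+n _ _
    ... | inj₂ p rewrite p = m≤n+m _ _

  quasilinear-power : ∀ A n k .{{_ : NonZero n}} .{{_ : NonZero k}} →
    (A * (n * suc ⌊log₂ n ⌋)) ^ k ≤ A ^ k * k ^ k * n ^ suc k
  quasilinear-power A n k = begin
    (A * (n * ℓ)) ^ k           ≡⟨ ^-distribʳ-* k A (n * ℓ) ⟩
    A ^ k * (n * ℓ) ^ k         ≡⟨ cong (A ^ k *_) (^-distribʳ-* k n ℓ) ⟩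
    A ^ k * (n ^ k * ℓ ^ k)     ≤⟨ *-monoʳ-≤ (A ^ k) (*-monoʳ-≤ (n ^ k) (log^k≤ n k)) ⟩
    A ^ k * (n ^ k * (k ^ k * n)) ≡⟨ cong (A ^ k *_) (x∙yz≈y∙zx (n ^ k) (k ^ k) n) ⟩
    A ^ k * (k ^ k * (n * n ^ k)) ≡⟨ *-assoc (A ^ k) (k ^ k) _ ⟨
    A ^ k * k ^ k * n ^ suc k   ∎
    where
    open ≤-Reasoning
    ℓ = suc ⌊log₂ n ⌋

  -- The first summand pays for writing the graph and the second for the relocated run, whose two
  -- instructions per step give the inner 2 ^ k. The outer one comes from `+-^-≤`.
  timeConstant : (k e A C : ℕ) → ℕ
  timeConstant k e A C = 2 ^ k * (A ^ k * k ^ k + 2 ^ k * (C ^ 2 * (A ^ e * e ^ e)))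

  -- A call of cost t^q m ≤ C m^(2q) on an instance of size m = O(n log n), with
  -- overhead O(n log n), stays below n^(2 - 1/(2q)).  Here k = 2q, h = 2q - 1 and
  -- e = 2h.
  time-bound : ∀ {q k h e A C n m t T p} .{{_ : NonZero k}} .{{nonZero-e : NonZero e}}
    .{{nonZero-n : NonZero n}} .{{nonZero-m : NonZero m}} →
    q * 2 ≡ k → 2 * q ≡ suc h → h * 2 ≡ e → suc (suc e) ≡ 2 * k → suc (suc k) ≤ 2 * k →
    0 < p → m ≤ A * (n * suc ⌊log₂ n ⌋) → T ≤ A * (n * suc ⌊log₂ n ⌋) + 2 * t →
    t ^ q * m ^ p ≤ C * m ^ (2 * q) → T ^ k * n ≤ timeConstant k e A C * n ^ (2 * k)
  time-bound {q} {k} {h} {e} {A} {C} {n} {m} {t} {T} {p} k-eq h-eq e-eq e+2 k+2 0<p m≤ T≤ t≤ =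
      begin
    T ^ k * n
      ≤⟨ *-monoˡ-≤ n (≤-trans (^-monoˡ-≤ k T≤) (+-^-≤ W (2 * t) k)) ⟩
    2 ^ k * (W ^ k + (2 * t) ^ k) * n
      ≡⟨ *-assoc (2 ^ k) _ n ⟩
    2 ^ k * ((W ^ k + (2 * t) ^ k) * n)
      ≡⟨ cong (2 ^ k *_) (*-distribʳ-+ n (W ^ k) _) ⟩
    2 ^ k * (W ^ k * n + (2 * t) ^ k * n)
      ≤⟨ *-monoʳ-≤ (2 ^ k) (+-mono-≤ overhead call) ⟩
    2 ^ k * (A ^ k * k ^ k * n ^ (2 * k) + 2 ^ k * (C ^ 2 * (A ^ e * e ^ e)) * n ^ (2 * k))
      ≡⟨ cong (2 ^ k *_) (*-distribʳ-+ (n ^ (2 * k)) (A ^ k * k ^ k) _) ⟨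
    2 ^ k * ((A ^ k * k ^ k + 2 ^ k * (C ^ 2 * (A ^ e * e ^ e))) * n ^ (2 * k))
      ≡⟨ *-assoc (2 ^ k) _ _ ⟨
    timeConstant k e A C * n ^ (2 * k) ∎
    where
    open ≤-Reasoning
    W = A * (n * suc ⌊log₂ n ⌋)
    overhead : W ^ k * n ≤ A ^ k * k ^ k * n ^ (2 * k)
    overhead = begin
      W ^ k * n                           ≤⟨ *-monoˡ-≤ n (quasilinear-power A n k) ⟩
      A ^ k * k ^ k * n ^ suc k * n       ≡⟨ *-assoc (A ^ k * k ^ k) (n ^ suc k) n ⟩
      A ^ k * k ^ k * (n ^ suc k * n)     ≡⟨ cong (A ^ k * k ^ k *_) (*-comm (n ^ suc k) n) ⟩
      A ^ k * k ^ k * n ^ suc (suc k)     ≤⟨ *-monoʳ-≤ (A ^ k * k ^ k) (^-monoʳ-≤ n k+2) ⟩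
      A ^ k * k ^ k * n ^ (2 * k)         ∎
    -- Of the factor m ^ p only one m is kept, which weakens the saving p / q to 1 / q. Cancelling
    -- it leaves the exponent 2 q - 1.
    t^q≤ : t ^ q ≤ C * m ^ h
    t^q≤ = *-cancelʳ-≤ (t ^ q) (C * m ^ h) m (begin
      t ^ q * m           ≤⟨ *-monoʳ-≤ (t ^ q) (m≤m^n m p 0<p) ⟩
      t ^ q * m ^ p       ≤⟨ t≤ ⟩
      C * m ^ (2 * q)     ≡⟨ cong (λ x → C * m ^ x) h-eq ⟩
      C * (m * m ^ h)     ≡⟨ cong (C *_) (*-comm m (m ^ h)) ⟩
      C * (m ^ h * m)     ≡⟨ *-assoc C (m ^ h) m ⟨
      C * m ^ h * m       ∎)
    t^k≤ : t ^ k ≤ C ^ 2 * W ^ e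
    t^k≤ = begin
      t ^ k                 ≡⟨ cong (t ^_) k-eq ⟨
      t ^ (q * 2)           ≡⟨ ^-*-assoc t q 2 ⟨
      (t ^ q) ^ 2           ≤⟨ ^-monoˡ-≤ 2 t^q≤ ⟩
      (C * m ^ h) ^ 2       ≡⟨ ^-distribʳ-* 2 C (m ^ h) ⟩
      C ^ 2 * (m ^ h) ^ 2   ≡⟨ cong (C ^ 2 *_) (trans (^-*-assoc m h 2) (cong (m ^_) e-eq)) ⟩
      C ^ 2 * m ^ e         ≤⟨ *-monoʳ-≤ (C ^ 2) (^-monoˡ-≤ e m≤) ⟩
      C ^ 2 * W ^ e         ∎
    regroup : ∀ a b c x y → a * (b * (c * x)) * y ≡ a * (b * c) * (y * x)
    regroup a b c x y = trans (cong (_* y) (trans (cong (a *_) (sym (*-assoc b c x)))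
        (sym (*-assoc a (b * c) x))))
      (trans (*-assoc (a * (b * c)) x y) (cong (a * (b * c) *_) (*-comm x y)))
    -- The logarithms in m ^ e cost one factor n, and the claimed saving is another one, giving n ^
    -- (e + 2). Squaring beforehand is what makes room for both, at the price of halving the saving.
    call : (2 * t) ^ k * n ≤ 2 ^ k * (C ^ 2 * (A ^ e * e ^ e)) * n ^ (2 * k)
    call = begin
      (2 * t) ^ k * n
        ≡⟨ cong (_* n) (^-distribʳ-* k 2 t) ⟩
      2 ^ k * t ^ k * n
        ≤⟨ *-monoˡ-≤ n (*-monoʳ-≤ (2 ^ k) (≤-trans t^k≤
            (*-monoʳ-≤ (C ^ 2) (quasilinear-power A n e)))) ⟩
      2 ^ k * (C ^ 2 * (A ^ e * e ^ e * n ^ suc e)) * n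
        ≡⟨ regroup (2 ^ k) (C ^ 2) (A ^ e * e ^ e) (n ^ suc e) n ⟩
      2 ^ k * (C ^ 2 * (A ^ e * e ^ e)) * n ^ suc (suc e)
        ≡⟨ cong (λ x → 2 ^ k * (C ^ 2 * (A ^ e * e ^ e)) * n ^ x) e+2 ⟩
      2 ^ k * (C ^ 2 * (A ^ e * e ^ e)) * n ^ (2 * k) ∎

  -- From R* ≤ (2 - δ) R with δ ≥ 1/q.
  approximation-gap : ∀ δ {R R*} → ℚ.0ℚ ℚ.< δ →
    IsApproximation (ℤ.+ 2 ℚ./ 1 ℚ.- δ) [ R ] [ R* ] → R* * ℚ.↧ₙ δ + R ≤ 2 * ℚ.↧ₙ δ * R
  approximation-gap (ℚ.mkℚ (ℤ.+ zero) d _)  (ℚ.*<* (ℤ.+<+ ())) _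
  approximation-gap (ℚ.mkℚ (ℤ.-[1+ _ ]) d _) (ℚ.*<* ()) _
  approximation-gap δ@(ℚ.mkℚ (ℤ.+ suc p) d _) {R} {R*} _ (_ , R*≤) = ℤ.drop‿+≤+ (begin
    ℤ.+ (R* * q + R)
      ≡⟨ ℤ.pos-+ (R* * q) R ⟩
    ℤ.+ (R* * q) ℤ.+ ℤ.+ R
      -- A positive δ has numerator at least 1.
      ≤⟨ ℤ.+-monoʳ-≤ (ℤ.+ (R* * q)) (ℤ.+≤+ (m≤m+n R (p * R))) ⟩
    ℤ.+ (R* * q) ℤ.+ ℤ.+ (suc p * R)
      ≤⟨ ℤ.+-monoˡ-≤ (ℤ.+ (suc p * R)) bound ⟩
    (ℤ.+ (2 * q) ℤ.- ℤ.+ suc p) ℤ.* ℤ.+ R ℤ.+ ℤ.+ (suc p * R)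
      ≡⟨ cong (λ x → (ℤ.+ (2 * q) ℤ.- ℤ.+ suc p) ℤ.* ℤ.+ R ℤ.+ x) (ℤ.pos-* (suc p) R) ⟩
    (ℤ.+ (2 * q) ℤ.- ℤ.+ suc p) ℤ.* ℤ.+ R ℤ.+ ℤ.+ suc p ℤ.* ℤ.+ R
      ≡⟨ ℤ.*-distribʳ-+ (ℤ.+ R) (ℤ.+ (2 * q) ℤ.- ℤ.+ suc p) (ℤ.+ suc p) ⟨
    (ℤ.+ (2 * q) ℤ.- ℤ.+ suc p ℤ.+ ℤ.+ suc p) ℤ.* ℤ.+ R
      ≡⟨ cong (ℤ._* ℤ.+ R) (trans (ℤ.+-assoc (ℤ.+ (2 * q)) (ℤ.- ℤ.+ suc p) (ℤ.+ suc p))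
           (trans (cong (λ x → ℤ.+ (2 * q) ℤ.+ x) (ℤ.+-inverseˡ (ℤ.+ suc p)))
               (ℤ.+-identityʳ (ℤ.+ (2 * q))))) ⟩
    ℤ.+ (2 * q) ℤ.* ℤ.+ R
      ≡⟨ ℤ.pos-* (2 * q) R ⟨
    ℤ.+ (2 * q * R) ∎)
    where
    open ℤ.≤-Reasoning
    q = suc d
    two : ℚᵘ.ℚᵘ
    two = ℚᵘ.mkℚᵘ (ℤ.+ 2) 0
    -- Without normalisation, sums and products of fractions compute to explicit numerators and
    -- denominators, so the inequality can be cleared of fractions.
    unnormalised : ℚ.toℚᵘ (ℤ.+ R* ℚ./ 1) ℚᵘ.≤ (two ℚᵘ.- ℚ.toℚᵘ δ) ℚᵘ.* ℚᵘ.mkℚᵘ (ℤ.+ R) 0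
    unnormalised = ℚᵘ.≤-respʳ-≃
      (ℚᵘ.≃-trans (ℚ.toℚᵘ-homo-* (ℤ.+ 2 ℚ./ 1 ℚ.- δ) (ℤ.+ R ℚ./ 1))
        (ℚᵘ.*-cong
          (ℚᵘ.≃-trans (ℚ.toℚᵘ-homo-+ (ℤ.+ 2 ℚ./ 1) (ℚ.- δ))
            (ℚᵘ.+-cong (ℚ.toℚᵘ-fromℚᵘ two) (ℚ.toℚᵘ-homo‿- δ)))
          (ℚ.toℚᵘ-fromℚᵘ (ℚᵘ.mkℚᵘ (ℤ.+ R) 0))))
      (ℚ.toℚᵘ-mono-≤ R*≤)
    fraction : ℚᵘ.mkℚᵘ (ℤ.+ R*) 0 ℚᵘ.≤ (two ℚᵘ.- ℚ.toℚᵘ δ) ℚᵘ.* ℚᵘ.mkℚᵘ (ℤ.+ R) 0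
    fraction = ℚᵘ.≤-respˡ-≃ (ℚ.toℚᵘ-fromℚᵘ (ℚᵘ.mkℚᵘ (ℤ.+ R*) 0)) unnormalised
    bound : ℤ.+ (R* * q) ℤ.≤ (ℤ.+ (2 * q) ℤ.- ℤ.+ suc p) ℤ.* ℤ.+ R
    bound with ℚᵘ.*≤* le ← fraction = begin
      ℤ.+ (R* * q)
        ≡⟨ cong (λ x → ℤ.+ (R* * x)) (sym (trans (*-identityʳ (q + 0)) (+-identityʳ q))) ⟩
      ℤ.+ (R* * ((q + 0) * 1))
        ≡⟨ ℤ.pos-* R* _ ⟩
      ℤ.+ R* ℤ.* ℤ.+ ((q + 0) * 1)
        ≤⟨ le ⟩
      (ℤ.+ 2 ℤ.* ℤ.+ q ℤ.+ (ℤ.- ℤ.+ suc p) ℤ.* ℤ.+ 1) ℤ.* ℤ.+ R ℤ.* ℤ.+ 1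
        ≡⟨ ℤ.*-identityʳ _ ⟩
      (ℤ.+ 2 ℤ.* ℤ.+ q ℤ.+ (ℤ.- ℤ.+ suc p) ℤ.* ℤ.+ 1) ℤ.* ℤ.+ R
        ≡⟨ cong (ℤ._* ℤ.+ R) (cong₂ ℤ._+_ (sym (ℤ.pos-* 2 q)) (ℤ.*-identityʳ (ℤ.- ℤ.+ suc p))) ⟩
      (ℤ.+ (2 * q) ℤ.- ℤ.+ suc p) ℤ.* ℤ.+ R ∎

  -- With paths of length L ≥ 4q, the radii L + 2 and 2 L are told apart, and so
  -- are their doubles.
  gap-separates : ∀ q g R {R*} → 0 < q → 0 < g → R ≤ g * (4 * q + 2) → R* * q + R ≤ 2 * q * R →
                  R* < g * (4 * q + 4 * q)
  gap-separates q@(suc r) g R {R*} _ 0<g R≤ gap = *-cancelʳ-< q R* (g * (4 * q + 4 * q))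
      (begin-strict
    R* * q                        ≤⟨ +-cancelʳ-≤ R (R* * q) (h * R)
        (≤-trans gap (≤-reflexive split)) ⟩
    h * R                         ≤⟨ *-monoʳ-≤ h R≤ ⟩
    h * (g * (4 * q + 2))         ≡⟨ x∙yz≈y∙xz h g (4 * q + 2) ⟩
    g * (h * (4 * q + 2))         <⟨ *-monoʳ-< g {{>-nonZero 0<g}} small ⟩
    g * ((4 * q + 4 * q) * q)     ≡⟨ *-assoc g (4 * q + 4 * q) q ⟨
    g * (4 * q + 4 * q) * q       ∎)
    where
    open ≤-Reasoning
    h = 1 + 2 * r
    2q≡ : 2 * q ≡ suc h
    2q≡ = *-suc 2 r
    split : 2 * q * R ≡ h * R + R
    split = trans (cong (_* R) 2q≡) (+-comm R (h * R))
    -- As 2 q = h + 1, this is twice the inequality h (h + 2) < (h + 1) ^ 2; the length 4 q is just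
    -- enough for it.
    small : h * (4 * q + 2) < (4 * q + 4 * q) * q
    small = begin-strict
      h * (4 * q + 2)             ≡⟨ cong (λ x → h * (x + 2))
          (trans (*-assoc 2 2 q) (cong (2 *_) 2q≡)) ⟩
      h * (2 * suc h + 2)         ≡⟨ cong (h *_)
          (trans (+-comm (2 * suc h) 2) (sym (*-suc 2 (suc h)))) ⟩
      h * (2 * suc (suc h))       ≡⟨ x∙yz≈y∙xz h 2 (suc (suc h)) ⟩
      2 * (h * suc (suc h))       <⟨ *-monoʳ-< 2 square ⟩
      2 * (suc h * suc h)         ≡⟨ cong (λ x → 2 * (x * x)) 2q≡ ⟨
      2 * (2 * q * (2 * q))       ≡⟨ cong (2 *_) (x∙yz≈xz∙y′ q) ⟩
      2 * (4 * q * q)             ≡⟨ *-assoc 2 (4 * q) q ⟨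
      2 * (4 * q) * q             ≡⟨ cong (λ x → (4 * q + x) * q) (+-identityʳ (4 * q)) ⟩
      (4 * q + 4 * q) * q         ∎
      where
      square : h * suc (suc h) < suc h * suc h
      square = begin-strict
        h * suc (suc h)     ≡⟨ *-suc h (suc h) ⟩
        h + h * suc h       <⟨ ≤-refl ⟩
        suc h * suc h       ∎
      x∙yz≈xz∙y′ : ∀ q → 2 * q * (2 * q) ≡ 4 * q * q
      x∙yz≈xz∙y′ q = trans (sym (*-assoc (2 * q) 2 q))
        (cong (_* q) (trans (*-comm (2 * q) 2) (sym (*-assoc 2 2 q))))

  -- The encoding of hitting set instances

  bitsOf : ∀ {m U} → Vec (Subset.Subset U) m → List ℕ
  bitsOf Ss = concatMap (λ S → map bit (toList S)) (toList Ss)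

  padded-++ˡ : ∀ xs ys {i} → i < length xs → padded (xs ++ ys) i ≡ padded xs i
  padded-++ˡ (x ∷ xs) ys {zero}  p       = refl
  padded-++ˡ (x ∷ xs) ys {suc i} (s≤s p) = padded-++ˡ xs ys p

  padded-++ʳ : ∀ xs ys i → padded (xs ++ ys) (length xs + i) ≡ padded ys i
  padded-++ʳ []       ys i = refl
  padded-++ʳ (x ∷ xs) ys i = padded-++ʳ xs ys i

  padded-beyond : ∀ xs {i} → length xs ≤ i → padded xs i ≡ 0
  padded-beyond []       p       = refl
  padded-beyond (x ∷ xs) (s≤s p) = padded-beyond xs p

  padded-≤ : ∀ {b xs} → All (_≤ b) xs → ∀ i → padded xs i ≤ b
  padded-≤ []       i       = z≤n
  padded-≤ (p ∷ ps) zero    = p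
  padded-≤ (p ∷ ps) (suc i) = padded-≤ ps i

  module _ {U : ℕ} where

    length-row : (S : Subset.Subset U) → length (map bit (toList S)) ≡ U
    length-row S = trans (length-map bit (toList S)) (Vec.length-toList S)

    length-bitsOf : ∀ {m} (Ss : Vec (Subset.Subset U) m) → length (bitsOf Ss) ≡ m * U
    length-bitsOf []       = refl
    length-bitsOf (S ∷ Ss) = trans (length-++ (map bit (toList S)))
      (cong₂ _+_ (length-row S) (length-bitsOf Ss))

    padded-row : ∀ {U} (S : Subset.Subset U) e → padded (map bit (toList S)) (toℕ e) ≡ bit
        (lookup S e)
    padded-row (b ∷ S) 0F    = refl
    padded-row (b ∷ S) (Fin.suc e) = padded-row S e

    padded-bitsOf : ∀ {m} (Ss : Vec (Subset.Subset U) m) k e →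
      padded (bitsOf Ss) (toℕ k * U + toℕ e) ≡ bit (lookup (lookup Ss k) e)
    padded-bitsOf (S ∷ Ss) 0F e = trans
      (padded-++ˡ (map bit (toList S)) (bitsOf Ss)
          (subst (toℕ e <_) (sym (length-row S)) (Fin.toℕ<n e)))
      (padded-row S e)
    padded-bitsOf (S ∷ Ss) (Fin.suc k) e = trans
      (cong (padded (bitsOf (S ∷ Ss))) (trans (+-assoc U (toℕ k * U) (toℕ e))
        (cong (_+ (toℕ k * U + toℕ e)) (sym (length-row S)))))
      (trans (padded-++ʳ (map bit (toList S)) (bitsOf Ss) (toℕ k * U + toℕ e))
          (padded-bitsOf Ss k e))

    bitsOf-≤1 : ∀ {m} (Ss : Vec (Subset.Subset U) m) → All (_≤ 1) (bitsOf Ss)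
    bitsOf-≤1 []       = []
    bitsOf-≤1 (S ∷ Ss) = All.++⁺ (All.map⁺ (All.tabulate λ {b} _ → bit≤1 b)) (bitsOf-≤1 Ss)
      where
      bit≤1 : ∀ b → bit b ≤ 1
      bit≤1 true  = ≤-refl
      bit≤1 false = z≤n

  module _ {c : ℚ.ℚ} (I : HSInstance c) where

    open HSInstance I

    private
      inp : ℕ → ℕ
      inp = padded (encodeHS I)

      second-cell : ∀ i → inp (2 + (n * U + i)) ≡ padded (bitsOf second) i
      second-cell i = trans (cong (λ l → padded (bitsOf first ++ bitsOf second) (l + i))
          (sym (length-bitsOf first)))
        (padded-++ʳ (bitsOf first) (bitsOf second) i)

      in-block : ∀ (k : Fin n) (e : Fin U) → toℕ k * U + toℕ e < n * U
      in-block k e = begin-strict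
        toℕ k * U + toℕ e     <⟨ +-monoʳ-< (toℕ k * U) (Fin.toℕ<n e) ⟩
        toℕ k * U + U         ≡⟨ +-comm (toℕ k * U) U ⟩
        suc (toℕ k) * U       ≤⟨ *-monoˡ-≤ U (Fin.toℕ<n k) ⟩
        n * U                 ∎
        where open ≤-Reasoning

    families : Families
    families = record
      { n = n ; U = U
      ; a = λ k e → lookup (lookup first k) e
      ; b = λ k e → lookup (lookup second k) e
      ; inp = inp
      ; inp-a = λ k e → trans (padded-++ˡ (bitsOf first) (bitsOf second)
          (subst (toℕ k * U + toℕ e <_) (sym (length-bitsOf first)) (in-block k e)))
              (padded-bitsOf first k e)
      ; inp-b = λ k e → trans (second-cell (toℕ k * U + toℕ e)) (padded-bitsOf second k e)
      }

    input-end : ∀ i → 2 + 2 * (n * U) ≤ i → inp i ≡ 0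
    input-end i p = padded-beyond (encodeHS I) (≤-trans (≤-reflexive (cong (2 +_) len)) p)
      where
      len : length (bitsOf first ++ bitsOf second) ≡ 2 * (n * U)
      len = trans (length-++ (bitsOf first))
        (cong₂ _+_ (length-bitsOf first) (trans (length-bitsOf second)
            (sym (+-identityʳ (n * U)))))

    input-≤ : ∀ {X} → n ≤ X → U ≤ X → 1 ≤ X → ∀ i → inp i ≤ X
    input-≤ n≤ U≤ 1≤ = padded-≤ (n≤ ∷ U≤ ∷
      All.map (λ p → ≤-trans p 1≤) (All.++⁺ (bitsOf-≤1 first) (bitsOf-≤1 second)))

    private
      common : ∀ k j → Families.Hit families k j →
          Subset.Nonempty (lookup first k Subset.∩ lookup second j)
      common k j (e , p , q) = e , Subset.x∈p∩q⁺ (Vec.lookup⇒[]= e _ p , Vec.lookup⇒[]= e _ q)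

      uncommon : ∀ k j → Subset.Nonempty (lookup first k Subset.∩ lookup second j) →
          Families.Hit families k j
      uncommon k j (e , p) with x , y ← Subset.x∈p∩q⁻ (lookup first k) (lookup second j) p =
        e , Vec.[]=⇒lookup x , Vec.[]=⇒lookup y

    hitting⇒ : Families.Hitting families → HasHittingSet I
    hitting⇒ (k , h) = k , λ j → common k j (h j)

    ⇒hitting : HasHittingSet I → Families.Hitting families
    ⇒hitting (k , h) = k , λ j → uncommon k j (h j)

  -- From a reduction to an algorithm

  total : ∀ {R} → (Fin R → ℕ) → ℕ
  total {zero}  f = 0
  total {suc R} f = f 0F + total (f ∘ Fin.suc)

  f≤total : ∀ {R} (f : Fin R → ℕ) p → f p ≤ total f
  f≤total f 0F    = m≤m+n (f 0F) _
  f≤total f (Fin.suc p) = ≤-trans (f≤total (f ∘ Fin.suc) p) (m≤n+m _ (f 0F))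

  length-concatMap-≤ : ∀ {A B : Set} (f : A → List B) {b} xs →
      (∀ {x} → x ∈ xs → length (f x) ≤ b) →
                       length (concatMap f xs) ≤ length xs * b
  length-concatMap-≤ f []       h = z≤n
  length-concatMap-≤ f (x ∷ xs) h = ≤-trans (≤-reflexive (length-++ (f x)))
    (+-mono-≤ (h (here refl)) (length-concatMap-≤ f xs (h ∘ there)))

  ≤-length-concatMap : ∀ {A B : Set} (f : A → List B) xs → (∀ x → 1 ≤ length (f x)) →
                       length xs ≤ length (concatMap f xs)
  ≤-length-concatMap f []       h = z≤n
  ≤-length-concatMap f (x ∷ xs) h = ≤-trans (+-mono-≤ (h x) (≤-length-concatMap f xs h))
    (≤-reflexive (sym (length-++ (f x))))

  module _ (E : Env) where

    length-emit₂ : ∀ r k l → length (emit₂ r E k l) ≤ 1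
    length-emit₂ r k l with eval (Rule.cond r) (E & (k , l)) ≡ᵇ 0
    ... | true  = z≤n
    ... | false = ≤-refl

    length-emit : ∀ r {T₂} → (∀ {k} → k < C₁ E r → C₂ E r k ≤ T₂) →
        length (emit r E) ≤ C₁ E r * T₂
    length-emit r {T₂} C₂≤ = subst (λ l → length (emit r E) ≤ l * T₂) (length-downFrom (C₁ E r))
      (length-concatMap-≤ (emit₁ r E) (downFrom (C₁ E r)) row)
      where
      row : ∀ {k} → k ∈ downFrom (C₁ E r) → length (emit₁ r E k) ≤ T₂
      row {k} k∈ = ≤-trans
        (length-concatMap-≤ (emit₂ r E k) (downFrom (C₂ E r k)) (λ {l} _ → length-emit₂ r k l))
        (≤-trans (≤-reflexive (trans (*-identityʳ _) (length-downFrom (C₂ E r k))))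
            (C₂≤ (∈-downFrom⁻ k∈)))

    length-emits : ∀ {R} (rs : Fin R → Rule) (T₂ : Fin R → ℕ) {b} →
      (∀ p {k} → k < C₁ E (rs p) → C₂ E (rs p) k ≤ T₂ p) → (∀ p → C₁ E (rs p) * T₂ p ≤ b) →
      length (emits rs E) ≤ R * b
    length-emits {zero}  rs T₂ C₂≤ h = z≤n
    length-emits {suc R} rs T₂ C₂≤ h = ≤-trans (≤-reflexive (length-++ (emit (rs 0F) E)))
      (+-mono-≤ (≤-trans (length-emit (rs 0F) (C₂≤ 0F)) (h 0F))
                (length-emits (rs ∘ Fin.suc) (T₂ ∘ Fin.suc) (λ p → C₂≤ (Fin.suc p))
                    (h ∘ Fin.suc)))

    emit-many : ∀ r → (∀ k → 1 ≤ length (emit₁ r E k)) → C₁ E r ≤ length (emit r E)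
    emit-many r h = ≤-trans (≤-reflexive (sym (length-downFrom (C₁ E r))))
      (≤-length-concatMap (emit₁ r E) (downFrom (C₁ E r)) h)

    emit≤emits : ∀ {R} (rs : Fin R → Rule) p → length (emit (rs p) E) ≤ length (emits rs E)
    emit≤emits rs 0F    = ≤-trans (m≤m+n _ _)
        (≤-reflexive (sym (length-++ (emit (rs 0F) E))))
    emit≤emits rs (Fin.suc p) = ≤-trans (emit≤emits (rs ∘ Fin.suc) p)
      (≤-trans (m≤n+m _ _) (≤-reflexive (sym (length-++ (emit (rs 0F) E)))))

  ruleFactor : Rule → ℕ
  ruleFactor r = (cost (Rule.count₁ r) + 3) + ((cost (Rule.count₂ r) + 8) + (5 + bodyCost r))

  -- The successor of `T₂` pays for outer rounds with an empty inner loop, and the leading 1 for an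
  -- empty outer loop.
  ruleCost-≤ : ∀ E r T₂ → ruleCost E r T₂ ≤ ruleFactor r * (1 + C₁ E r * suc T₂)
  ruleCost-≤ E r T₂ = begin
    a + 2 + (1 + c * (5 + (b + 2 + (1 + T₂ * y))))
      ≡⟨ +-assoc a 2 _ ⟩
    a + (3 + c * (5 + (b + 2 + (1 + T₂ * y))))
      ≡⟨ +-assoc a 3 _ ⟨
    a + 3 + c * (5 + (b + 2 + (1 + T₂ * y)))
      ≡⟨ cong (λ x → a + 3 + c * x) inner ⟩
    a + 3 + c * (b + 8 + T₂ * y)
      ≤⟨ +-mono-≤ (m≤m+n (a + 3) _) (*-monoʳ-≤ c spread) ⟩
    f + c * (f * suc T₂)
      ≡⟨ cong (f +_) (x∙yz≈y∙xz c f (suc T₂)) ⟩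
    f + f * (c * suc T₂)
      ≡⟨ *-suc f (c * suc T₂) ⟨
    f * (1 + c * suc T₂) ∎
    where
    open ≤-Reasoning
    a = cost (Rule.count₁ r)
    b = cost (Rule.count₂ r)
    c = C₁ E r
    y = 5 + bodyCost r
    f = ruleFactor r
    inner : 5 + (b + 2 + (1 + T₂ * y)) ≡ b + 8 + T₂ * y
    inner = trans (cong (5 +_) (+-assoc b 2 _))
        (trans (sym (+-assoc 5 b _)) (trans (cong (_+ (3 + T₂ * y)) (+-comm 5 b))
      (trans (+-assoc b 5 _) (sym (+-assoc b 8 _)))))
    spread : b + 8 + T₂ * y ≤ f * suc T₂
    spread = begin
      b + 8 + T₂ * y          ≤⟨ +-mono-≤ (≤-trans (m≤m+n (b + 8) y) (m≤n+m _ (a + 3)))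
                                          (*-monoʳ-≤ T₂
                                              (≤-trans (m≤n+m y (b + 8)) (m≤n+m _ (a + 3)))) ⟩
      f + T₂ * f              ≡⟨ *-comm (suc T₂) f ⟩
      f * suc T₂              ∎

  rulesCost-≤ : ∀ {R} E (rs : Fin R → Rule) T₂ {b} → (∀ p → 1 + C₁ E (rs p) * suc (T₂ p) ≤ b) →
                rulesCost E rs T₂ ≤ total (ruleFactor ∘ rs) * b
  rulesCost-≤ {zero}  E rs T₂ h = z≤n
  rulesCost-≤ {suc R} E rs T₂ {b} h = ≤-trans
    (+-mono-≤ (≤-trans (ruleCost-≤ E (rs 0F) (T₂ 0F))
        (*-monoʳ-≤ (ruleFactor (rs 0F)) (h 0F)))
              (rulesCost-≤ E (rs ∘ Fin.suc) (T₂ ∘ Fin.suc) (h ∘ Fin.suc)))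
    (≤-reflexive (sym (*-distribʳ-+ b (ruleFactor (rs 0F)) _)))

  -- What both graphs have to provide

  inputEnd : Families → ℕ
  inputEnd F = eval baseExp (Families.E F)

  -- The number of edges is O((n + 1) (U + 1)).
  area : Families → ℕ
  area F = suc (Families.n F) * suc (Families.U F)

  record Readable (F : Families) (r : Rule) : Set where
    private E = Families.E F
    field
      reads₁ : Reads (inputEnd F) (Rule.count₁ r) E
      reads₂ : ∀ {k} → k < C₁ E r → Reads (inputEnd F) (Rule.count₂ r) (E & (k , 0))
      readsᵇ : ∀ {k l} → k < C₁ E r → l < C₂ E r k →
               Reads (inputEnd F) (Rule.cond r) (E & (k , l)) ×
               Reads (inputEnd F) (Rule.src r) (E & (k , l)) ×
               Reads (inputEnd F) (Rule.dst r) (E & (k , l))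

  -- The factor `g` is 1 for the max and 2 for the roundtrip radius. The time bound of the
  -- approximation program holds only from some number of edges on; by `many`, all large n get
  -- there.
  record Reduction (radius : Digraph → ℕ∞) (L : ℕ) : Set₁ where
    field
      R        : ℕ
      rules    : Fin R → Rule
      vertices : Exp
      present  : ∀ F → Presentation rules vertices (Families.E F)
      width    : Families → Fin R → ℕ
      width-ok : ∀ F p {k} → k < C₁ (Families.E F) (rules p) →
          C₂ (Families.E F) (rules p) k ≤ width F p
      G        : ℕ
      area-ok  : ∀ F p → C₁ (Families.E F) (rules p) * suc (width F p) ≤ G * area F
      reads₀   : ∀ F → Reads (inputEnd F) vertices (Families.E F)
      readable : ∀ F p → Readable F (rules p)
      many     : ∀ F → Families.n F ≤ length (emits rules (Families.E F))
      g        : ℕ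
      0<g      : 0 < g
      yes-≤    : ∀ F → Families.n F ≤ 2 ^ Families.U F → Families.Hitting F →
                 radius (Presentation.graph (present F)) ≤∞ [ g * (L + 2) ]
      no-≥     : ∀ F → Families.n F ≤ 2 ^ Families.U F → ¬ Families.Hitting F →
                 [ g * (L + L) ] ≤∞ radius (Presentation.graph (present F))

  module _ (F : Families) where

    open Families F

    private
      M = area F

      n≤M : n ≤ M
      n≤M = ≤-trans (n≤1+n n) (m≤m*n (suc n) (suc U))

      U≤M : U ≤ M
      U≤M = ≤-trans (n≤1+n U) (m≤n*m (suc U) (suc n))

      n*U≤M : n * suc U ≤ M
      n*U≤M = *-monoˡ-≤ (suc U) (n≤1+n n)

      2+2n≤2M : 2 + (n + n) ≤ 2 * M
      2+2n≤2M = ≤-trans (≤-reflexive (trans (cong suc (sym (+-suc n n)))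
          (cong (suc n +_) (sym (+-identityʳ (suc n))))))
        (*-monoʳ-≤ 2 (m≤m*n (suc n) (suc U)))

      U+1+U≤2M : U + suc U ≤ 2 * M
      U+1+U≤2M = ≤-trans (≤-trans (+-monoˡ-≤ (suc U) (n≤1+n U))
          (≤-reflexive (cong (suc U +_) (sym (+-identityʳ (suc U))))))
        (*-monoʳ-≤ 2 (m≤n*m (suc U) (suc n)))

      scale-≤ : ∀ {x a b} c → x ≤ a * M → c * a ≤ b → x * c ≤ b * M
      scale-≤ {x} {a} {b} c p q = begin
        x * c         ≤⟨ *-monoˡ-≤ c p ⟩
        a * M * c     ≡⟨ *-comm (a * M) c ⟩
        c * (a * M)   ≡⟨ *-assoc c a M ⟨
        c * a * M     ≤⟨ *-monoˡ-≤ M q ⟩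
        b * M         ∎
        where open ≤-Reasoning

      one : ∀ {x} → x ≤ M → x ≤ 1 * M
      one p = ≤-trans p (≤-reflexive (sym (+-identityʳ M)))

      row-cell : ∀ {k l} → k < n → l < U → k * U + l < n * U
      row-cell {k} {l} k<n l<U = begin-strict
        k * U + l   <⟨ +-monoʳ-< (k * U) l<U ⟩
        k * U + U   ≡⟨ +-comm (k * U) U ⟩
        suc k * U   ≤⟨ *-monoˡ-≤ U k<n ⟩
        n * U       ∎
        where open ≤-Reasoning

      first-cell : ∀ {k l} → k < n → l < U → 2 + (k * U + l) < inputEnd F
      first-cell p q = +-monoʳ-< 2 (<-≤-trans (row-cell p q) (m≤m+n (n * U) _))

      second-cell : ∀ {k l} → k < n → l < U → 2 + (n * U + (k * U + l)) < inputEnd F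
      second-cell p q = +-monoʳ-< 2 (+-monoʳ-< (n * U)
        (<-≤-trans (row-cell p q) (≤-reflexive (sym (+-identityʳ (n * U))))))

      halved : ∀ {l} → l < U * 2 → l / 2 < U
      halved {l} = m<n*o⇒m/o<n {l} {U} {2}

    module _ (L : ℕ) where

      open MaxGraph L using (maxRules; K)

      maxWidth : Fin 7 → ℕ
      maxWidth 0F = 1
      maxWidth 1F = L
      maxWidth 2F = 1
      maxWidth 3F = 2
      maxWidth 4F = 1
      maxWidth 5F = U
      maxWidth 6F = U

      maxWidth-ok : ∀ p {k} → k < C₁ E (maxRules p) → C₂ E (maxRules p) k ≤ maxWidth p
      maxWidth-ok 0F _ = ≤-refl
      maxWidth-ok 1F _ = ≤-refl
      maxWidth-ok 2F _ = ≤-refl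
      maxWidth-ok 3F _ = ≤-refl
      maxWidth-ok 4F _ = ≤-refl
      maxWidth-ok 5F _ = ≤-refl
      maxWidth-ok 6F _ = ≤-refl

      private
        maxFactor = 2 * (1 + 2 * K)

        3≤ : 3 ≤ maxFactor
        3≤ = ≤-trans (s≤s (s≤s (s≤s z≤n))) (*-monoʳ-≤ 2
            (+-monoʳ-≤ 1 (*-monoʳ-≤ 2 (s≤s (z≤n {L})))))

      maxArea-ok : ∀ p → C₁ E (maxRules p) * suc (maxWidth p) ≤ 2 * (1 + 2 * K) * M
      -- The hub rule determines the factor: it has at most (1 + 2 K) M outer rounds, and its width
      -- 1 counts as 2.
      maxArea-ok 0F = scale-≤ {a = 1 + 2 * K} 2 (+-mono-≤ U≤M (begin
        (2 + (n + n)) * K   ≤⟨ *-monoˡ-≤ K 2+2n≤2M ⟩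
        2 * M * K           ≡⟨ *-assoc 2 M K ⟩
        2 * (M * K)         ≡⟨ cong (2 *_) (*-comm M K) ⟩
        2 * (K * M)         ≡⟨ *-assoc 2 K M ⟨
        2 * K * M           ∎)) ≤-refl
        where open ≤-Reasoning
      maxArea-ok 1F = scale-≤ {a = 2} K 2+2n≤2M (begin
        K * 2               ≤⟨ m≤n+m (K * 2) (2 + K * 2) ⟩
        2 + K * 2 + K * 2   ≡⟨ cong (λ x → 2 + x + x) (*-comm K 2) ⟩
        2 + 2 * K + 2 * K   ≡⟨ cong (2 +_) (cong (2 * K +_) (sym (+-identityʳ (2 * K)))) ⟩
        2 + 2 * (2 * K)     ≡⟨ *-distribˡ-+ 2 1 (2 * K) ⟨
        maxFactor           ∎)
        where open ≤-Reasoning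
      maxArea-ok 2F = scale-≤ {a = 1} 2 (one n≤M) (≤-trans (n≤1+n 2) 3≤)
      maxArea-ok 3F = scale-≤ {a = 1} 3 (one n≤M) 3≤
      maxArea-ok 4F = scale-≤ {a = 1} 2 (one U≤M) (≤-trans (n≤1+n 2) 3≤)
      maxArea-ok 5F = ≤-trans n*U≤M (m≤n*m M maxFactor {{>-nonZero (<-≤-trans z<s 3≤)}})
      maxArea-ok 6F = ≤-trans n*U≤M (m≤n*m M maxFactor {{>-nonZero (<-≤-trans z<s 3≤)}})

      maxReadable : ∀ p → Readable F (maxRules p)
      maxReadable 0F = _
      maxReadable 1F = _
      maxReadable 2F = _
      maxReadable 3F = _
      maxReadable 4F = _
      maxReadable 5F = record { readsᵇ = λ p q → (_ , second-cell p q) , _ }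
      maxReadable 6F = record { readsᵇ = λ p q → (_ , first-cell p q) , _ }

      maxMany : n ≤ length (emits maxRules E)
      maxMany = ≤-trans (emit-many E (maxRules 2F) (λ _ → ≤-refl)) (emit≤emits E maxRules 2F)

      open RoundtripGraph L using (rtRules)

      rtWidth : Fin 8 → ℕ
      rtWidth 0F = L
      rtWidth 1F = 2
      rtWidth 2F = U * 2
      rtWidth 3F = U * 2
      rtWidth 4F = suc U * 2
      rtWidth 5F = suc U * 2
      rtWidth 6F = U * 2
      rtWidth 7F = U * 2

      rtWidth-ok : ∀ p {k} → k < C₁ E (rtRules p) → C₂ E (rtRules p) k ≤ rtWidth p
      rtWidth-ok 0F _ = ≤-refl
      rtWidth-ok 1F _ = ≤-refl
      rtWidth-ok 2F _ = ≤-refl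
      rtWidth-ok 3F _ = ≤-refl
      rtWidth-ok 4F _ = ≤-refl
      rtWidth-ok 5F _ = ≤-refl
      rtWidth-ok 6F _ = ≤-refl
      rtWidth-ok 7F _ = ≤-refl

      private
        12≤ : ∀ {c} → c ≤ 12 → c ≤ 12 * K
        12≤ p = ≤-trans p (*-monoʳ-≤ 12 (s≤s (z≤n {L})))

        per-set : ∀ {x} → x ≤ 3 * suc U → n * x ≤ 12 * K * M
        per-set {x} p = begin
          n * x           ≤⟨ *-monoʳ-≤ n p ⟩
          n * (3 * suc U) ≡⟨ x∙yz≈y∙xz n 3 (suc U) ⟩
          3 * (n * suc U) ≤⟨ *-monoʳ-≤ 3 n*U≤M ⟩
          3 * M           ≤⟨ *-monoˡ-≤ M (12≤ (s≤s (s≤s (s≤s z≤n)))) ⟩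
          12 * K * M      ∎
          where open ≤-Reasoning

        set-row : suc (U * 2) ≤ 3 * suc U
        set-row = ≤-trans (≤-trans (n≤1+n _) (≤-reflexive (*-comm (suc U) 2)))
            (*-monoˡ-≤ (suc U) (n≤1+n 2))

        id-row : suc (suc U * 2) ≤ 3 * suc U
        id-row = ≤-trans (≤-reflexive (cong suc (*-comm (suc U) 2)))
            (+-monoˡ-≤ (2 * suc U) (s≤s (z≤n {U})))

      rtArea-ok : ∀ p → C₁ E (rtRules p) * suc (rtWidth p) ≤ 12 * K * M
      rtArea-ok 0F = scale-≤ {a = 2 * (2 * 2)} K
          (scale-≤ {a = 2 * 2} 2 (scale-≤ {a = 2} 2 U+1+U≤2M ≤-refl) ≤-refl)
        (≤-trans (≤-reflexive (*-comm K 8)) (*-monoˡ-≤ K (m≤m+n 8 4)))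
      -- The 12 stems from this rule, with at most 4 M outer rounds, each counted 2 + 1 times.
      rtArea-ok 1F = scale-≤ {a = 2 * 2} 3 (scale-≤ {a = 2} 2 U+1+U≤2M ≤-refl) (12≤ ≤-refl)
      rtArea-ok 2F = per-set set-row
      rtArea-ok 3F = per-set set-row
      rtArea-ok 4F = per-set id-row
      rtArea-ok 5F = per-set id-row
      rtArea-ok 6F = per-set set-row
      rtArea-ok 7F = per-set set-row

      rtReadable : ∀ p → Readable F (rtRules p)
      rtReadable 0F = _
      rtReadable 1F = _
      rtReadable 2F = record { readsᵇ = λ {k} {l} p q →
          _ , _ , (_ , ((_ , (_ , (_ , first-cell p (halved {l} q)))) , _)) }
      rtReadable 3F = record { readsᵇ = λ {k} {l} p q →
          _ , (_ , ((_ , (_ , (_ , (_ , first-cell p (halved {l} q))))) , _)) , _ }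
      rtReadable 4F = _
      rtReadable 5F = _
      rtReadable 6F = record { readsᵇ = λ {k} {l} p q → (_ , second-cell p (halved {l} q)) , _ }
      rtReadable 7F = record { readsᵇ = λ {k} {l} p q → (_ , second-cell p (halved {l} q)) , _ }

      -- Edges are counted at the digits, since the universe may be empty but there is always a
      -- digit.
      rtMany : n ≤ length (emits rtRules E)
      rtMany = ≤-trans (emit-many E (rtRules 4F) (λ _ → s≤s z≤n)) (emit≤emits E rtRules 4F)

  maxReduction : ∀ L → Reduction MaxRadius L
  maxReduction L = record
    { rules = maxRules ; vertices = maxOrder ; present = maxPresentation
    ; width = λ F → maxWidth F L ; width-ok = λ F → maxWidth-ok F L
    ; G = 2 * (1 + 2 * K) ; area-ok = λ F → maxArea-ok F L ; reads₀ = λ F → _ ; readable = λ F →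
        maxReadable F L
    ; many = λ F → maxMany F L ; g = 1 ; 0<g = z<s
    ; yes-≤ = λ F _ h → subst (λ t → MaxRadius (Presentation.graph (maxPresentation F)) ≤∞ [ t ])
        (sym (+-identityʳ (L + 2))) (maxRadius-yes F h)
    ; no-≥ = λ F _ h → subst (λ t → [ t ] ≤∞ MaxRadius (Presentation.graph (maxPresentation F)))
        (sym (+-identityʳ (L + L))) (maxRadius-no F h)
    }
    where open MaxGraph L

  roundtripReduction : ∀ L → Reduction RoundtripRadius L
  roundtripReduction L = record
    { rules = rtRules ; vertices = rtOrder ; present = rtPresentation
    ; width = λ F → rtWidth F L ; width-ok = λ F → rtWidth-ok F L
    ; G = 12 * K ; area-ok = λ F → rtArea-ok F L ; reads₀ = λ F → _ ; readable = λ F →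
        rtReadable F L
    ; many = λ F → rtMany F L ; g = 2 ; 0<g = z<s
    ; yes-≤ = λ F n≤ h → subst (λ t → RoundtripRadius (Presentation.graph (rtPresentation F)) ≤∞ [
        t ])
        (cong (L + 2 +_) (sym (+-identityʳ (L + 2)))) (rt-yes F n≤ h)
    ; no-≥ = λ F n≤ h → subst (λ t → [ t ] ≤∞ RoundtripRadius
        (Presentation.graph (rtPresentation F)))
        (cong (L + L +_) (sym (+-identityʳ (L + L)))) (rt-no F n≤ h)
    }
    where open RoundtripGraph L

  -- With c ≥ 1 the universe has at least ⌈log₂ n⌉ elements, so U binary digits suffice to number
  -- the sets.
  universe-large : ∀ {c} n → ℚ.1ℚ ℚ.≤ c → n ≤ 2 ^ universeSize c n
  universe-large {c} n (ℚ.*≤* 1≤c) = ≤-trans (n≤2^⌈log⌉ n) (^-monoʳ-≤ 2 (begin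
    l                           ≡⟨ m*n/n≡m l q ⟨
    l * q / q                   ≤⟨ /-monoˡ-≤ q
        (≤-trans (≤-reflexive (*-comm l q)) (*-monoˡ-≤ l q≤p)) ⟩
    ℤ.∣ ℚ.↥ c ∣ * l / q         ∎))
    where
    open ≤-Reasoning
    l = ⌈log₂ n ⌉
    q = ℚ.↧ₙ c
    +≤⇒≤∣∣ : ∀ {m i} → ℤ.+ m ℤ.≤ i → m ≤ ℤ.∣ i ∣
    +≤⇒≤∣∣ (ℤ.+≤+ p) = p
    q≤p : q ≤ ℤ.∣ ℚ.↥ c ∣
    q≤p = +≤⇒≤∣∣ (subst₂ ℤ._≤_ (ℤ.*-identityˡ (ℚ.↧ c)) (ℤ.*-identityʳ (ℚ.↥ c)) 1≤c)

  universe-small : ∀ c n → universeSize c n ≤ ℤ.∣ ℚ.↥ c ∣ * suc ⌊log₂ n ⌋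
  universe-small c n = ≤-trans (m/n≤m _ (ℚ.↧ₙ c)) (*-monoʳ-≤ ℤ.∣ ℚ.↥ c ∣ (⌈log⌉≤1+⌊log⌋ n))

  module _ {δ : ℚ.ℚ} (0<δ : ℚ.0ℚ ℚ.< δ) {g : ℕ} (0<g : 0 < g) where

    private
      L = 4 * ℚ.↧ₙ δ

      0<↧ : 0 < ℚ.↧ₙ δ
      0<↧ = z<s

    -- The radius is finite here, so the output 0, which stands for ∞, does not approximate it; only
    -- successors remain.
    accepts : ∀ {r} out → r ≤∞ [ g * (L + 2) ] →
              IsApproximation (ℤ.+ 2 ℚ./ 1 ℚ.- δ) r (decode∞ out) → verdict (g * (L + L)) out ≡ 1
    accepts {[ r ]} (suc out) [ r≤ ] A =
      verdict-yes {g * (L + L)} {out} (gap-separates (ℚ.↧ₙ δ) g r 0<↧ 0<g r≤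
          (approximation-gap δ 0<δ A))

    rejects : ∀ {r} out → [ g * (L + L) ] ≤∞ r →
              IsApproximation (ℤ.+ 2 ℚ./ 1 ℚ.- δ) r (decode∞ out) → verdict (g * (L + L)) out ≡ 0
    rejects {[ r ]} (suc out) [ ≤r ] (r≤ , _) =
      verdict-no {g * (L + L)} {out} (≤-trans ≤r r≤)
    -- An infinite radius forces the output 0, which `verdict` rejects for every threshold.
    rejects {⊤⁺}    zero      _      _        = refl

  log-power : ∀ {N} e → N ≤ 2 ^ e → ⌊log₂ N ⌋ ≤ e
  log-power e p = ≤-trans (⌊log₂⌋-mono-≤ p) (≤-reflexive (⌊log₂[2^n]⌋≡n e))

  -- 1 / (2 q) for ε = p / q
  saving : ℚ.ℚ → ℚ.ℚ
  saving ε = ℚ.mkℚ (ℤ.+ 1) (ℚ.ℚ.denominator-1 ε + ℚ.↧ₙ ε) (1-coprimeTo _)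

  -- The hitting set algorithm

  module Assembly {radius : Digraph → ℕ∞} {δ ε c : ℚ.ℚ}
    (0<ε : ℚ.0ℚ ℚ.< ε) (0<δ : ℚ.0ℚ ℚ.< δ) (1≤c : ℚ.1ℚ ℚ.≤ c)
    (Red : Reduction radius (4 * ℚ.↧ₙ δ))
    (alg : Algorithm (Approximating (ℤ.+ 2 ℚ./ 1 ℚ.- δ) radius) ε) where

    open Reduction Red

    private
      L = 4 * ℚ.↧ₙ δ
      threshold = g * (L + L)
      κ = ℤ.∣ ℚ.↥ c ∣
      -- Chosen for `suc U` ≤ (κ + 1) ℓ ≤ 2 ^ (κ + 1 + ℓ) ≤ 2 ^ (ℓ (κ + 2)).
      h = κ + 2

      -- Lies above the fixed registers and the evaluation stacks of all expressions.
      s : ℕ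
      s = 8 + (height vertices + (height baseExp + total (ruleHeight ∘ rules)))

      7<s : 7 < s
      7<s = m≤m+n 8 _

      -- With ℓ = 1 + ⌊log₂ n⌋, everything is bounded by powers of X = 2 ^ (ℓ h).
      roomExponent graphRate rate : ℕ
      roomExponent = deg (lit 2 ⊞ baseExp) + (2 * (R * G) + 2)
      graphRate    = Algorithm.wordRate alg * suc (h * deg vertices)
      rate = suc (h * deg vertices) + (suc (h * deg baseExp) + (suc (h * roomExponent) +
        (suc (h * suc threshold) + (suc (h * deg baseExp) + suc graphRate +
        total (λ p → suc (h * ruleDeg (rules p)))))))

      overheadFactor sizeFactor : ℕ
      overheadFactor = 9 + (cost baseExp + cost vertices) + 7 + 2 + 6 + total (ruleFactor ∘ rules)
          * (1 + G)
      sizeFactor     = (overheadFactor + R * G) * (2 * suc κ)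

      -- Here `k` is 2 q, `r` is 2 q - 1 and `e` is 4 q - 2. Written with the predecessor of q,
      -- `2 * q` computes to `suc r`, and `k` is the denominator of `saving ε`.
      q = ℚ.↧ₙ ε
      k = suc (ℚ.ℚ.denominator-1 ε + q)
      r = ℚ.ℚ.denominator-1 ε + (q + 0)
      e = r * 2

    open Solver s 7<s rules vertices threshold (Algorithm.program alg) using
        (solver; solver-correct)

    module _ (I : HSInstance c) where

      private
        n = HSInstance.n I
        U = HSInstance.U I
        ℓ = suc ⌊log₂ n ⌋
        X = 2 ^ (ℓ * h)
        F = families I
        E = Families.E F
        Γ = present F
        w = rate * ℓ
        m = length (emits rules E)

        open Presentation Γ using (graph; size-graph; encode-graph)

        n≤2^U : n ≤ 2 ^ U
        n≤2^U = universe-large n 1≤c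

        below-X : ∀ {v} d → v ≤ 2 ^ (d + ℓ) → d ≤ suc κ → v ≤ X
        below-X {v} d p d≤ = ≤-trans p (^-monoʳ-≤ 2 (begin
          d + ℓ             ≤⟨ +-monoˡ-≤ ℓ d≤ ⟩
          suc κ + ℓ         ≡⟨ +-comm (suc κ) ℓ ⟩
          ℓ + suc κ         ≤⟨ +-monoʳ-≤ ℓ (m≤n*m (suc κ) ℓ) ⟩
          ℓ + ℓ * suc κ     ≡⟨ *-suc ℓ (suc κ) ⟨
          ℓ * (2 + κ)       ≡⟨ cong (ℓ *_) (+-comm 2 κ) ⟩
          ℓ * h             ∎))
          where open ≤-Reasoning

        1+U≤ : suc U ≤ suc κ * ℓ
        1+U≤ = s≤s (≤-trans (universe-small c n) (m≤n+m _ ⌊log₂ n ⌋))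

        U<X : suc U ≤ X
        U<X = below-X (suc κ) (begin
          suc U               ≤⟨ 1+U≤ ⟩
          suc κ * ℓ           ≤⟨ *-mono-≤ (<⇒≤ (m<2^m (suc κ))) (<⇒≤ (m<2^m ℓ)) ⟩
          2 ^ suc κ * 2 ^ ℓ   ≡⟨ ^-distribˡ-+-* 2 (suc κ) ℓ ⟨
          2 ^ (suc κ + ℓ)     ∎) ≤-refl
          where open ≤-Reasoning

        n<X : suc n ≤ X
        n<X = below-X 0 (n<2^1+⌊log⌋ n) z≤n

        2≤X : 2 ≤ X
        2≤X = below-X 0 (m≤m^n 2 ℓ z<s) z≤n

        W : Within X E
        W = record { n≤ = <⇒≤ n<X ; U≤ = <⇒≤ U<X ; i≤ = z≤n ; j≤ = z≤n
                   ; inp≤ = input-≤ I (<⇒≤ n<X) (<⇒≤ U<X) (≤-trans (n≤1+n 1) 2≤X) }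

        X^ : ∀ d → X ^ d ≡ 2 ^ (ℓ * (h * d))
        X^ d = trans (^-*-assoc 2 (ℓ * h) d) (cong (2 ^_) (*-assoc ℓ h d))

        X^<2^w : ∀ d → suc (h * d) ≤ rate → X ^ d < 2 ^ w
        X^<2^w d p = subst (_< 2 ^ w) (sym (X^ d)) (^-monoʳ-< 2 ≤-refl (begin-strict
          ℓ * (h * d)       <⟨ *-monoʳ-< ℓ (n<1+n (h * d)) ⟩
          ℓ * suc (h * d)   ≡⟨ *-comm ℓ _ ⟩
          suc (h * d) * ℓ   ≤⟨ *-monoˡ-≤ ℓ p ⟩
          rate * ℓ          ∎))
          where open ≤-Reasoning

        skip₁ : ∀ {x} a {b} → x ≤ b → x ≤ a + b
        skip₁ a {b} p = ≤-trans p (m≤n+m b a)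

        r₁ = suc (h * deg vertices)
        r₂ = suc (h * deg baseExp)
        r₃ = suc (h * roomExponent)
        r₄ = suc (h * suc threshold)
        r₅ = suc (h * deg baseExp) + suc graphRate

        order-rate : r₁ ≤ rate
        order-rate = m≤m+n r₁ _

        base-rate : r₂ ≤ rate
        base-rate = skip₁ r₁ (m≤m+n r₂ _)

        room-rate : r₃ ≤ rate
        room-rate = skip₁ r₁ (skip₁ r₂ (m≤m+n r₃ _))

        threshold-rate : r₄ ≤ rate
        threshold-rate = skip₁ r₁ (skip₁ r₂ (skip₁ r₃ (m≤m+n r₄ _)))

        address-rate : r₅ ≤ rate
        address-rate = skip₁ r₁ (skip₁ r₂ (skip₁ r₃ (skip₁ r₄ (m≤m+n r₅ _))))

        rule-rate : ∀ p → suc (h * ruleDeg (rules p)) ≤ rate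
        rule-rate p = skip₁ r₁ (skip₁ r₂ (skip₁ r₃ (skip₁ r₄ (skip₁ r₅
          (f≤total (λ p → suc (h * ruleDeg (rules p))) p)))))

        M = area F

        m≤ : m ≤ R * (G * M)
        m≤ = length-emits E rules (width F) (width-ok F)
          (λ p → ≤-trans (*-monoʳ-≤ (C₁ E (rules p)) (n≤1+n (width F p))) (area-ok F p))

        room : 2 + eval baseExp E + 2 * m < 2 ^ w
        room = ≤-<-trans (arith-bound 2≤X plus (deg>0 (lit 2 ⊞ baseExp))
            (m≤n+m 1 (2 * (R * G) + 1) ▸ +-assoc′)
          (eval-bound 2≤X W (lit 2 ⊞ baseExp)) edges≤) (X^<2^w roomExponent room-rate)
          where
          open ≤-Reasoning
          infixl 1 _▸_
          _▸_ : ∀ {a b} → 0 < a → a ≡ b → 0 < b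
          p ▸ eq = subst (0 <_) eq p
          +-assoc′ : 2 * (R * G) + 1 + 1 ≡ 2 * (R * G) + 2
          +-assoc′ = +-assoc (2 * (R * G)) 1 1
          edges≤ : 2 * m ≤ X ^ (2 * (R * G) + 2)
          edges≤ = begin
            2 * m                           ≤⟨ *-monoʳ-≤ 2 m≤ ⟩
            2 * (R * (G * M))               ≡⟨ trans (cong (2 *_) (sym (*-assoc R G M)))
                (sym (*-assoc 2 (R * G) M)) ⟩
            2 * (R * G) * M                 ≤⟨ *-mono-≤
                (≤-trans (<⇒≤ (m<2^m (2 * (R * G)))) (^-monoˡ-≤ (2 * (R * G)) 2≤X))
                                                        (*-mono-≤ n<X
                                                            (≤-trans U<X (≤-reflexive
                                                                (sym (*-identityʳ X))))) ⟩
            X ^ (2 * (R * G)) * X ^ 2       ≡⟨ ^-distribˡ-+-* X (2 * (R * G)) 2 ⟨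
            X ^ (2 * (R * G) + 2)           ∎

        open Build {w} 7<s E 2≤X W rules vertices using (Buildable)

        buildable : Buildable
        buildable = record
          { input₀ = refl ; input₁ = refl ; input-end = input-end I
          ; order< = X^<2^w (deg vertices) order-rate ; base< = X^<2^w (deg baseExp) base-rate
          ; order-h = ≤-trans (+-monoʳ-≤ 7 (m≤m+n (height vertices) _)) (n≤1+n _)
          ; base-h = ≤-trans (+-monoʳ-≤ 7 (≤-trans (m≤m+n (height baseExp) _)
              (m≤n+m _ (height vertices)))) (n≤1+n _)
          ; order-rd = reads₀ F ; room = room
          ; rules-ok = λ p → record
            { small = X^<2^w (ruleDeg (rules p)) (rule-rate p)
            ; shallow = ≤-trans (+-monoʳ-≤ 7 (≤-trans (f≤total (ruleHeight ∘ rules) p)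
                (≤-trans (m≤n+m _ (height baseExp)) (m≤n+m _ (height vertices))))) (n≤1+n _)
            ; reads₁ = Readable.reads₁ (readable F p) ; reads₂ = Readable.reads₂ (readable F p)
            ; readsᵇ = Readable.readsᵇ (readable F p) } }

        N = eval vertices E
        v = Algorithm.wordRate alg * suc ⌊log₂ N ⌋

        v≤ : v ≤ graphRate * ℓ
        v≤ = begin
          Algorithm.wordRate alg * suc ⌊log₂ N ⌋
            ≤⟨ *-monoʳ-≤ (Algorithm.wordRate alg) (s≤s (log-power _
                 (≤-trans (eval-bound 2≤X W vertices) (≤-reflexive (X^ (deg vertices)))))) ⟩
          Algorithm.wordRate alg * suc (ℓ * (h * deg vertices))
            ≤⟨ *-monoʳ-≤ (Algorithm.wordRate alg)
                (+-monoˡ-≤ (ℓ * (h * deg vertices)) (s≤s (z≤n {⌊log₂ n ⌋}))) ⟩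
          Algorithm.wordRate alg * (ℓ + ℓ * (h * deg vertices))
            ≡⟨ cong (Algorithm.wordRate alg *_)
                (trans (sym (*-suc ℓ (h * deg vertices))) (*-comm ℓ _)) ⟩
          Algorithm.wordRate alg * (suc (h * deg vertices) * ℓ)
            ≡⟨ *-assoc (Algorithm.wordRate alg) _ ℓ ⟨
          graphRate * ℓ ∎
          where open ≤-Reasoning

        v≤w : v ≤ w
        v≤w = ≤-trans v≤ (*-monoˡ-≤ ℓ (≤-trans (n≤1+n graphRate)
          (≤-trans (m≤n+m (suc graphRate) (suc (h * deg baseExp))) address-rate)))

        fits : ∀ {a} → a < 2 ^ v → eval baseExp E + a < 2 ^ w
        fits {a} a< = begin-strict
          eval baseExp E + a
            <⟨ +-mono-≤-< (≤-trans (eval-bound 2≤X W baseExp) (≤-reflexive (X^ (deg baseExp))))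
                a< ⟩
          2 ^ (ℓ * (h * deg baseExp)) + 2 ^ v
            -- Passing to successors makes both exponents positive, hence both powers at least 2, as
            -- `m+n≤m*n` requires.
            ≤⟨ +-mono-≤ (^-monoʳ-≤ 2 (*-monoʳ-≤ ℓ (n≤1+n (h * deg baseExp))))
                        (^-monoʳ-≤ 2 (≤-trans v≤
                            (≤-trans (≤-reflexive (*-comm graphRate ℓ))
                                (*-monoʳ-≤ ℓ (n≤1+n graphRate))))) ⟩
          2 ^ (ℓ * suc (h * deg baseExp)) + 2 ^ (ℓ * suc graphRate)
            ≤⟨ m+n≤m*n (m≤m^n 2 (ℓ * suc (h * deg baseExp)) z<s) (m≤m^n 2 (ℓ * suc graphRate) z<s)
                ⟩
          2 ^ (ℓ * suc (h * deg baseExp)) * 2 ^ (ℓ * suc graphRate)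
            ≡⟨ ^-distribˡ-+-* 2 (ℓ * suc (h * deg baseExp)) _ ⟨
          2 ^ (ℓ * suc (h * deg baseExp) + ℓ * suc graphRate)
            ≡⟨ cong (2 ^_) (trans (sym (*-distribˡ-+ ℓ (suc (h * deg baseExp)) (suc graphRate)))
                (*-comm ℓ _)) ⟩
          2 ^ (r₅ * ℓ)
            ≤⟨ ^-monoʳ-≤ 2 (*-monoˡ-≤ ℓ address-rate) ⟩
          2 ^ w ∎
          where open ≤-Reasoning

        threshold< : suc threshold < 2 ^ w
        threshold< = ≤-<-trans (≤-trans (<⇒≤ (m<2^m (suc threshold)))
            (^-monoˡ-≤ (suc threshold) 2≤X))
          (X^<2^w (suc threshold) threshold-rate)

        M≤ : 0 < n → M ≤ 2 * suc κ * (n * ℓ)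
        M≤ 0<n = begin
          suc n * suc U               ≤⟨ *-mono-≤ (+-monoˡ-≤ n 0<n) 1+U≤ ⟩
          (n + n) * (suc κ * ℓ)       ≡⟨ cong (λ x → (n + x) * (suc κ * ℓ)) (+-identityʳ n) ⟨
          2 * n * (suc κ * ℓ)         ≡⟨ [m*n]*[o*p]≡[m*o]*[n*p] 2 n (suc κ) ℓ ⟩
          2 * suc κ * (n * ℓ)         ∎
          where open ≤-Reasoning

        size≤ : 0 < n → m ≤ sizeFactor * (n * ℓ)
        size≤ 0<n = begin
          m                                               ≤⟨ m≤ ⟩
          R * (G * M)                                     ≡⟨ *-assoc R G M ⟨
          R * G * M                                       ≤⟨ *-mono-≤
              (m≤n+m (R * G) overheadFactor) (M≤ 0<n) ⟩
          (overheadFactor + R * G) * (2 * suc κ * (n * ℓ)) ≡⟨ *-assoc (overheadFactor + R * G)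
              (2 * suc κ) (n * ℓ) ⟨
          sizeFactor * (n * ℓ)                            ∎
          where open ≤-Reasoning

        overhead≤ : 0 < n → ∀ {t t′} →
          t′ ≤ 9 + (cost baseExp + cost vertices) + (rulesCost E rules (width F) + 7)
              + (2 + 2 * t) + 6 →
          t′ ≤ sizeFactor * (n * ℓ) + 2 * t
        overhead≤ 0<n {t} {t′} t′≤ = begin
          t′                                  ≤⟨ t′≤ ⟩
          a + (x + 7) + (2 + 2 * t) + 6       ≡⟨ shuffle a x (2 * t) ⟩
          (a + 7 + 2 + 6) + x + 2 * t         ≤⟨ +-monoˡ-≤ (2 * t)
              (+-mono-≤ (m≤m*n (a + 7 + 2 + 6) M) rules≤) ⟩
          (a + 7 + 2 + 6) * M + y * (1 + G) * M + 2 * t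
            ≡⟨ cong (_+ 2 * t) (*-distribʳ-+ M (a + 7 + 2 + 6) (y * (1 + G))) ⟨
          overheadFactor * M + 2 * t
            ≤⟨ +-monoˡ-≤ (2 * t) (*-mono-≤ (m≤m+n overheadFactor (R * G)) (M≤ 0<n)) ⟩
          (overheadFactor + R * G) * (2 * suc κ * (n * ℓ)) + 2 * t
            ≡⟨ cong (_+ 2 * t) (*-assoc (overheadFactor + R * G) (2 * suc κ) (n * ℓ)) ⟨
          sizeFactor * (n * ℓ) + 2 * t        ∎
          where
          open ≤-Reasoning
          a = 9 + (cost baseExp + cost vertices)
          x = rulesCost E rules (width F)
          y = total (ruleFactor ∘ rules)
          shuffle : ∀ a x z → a + (x + 7) + (2 + z) + 6 ≡ (a + 7 + 2 + 6) + x + z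
          shuffle a x z = begin-equality
            a + (x + 7) + (2 + z) + 6   ≡⟨ cong (λ u → u + (2 + z) + 6)
                (trans (cong (a +_) (+-comm x 7)) (sym (+-assoc a 7 x))) ⟩
            a + 7 + x + (2 + z) + 6     ≡⟨ cong (_+ 6) (sym (+-assoc (a + 7 + x) 2 z)) ⟩
            a + 7 + x + 2 + z + 6       ≡⟨ +-assoc (a + 7 + x + 2) z 6 ⟩
            a + 7 + x + 2 + (z + 6)     ≡⟨ cong (a + 7 + x + 2 +_) (+-comm z 6) ⟩
            a + 7 + x + 2 + (6 + z)     ≡⟨ +-assoc (a + 7 + x + 2) 6 z ⟨
            a + 7 + x + 2 + 6 + z       ≡⟨ cong (_+ z)
                (trans (+-assoc (a + 7 + x) 2 6) (trans (+-assoc (a + 7) x 8)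
                                             (trans (cong (a + 7 +_) (+-comm x 8))
                                                 (trans (sym (+-assoc (a + 7) 8 x))
                                             (cong (_+ x) (sym (+-assoc (a + 7) 2 6))))))) ⟩
            (a + 7 + 2 + 6) + x + z     ∎
          rules≤ : x ≤ y * (1 + G) * M
          rules≤ = ≤-trans (rulesCost-≤ E rules (width F) {(1 + G) * M}
              (λ p → +-mono-≤ (s≤s z≤n) (area-ok F p)))
            (≤-reflexive (sym (*-assoc y (1 + G) M)))

      decided : ∀ out → IsApproximation (ℤ.+ 2 ℚ./ 1 ℚ.- δ) (radius graph) (decode∞ out) →
                Problem.Correct (HittingSet c) I (verdict threshold out)
      decided out A = go (Fin.any? λ k → Fin.all? λ j → Families.Hit? F k j)
        where
        go : Dec (Families.Hitting F) → Problem.Correct (HittingSet c) I (verdict threshold out)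
        go (yes h) = inj₁ (hitting⇒ I h , accepts 0<δ 0<g out (yes-≤ F n≤2^U h) A)
        go (no ¬h) = inj₂ (¬h ∘ ⇒hitting I , rejects 0<δ 0<g out (no-≥ F n≤2^U ¬h) A)

      fast : ∀ {t t′} → (Algorithm.cutoff alg ≤ size graph →
          t ≤ Algorithm.constant alg · size graph ^[2- ε ]) →
        t′ ≤ 9 + (cost baseExp + cost vertices) + (rulesCost E rules (width F) + 7) + (2 + 2 * t)
            + 6 →
        suc (Algorithm.cutoff alg) ≤ n →
        t′ ^ k * n ^ 1 ≤ timeConstant k e sizeFactor (Algorithm.constant alg) * n ^ (2 * k)
      fast {t} {t′} t≤ t′≤ cutoff≤ = subst
        (λ x → t′ ^ k * x ≤ timeConstant k e sizeFactor (Algorithm.constant alg) * n ^ (2 * k))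
        (sym (^-identityʳ n))
        (time-bound {q} {k} {r} {e} {sizeFactor} {Algorithm.constant alg} {n} {m} {t} {t′}
            {ℤ.∣ ℚ.↥ ε ∣}
          {{nonZero-e = e≢0}} {{nonZero-n = >-nonZero 0<n}}
              {{nonZero-m = >-nonZero (≤-trans 0<n (many F))}}
          k-eq refl refl e+2 k+2 (numerator>0 0<ε) (size≤ 0<n) (overhead≤ 0<n {t} {t′} t′≤)
          (subst (λ x → t ^ q * x ^ ℤ.∣ ℚ.↥ ε ∣ ≤ Algorithm.constant alg * x ^ (2 * q)) size-graph
            (t≤ (≤-trans (≤-trans (n≤1+n _) cutoff≤)
                (≤-trans (many F) (≤-reflexive (sym size-graph)))))))
        where
        0<n : 0 < n
        0<n = ≤-trans (s≤s z≤n) cutoff≤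
        numerator>0 : ∀ {ε} → ℚ.0ℚ ℚ.< ε → 0 < ℤ.∣ ℚ.↥ ε ∣
        numerator>0 {ℚ.mkℚ (ℤ.+ zero) _ _}  (ℚ.*<* (ℤ.+<+ ()))
        numerator>0 {ℚ.mkℚ (ℤ.+ suc _) _ _} _ = z<s
        numerator>0 {ℚ.mkℚ ℤ.-[1+ _ ] _ _}  (ℚ.*<* ())
        k-eq : q * 2 ≡ k
        k-eq = trans (*-comm q 2) (cong (q +_) (+-identityʳ q))
        e+2 : suc (suc e) ≡ 2 * k
        e+2 = trans (*-comm (suc r) 2) (cong (2 *_) (trans (*-comm 2 q) k-eq))
        k+2 : suc (suc k) ≤ 2 * k
        k+2 = ≤-trans (+-monoˡ-≤ k (s≤s (≤-trans (s≤s z≤n) (m≤n+m q (ℚ.ℚ.denominator-1 ε)))))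
          (≤-reflexive (cong (k +_) (sym (+-identityʳ k))))
        e≢0 : NonZero e
        e≢0 = m*n≢0 r 2 {{>-nonZero (≤-trans (s≤s z≤n) (m≤n+m (q + 0) (ℚ.ℚ.denominator-1 ε)))}}

      solve : ∃₂ λ t τ → Runs w solver (initial (encodeHS I)) t τ ×
        Problem.Correct (HittingSet c) I (output τ) ×
        (suc (Algorithm.cutoff alg) ≤ n →
          t ^ k * n ^ 1 ≤ timeConstant k e sizeFactor (Algorithm.constant alg) * n ^ (2 * k))
      solve = step₁ (Algorithm.solves alg graph)
        where
        Result = ∃₂ λ t τ → Runs w solver (initial (encodeHS I)) t τ ×
          Problem.Correct (HittingSet c) I (output τ) ×
          (suc (Algorithm.cutoff alg) ≤ n →
            t ^ k * n ^ 1 ≤ timeConstant k e sizeFactor (Algorithm.constant alg) * n ^ (2 * k))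
        step₁ : (∃₂ λ t τ → Runs v (Algorithm.program alg) (initial (encodeDigraph graph)) t τ ×
            IsApproximation (ℤ.+ 2 ℚ./ 1 ℚ.- δ) (radius graph) (decode∞ (output τ)) ×
            (Algorithm.cutoff alg ≤ size graph → t ≤ Algorithm.constant alg · size graph ^[2- ε
                ])) → Result
        step₁ (t , τ , run , approx , t≤) =
          step₂ (solver-correct 2≤X W buildable v≤w fits threshold< (width F) (width-ok F)
            (subst (λ xs → Runs v (Algorithm.program alg) (initial xs) t τ) encode-graph run))
          where
          step₂ : (∃₂ λ t′ τ′ → Runs w solver (initial (encodeHS I)) t′ τ′ ×
              output τ′ ≡ verdict threshold (output τ) ×
              t′ ≤ 9 + (cost baseExp + cost vertices) + (rulesCost E rules (width F) + 7)
                  + (2 + 2 * t) + 6) → Result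
          step₂ (t′ , τ′ , run′ , out , t′≤) = t′ , τ′ , run′
            , subst (Problem.Correct (HittingSet c) I) (sym out) (decided (output τ) approx)
            , fast {t} {t′} t≤ t′≤

    hittingSetAlgorithm : Algorithm (HittingSet c) (saving ε)
    hittingSetAlgorithm = record
      { program = solver ; wordRate = rate
      ; constant = timeConstant k e sizeFactor (Algorithm.constant alg)
      -- The successor excludes n = 0, for which no multiple of n log n could cover the overhead.
      ; cutoff = suc (Algorithm.cutoff alg) ; solves = solve }

  -- One saving has to serve all c: it depends on ε alone, while c only enters the word length and
  -- the constant.
  refute : ∀ {radius δ ε} → ℚ.0ℚ ℚ.< ε → ℚ.0ℚ ℚ.< δ → Reduction radius (4 * ℚ.↧ₙ δ) →
    Algorithm (Approximating (ℤ.+ 2 ℚ./ 1 ℚ.- δ) radius) ε → ¬ HittingSetConjecture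
  refute {ε = ε} 0<ε 0<δ Red alg conjecture = conjecture
    ( saving ε , ℚ.*<* (ℤ.+<+ (s≤s z≤n))
    , λ c 1≤c → Assembly.hittingSetAlgorithm 0<ε 0<δ 1≤c Red alg )

open import Defs
open import Data.Integer.Base using (+_)
open import Data.Product using (∃₂; _×_; _,_)
open import Data.Rational.Base using (ℚ; 0ℚ; _<_; _-_; _/_)
open import Data.Sum.Base using (_⊎_; [_,_]′)
open import Relation.Nullary using (¬_)
open HittingSetReduction using (refute; maxReduction; roundtripReduction)

theorem1p5 : (∃₂ λ (ε δ : ℚ) → 0ℚ < ε × 0ℚ < δ ×
    (Algorithm (Approximating (+ 2 / 1 - δ) RoundtripRadius) ε ⊎
    Algorithm (Approximating (+ 2 / 1 - δ) MaxRadius) ε)) →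
    ¬ HittingSetConjecture
theorem1p5 (ε , δ , 0<ε , 0<δ , alg) =
  [ refute 0<ε 0<δ (roundtripReduction _) , refute 0<ε 0<δ (maxReduction _) ]′ alg
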